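{- For every $\eta>0$ there exists $n_0=n_0(\eta)\in\mathbb N$ such that the following holds. Let $\ell_1,\dots,\ell_t\ge 3$ be integers with $n:=\ell_1+\dots+\ell_t\ge n_0$, and let $D_1,\dots,D_t$ be orientations of cycles of lengths $\ell_1,\dots,\ell_t$, respectively. If $G$ is an $n$-vertex digraph with $\delta^0(G)\ge \frac{n+t}{2}+\eta n$, then $G$ contains vertex-disjoint copies of $D_1,\dots,D_t$.
   Context: Digraphs have no loops and at most one edge in each direction between any pair of vertices. An orientation of a cycle is a digraph whose underlying graph is a cycle (no double edges). $\delta^0(G)$ denotes the minimum of all in-degrees and out-degrees of vertices of $G$. -}

module Defs where

open import Data.Bool using (Bool; true; false; if_then_else_)
open import Data.Nat using (ℕ; zero; suc; _≤_)
open import Data.Fin using (Fin; toℕ)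
open import Data.List using (List; map; allFin)
open import Data.Nat.ListAction using (sum)
open import Data.Product using (Σ; _×_)
open import Data.Sum using (_⊎_)
open import Relation.Binary.PropositionalEquality using (_≡_; _≢_)
open import Function.Definitions using (Injective)
open import Data.Integer using (+_)
open import Data.Rational using (ℚ; _/_)

record Digraph (n : ℕ) : Set where
  field
    adj      : Fin n → Fin n → Bool
    loopless : ∀ v → adj v v ≡ false
open Digraph public

Edge : ∀ {n} → Digraph n → Fin n → Fin n → Set
Edge G u v = adj G u v ≡ true

outdeg : ∀ {n} → Digraph n → Fin n → ℕ
outdeg {n} G v = sum (map (λ w → if adj G v w then 1 else 0) (allFin n))

indeg : ∀ {n} → Digraph n → Fin n → ℕ
indeg {n} G v = sum (map (λ w → if adj G w v then 1 else 0) (allFin n))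

ℕ→ℚ : ℕ → ℚ
ℕ→ℚ m = + m / 1

MinSemiDegreeAtLeast : ∀ {n} → Digraph n → ℚ → Set
MinSemiDegreeAtLeast {n} G q =
  ∀ (v : Fin n) → (q Data.Rational.≤ ℕ→ℚ (outdeg G v)) × (q Data.Rational.≤ ℕ→ℚ (indeg G v))

CycStep : ∀ {ℓ} → Fin ℓ → Fin ℓ → Set
CycStep {ℓ} a b = (suc (toℕ a) ≡ toℕ b) ⊎ ((suc (toℕ a) ≡ ℓ) × (toℕ b ≡ 0))

CycAdj : ∀ {ℓ} → Fin ℓ → Fin ℓ → Set
CycAdj a b = CycStep a b ⊎ CycStep b a

-- D is an orientation of a cycle of length ℓ: its underlying (undirected) graph
-- is isomorphic to the cycle C_ℓ (via a bijection σ of the vertex set), and there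
-- are no double edges.
IsCycleOrientation : ∀ {ℓ} → Digraph ℓ → Set
IsCycleOrientation {ℓ} D =
  Σ (Fin ℓ → Fin ℓ) λ σ →
    Injective _≡_ _≡_ σ
    × (∀ i j → (Edge D i j ⊎ Edge D j i) → CycAdj (σ i) (σ j))
    × (∀ i j → CycAdj (σ i) (σ j) → (Edge D i j ⊎ Edge D j i))
    × (∀ i j → Edge D i j → adj D j i ≡ false)

IsCopy : ∀ {ℓ n} → Digraph ℓ → Digraph n → (Fin ℓ → Fin n) → Set
IsCopy D G f = Injective _≡_ _≡_ f × (∀ i j → Edge D i j → Edge G (f i) (f j))

ContainsDisjointCopies : ∀ {t n} (ℓ : Fin t → ℕ) → ((k : Fin t) → Digraph (ℓ k)) → Digraph n → Set
ContainsDisjointCopies {t} {n} ℓ D G =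
  Σ ((k : Fin t) → Fin (ℓ k) → Fin n) λ f →
    (∀ k → IsCopy (D k) G (f k))
    × (∀ k k' i i' → k ≢ k' → f k i ≢ f k' i')

sumFin : ∀ {t} → (Fin t → ℕ) → ℕ
sumFin {t} ℓ = sum (map ℓ (allFin t))

{-# OPTIONS --safe #-}
module Submission where

-- A greedy packing steered by prices leaves few positions unfilled, and a small absorbing structure set aside beforehand
-- fills these. Long cycles are first cut into tiles of bounded length separated by single slots.
--
-- Absorption: a gadget is a path x r z on three consecutive positions. If a vertex w left over also fits between x and z
-- and r fits a free slot, then w can replace r and r can move to the slot. As any two vertices have many common neighbours
-- for any choice of directions, a positive proportion of all triples serves a given w and slot; choosing triples by
-- exponential weights yields a linear number of disjoint gadgets of which linearly many serve every w and slot.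
-- If almost all cycles are triangles, then t is close to n/3 and even three neighbourhoods meet, which closes a gadget to
-- a triangle.
--
-- Packing: the degree requirement is half the sum of the lengths plus the number t of tiles, plus a small proportion. The
-- quadratic potential of the deficits of all signed neighbourhoods prices the vertices, and placing a tile at most its
-- share of the total price keeps the potential small. Such a tile exists by averaging: outside the t most expensive
-- vertices every semidegree exceeds one half, so perfect matchings build parallel paths of average price, and a path is
-- closed through one of its more than t common neighbours, one of which is no more expensive than those t vertices.

-- Clearing denominators, every semidegree is at least `(n + t) / 2 + n / q`, where `q` is the
-- denominator of η. The packing asks every signed neighbourhood for `(len + 1) / 2` vertices per
-- remaining tile, plus a reserve: two neighbourhoods inside the vertices still to be used then
-- share more vertices than there are tiles left. The obstacle is to keep this true for all `2 * n`
-- neighbourhoods until few tiles remain. As tiles have bounded length, one placement changes each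
-- deficit by a bounded amount, so the potential gains O(n) per step and O(n²) in all. A vertex is
-- bad only if one of its deficits is linear in `n`, hence at most a constant number `c₀` of
-- vertices is bad at any time. That many spare vertices must exist, so `c₀` tiles are given up
-- beforehand and left to absorption together with the slots. The reserve shrinks with the remaining
-- length, so packing has to stop at a linear remainder. Absorption can take it over because a slot
-- enters only through two signed vertices around it: there are just `4 * (n * (n * n))`
-- combinations of slot and leftover vertex, whose logarithm is far below the number of gadgets.

module Proof where

  open import Defs
  open import Data.Bool using (Bool; true; false; if_then_else_; not; _∧_; T; _∨_)
  open import Data.Bool.Properties using () renaming (_≟_ to _≟ᵇ_)
  open import Data.Empty using (⊥; ⊥-elim)
  open import Data.Fin using (Fin; _≟_; toℕ)
  open import Data.Fin.Properties using (any?; toℕ<n; toℕ-injective)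
  import Data.Integer as ℤ
  import Data.Integer.Properties as ℤ
  open import Data.List using (List; []; _∷_; _++_; map; length; filterᵇ; allFin; concatMap; upTo; tabulate; take; drop)
  open import Data.List.Membership.Propositional using (_∈_; _∉_; find; lose)
  open import Data.List.Membership.Propositional.Properties using (∈-++⁻; ∈-++⁺ˡ; ∈-++⁺ʳ; ∈-map⁻; ∈-map⁺; ∈-∃++; ∈-allFin; ∈-upTo⁺; ∈-upTo⁻)
  open import Data.List.Properties using (++-assoc; length-tabulate; length-upTo; map-++; length-++; map-∘; length-map; map-id; map-tabulate; take++drop≡id; length-take; length-drop)
  open import Data.List.Relation.Binary.Permutation.Propositional using (_↭_; ↭-refl; ↭-sym; ↭-trans; prep; swap; ↭-reflexive; ↭⇒↭ₛ)
  open import Data.List.Relation.Binary.Permutation.Propositional.Properties using (∈-resp-↭; ↭-length; shift; map⁺; ++⁺ˡ; ++⁺ʳ; ++-comm)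
  import Data.List.Relation.Binary.Permutation.Setoid.Properties as PermutationSetoid
  open import Data.List.Relation.Unary.All as All using (All; []; _∷_)
  open import Data.List.Relation.Unary.AllPairs using (AllPairs; []; _∷_)
  import Data.List.Relation.Unary.AllPairs.Properties as AllPairsₚ
  open import Data.List.Relation.Unary.Any using (here; there)
  open import Data.List.Relation.Unary.Any.Properties using (concatMap⁺; concatMap⁻)
  open import Data.List.Relation.Unary.Unique.Propositional.Properties using (allFin⁺)
  open import Data.Maybe using (Maybe; just; nothing; is-just)
  open import Data.Maybe.Properties using (just-injective)
  import Data.Nat as ℕ
  open import Data.Nat using (>-nonZero; _<ᵇ_; _≤ᵇ_; ℕ; zero; suc; _+_; _*_; _∸_; _^_; _≤_; _<_; z≤n; s≤s; z<s)
  open import Data.Nat.DivMod using (_/_; _%_; m≡m%n+[m/n]*n; m%n<n)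
  open import Data.Nat.ListAction using (sum)
  open import Data.Nat.ListAction.Properties using (sum-++; sum-↭)
  open import Data.Nat.Properties hiding (_≟_)
  open import Data.Nat.Tactic.RingSolver using (solve-∀)
  open import Data.Product using (Σ; ∃; ∃₂; _×_; _,_; proj₁; proj₂)
  open import Data.Product.Properties using (,-injectiveˡ; ,-injectiveʳ; ≡-dec)
  import Data.Rational as ℚ
  open import Data.Rational.Base using (mkℚ)
  import Data.Rational.Properties as ℚ
  import Data.Rational.Unnormalised as ℚᵘ
  import Data.Rational.Unnormalised.Properties as ℚᵘ
  open import Data.Sum using (_⊎_; inj₁; inj₂; [_,_]′)
  open import Function using (_∘_; id; const; case_of_)
  open import Relation.Binary.Definitions using (tri<; tri≈; tri>)
  open import Relation.Binary.PropositionalEquality using (_≡_; _≢_; refl; sym; trans; cong; cong₂; subst; subst₂; setoid)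
  open import Relation.Nullary using (¬_; Dec; yes; no; does)
  open import Relation.Nullary.Decidable using (_×-dec_; _⊎-dec_; dec-true; dec-false)

  -- Linear arithmetic: the equation certifies that x ≤ y follows from a ≤ b, with slack k.
  linear : ∀ {a b x y} k → a ≤ b → x + b + k ≡ y + a → x ≤ y
  linear {a} {b} {x} {y} k h e =
    +-cancelʳ-≤ b x y (≤-trans (m≤m+n (x + b) k) (≤-trans (≤-reflexive e) (+-monoʳ-≤ y h)))

  -- Indicators and finite sums.

  ⟦_⟧ : Bool → ℕ
  ⟦ b ⟧ = if b then 1 else 0

  ⟦⟧≤1 : ∀ b → ⟦ b ⟧ ≤ 1
  ⟦⟧≤1 true = ≤-refl
  ⟦⟧≤1 false = z≤n

  ⟦⟧-true : ∀ b → 0 < ⟦ b ⟧ → b ≡ true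
  ⟦⟧-true true _ = refl
  ⟦⟧-true false ()

  ∧-true : ∀ a {b} → a ∧ b ≡ true → a ≡ true × b ≡ true
  ∧-true true e = refl , e
  ∧-true false ()

  ⟦∧not⟧ : ∀ a b → ⟦ a ⟧ ≤ ⟦ a ∧ not b ⟧ + ⟦ b ⟧
  ⟦∧not⟧ true true = ≤-refl
  ⟦∧not⟧ true false = ≤-refl
  ⟦∧not⟧ false b = z≤n

  ⟦∧⟧ : ∀ a b → ⟦ a ⟧ + ⟦ b ⟧ ≤ ⟦ a ∧ b ⟧ + 1
  ⟦∧⟧ true b = ≤-reflexive (+-comm 1 ⟦ b ⟧)
  ⟦∧⟧ false b = ⟦⟧≤1 b

  ∑ : ∀ {A : Set} → List A → (A → ℕ) → ℕ
  ∑ xs f = sum (map f xs)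

  ∑-cong : ∀ {A : Set} (xs : List A) {f g : A → ℕ} → (∀ x → f x ≡ g x) → ∑ xs f ≡ ∑ xs g
  ∑-cong [] e = refl
  ∑-cong (x ∷ xs) e = cong₂ _+_ (e x) (∑-cong xs e)

  ∑-mono : ∀ {A : Set} (xs : List A) {f g : A → ℕ} → (∀ x → x ∈ xs → f x ≤ g x) → ∑ xs f ≤ ∑ xs g
  ∑-mono [] h = z≤n
  ∑-mono (x ∷ xs) h = +-mono-≤ (h x (here refl)) (∑-mono xs (λ y y∈ → h y (there y∈)))

  ∑-mono′ : ∀ {A : Set} (xs : List A) {f g : A → ℕ} → (∀ x → f x ≤ g x) → ∑ xs f ≤ ∑ xs g
  ∑-mono′ xs h = ∑-mono xs (λ x _ → h x)

  ∑-+ : ∀ {A : Set} (xs : List A) (f g : A → ℕ) → ∑ xs (λ x → f x + g x) ≡ ∑ xs f + ∑ xs g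
  ∑-+ [] f g = refl
  ∑-+ (x ∷ xs) f g rewrite ∑-+ xs f g = eq (f x) (g x) (∑ xs f) (∑ xs g)
    where
    eq : ∀ a b c d → a + b + (c + d) ≡ a + c + (b + d)
    eq = solve-∀

  ∑-* : ∀ {A : Set} (xs : List A) c (f : A → ℕ) → ∑ xs (λ x → c * f x) ≡ c * ∑ xs f
  ∑-* [] c f = sym (*-zeroʳ c)
  ∑-* (x ∷ xs) c f rewrite ∑-* xs c f = sym (*-distribˡ-+ c (f x) (∑ xs f))

  ∑-*ʳ : ∀ {A : Set} (xs : List A) c (f : A → ℕ) → ∑ xs (λ x → f x * c) ≡ ∑ xs f * c
  ∑-*ʳ [] c f = refl
  ∑-*ʳ (x ∷ xs) c f rewrite ∑-*ʳ xs c f = sym (*-distribʳ-+ c (f x) (∑ xs f))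

  ∑-const : ∀ {A : Set} (xs : List A) c → ∑ xs (λ _ → c) ≡ length xs * c
  ∑-const [] c = refl
  ∑-const (x ∷ xs) c = cong (c +_) (∑-const xs c)

  ∑-zero : ∀ {A : Set} (xs : List A) → ∑ xs (λ _ → 0) ≡ 0
  ∑-zero xs = trans (∑-const xs 0) (*-zeroʳ (length xs))

  ∑-swap : ∀ {A B : Set} (xs : List A) (ys : List B) (f : A → B → ℕ) →
    ∑ xs (λ x → ∑ ys (f x)) ≡ ∑ ys (λ y → ∑ xs (λ x → f x y))
  ∑-swap [] ys f = sym (∑-zero ys)
  ∑-swap (x ∷ xs) ys f rewrite ∑-swap xs ys f = sym (∑-+ ys (f x) _)

  ∑-++ : ∀ {A : Set} (xs ys : List A) f → ∑ (xs ++ ys) f ≡ ∑ xs f + ∑ ys f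
  ∑-++ xs ys f rewrite map-++ f xs ys = sum-++ (map f xs) (map f ys)

  ∑-↭ : ∀ {A : Set} {xs ys : List A} f → xs ↭ ys → ∑ xs f ≡ ∑ ys f
  ∑-↭ f p = sum-↭ (map⁺ f p)

  ∑-map : ∀ {A B : Set} (g : A → B) xs f → ∑ (map g xs) f ≡ ∑ xs (f ∘ g)
  ∑-map g xs f = cong sum (sym (map-∘ xs))

  ∑-∈ : ∀ {A : Set} {xs : List A} {x} f → x ∈ xs → f x ≤ ∑ xs f
  ∑-∈ f (here refl) = m≤m+n _ _
  ∑-∈ f (there x∈) = ≤-trans (∑-∈ f x∈) (m≤n+m _ _)

  ∑-pick : ∀ {A : Set} (xs : List A) (f g : A → ℕ) → ∑ xs g < ∑ xs f → ∃ λ x → x ∈ xs × g x < f x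
  ∑-pick [] f g ()
  ∑-pick (x ∷ xs) f g h with suc (g x) ≤? f x
  ... | yes p = x , here refl , p
  ... | no ¬p with ∑-pick xs f g (≰⇒> λ q → <⇒≱ h (+-mono-≤ (≮⇒≥ ¬p) q))
  ...   | y , y∈ , q = y , there y∈ , q

  ∑-pick≤ : ∀ {A : Set} (xs : List A) (f g : A → ℕ) → 0 < length xs → ∑ xs f ≤ ∑ xs g → ∃ λ x → x ∈ xs × f x ≤ g x
  ∑-pick≤ xs f g pos h with ∑-pick xs (suc ∘ g) f (≤-trans (s≤s h) lt)
    where
    lt : suc (∑ xs g) ≤ ∑ xs (suc ∘ g)
    lt rewrite ∑-+ xs (const 1) g | ∑-const xs 1 | *-identityʳ (length xs) = +-monoˡ-≤ (∑ xs g) pos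
  ... | x , x∈ , s≤s p = x , x∈ , p

  ∑-filter : ∀ {A : Set} (p : A → Bool) xs f → ∑ xs f ≡ ∑ (filterᵇ p xs) f + ∑ (filterᵇ (not ∘ p) xs) f
  ∑-filter p [] f = refl
  ∑-filter p (x ∷ xs) f with p x | ∑-filter p xs f
  ... | true | ih rewrite ih = sym (+-assoc (f x) _ _)
  ... | false | ih rewrite ih = eq (f x) (∑ (filterᵇ p xs) f) _
    where
    eq : ∀ a b c → a + (b + c) ≡ b + (a + c)
    eq = solve-∀

  ∑-length : ∀ {A : Set} (xs : List A) → ∑ xs (const 1) ≡ length xs
  ∑-length xs = trans (∑-const xs 1) (*-identityʳ _)

  ∈-filterᵇ : ∀ {A : Set} (p : A → Bool) {x} xs → x ∈ filterᵇ p xs → x ∈ xs × p x ≡ true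
  ∈-filterᵇ p (y ∷ xs) x∈ with p y in eq
  ∈-filterᵇ p (y ∷ xs) (here refl) | true = here refl , eq
  ∈-filterᵇ p (y ∷ xs) (there x∈) | true = let a , b = ∈-filterᵇ p xs x∈ in there a , b
  ... | false = let a , b = ∈-filterᵇ p xs x∈ in there a , b

  ∈-↭-∷ : ∀ {A : Set} {x : A} {xs} → x ∈ xs → ∃ λ ys → xs ↭ x ∷ ys
  ∈-↭-∷ {x = x} x∈ with ∈-∃++ x∈
  ... | ys , zs , refl = ys ++ zs , shift x ys zs

  ⟦⟧-both : ∀ a b → 1 < ⟦ a ⟧ + ⟦ b ⟧ → a ≡ true × b ≡ true
  ⟦⟧-both true true h = refl , refl
  ⟦⟧-both true false (s≤s ())
  ⟦⟧-both false true (s≤s ())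
  ⟦⟧-both false false ()

  search : ∀ {A : Set} (p : A → Bool) xs → (∃ λ x → x ∈ xs × p x ≡ true) ⊎ (∑ xs (λ x → ⟦ p x ⟧) ≡ 0)
  search p [] = inj₂ refl
  search p (x ∷ xs) with p x in eq | search p xs
  ... | true | _ = inj₁ (x , here refl , eq)
  ... | false | inj₁ (y , y∈ , e) = inj₁ (y , there y∈ , e)
  ... | false | inj₂ e = inj₂ e

  -- Perfect matchings in bipartite graphs where every degree is at least half.

  module Matching {A B : Set} (R : A → B → Bool) where
    Edges : Set
    Edges = List (Σ A λ a → Σ B λ b → R a b ≡ true)

    left : Edges → List A
    left = map proj₁

    right : Edges → List B
    right = map (proj₁ ∘ proj₂)

    module _ (xs : List A) (ys : List B) (len : length xs ≡ length ys)
      (degˡ : ∀ x → x ∈ xs → length ys ≤ 2 * ∑ ys (λ y → ⟦ R x y ⟧))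
      (degʳ : ∀ y → y ∈ ys → length xs ≤ 2 * ∑ xs (λ x → ⟦ R x y ⟧)) where

      -- When x and y have no unmatched neighbours, some matched edge (a , b) has R x b and R a y, and it is replaced by these two.
      augment : ∀ m (ps : Edges) xr yr → length xr ≡ m → length yr ≡ m → left ps ++ xr ↭ xs → right ps ++ yr ↭ ys →
        ∃ λ (ps : Edges) → left ps ↭ xs × right ps ↭ ys
      augment zero ps [] [] _ _ p q = ps , ↭-trans (↭-reflexive (sym (++-[] (left ps)))) p , ↭-trans (↭-reflexive (sym (++-[] (right ps)))) q
        where
        ++-[] : ∀ {C : Set} (zs : List C) → zs ++ [] ≡ zs
        ++-[] [] = refl
        ++-[] (z ∷ zs) = cong (z ∷_) (++-[] zs)
      augment (suc m) ps (x ∷ xr) (y ∷ yr) lx ly p q with search (R x) (y ∷ yr) | search (λ a → R a y) (x ∷ xr)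
      ... | inj₁ (b , b∈ , r) | _ =
        let zs , σ = ∈-↭-∷ b∈ in
        augment m ((x , b , r) ∷ ps) xr zs (suc-injective lx) (suc-injective (trans (sym (↭-length σ)) ly))
          (↭-trans (↭-sym (shift x (left ps) xr)) p)
          (↭-trans (↭-sym (shift b (right ps) zs)) (↭-trans (++⁺ˡ (right ps) (↭-sym σ)) q))
      ... | inj₂ _ | inj₁ (a , a∈ , r) =
        let zs , σ = ∈-↭-∷ a∈ in
        augment m ((a , y , r) ∷ ps) zs yr (suc-injective (trans (sym (↭-length σ)) lx)) (suc-injective ly)
          (↭-trans (↭-sym (shift a (left ps) zs)) (↭-trans (++⁺ˡ (left ps) (↭-sym σ)) p))
          (↭-trans (↭-sym (shift y (right ps) yr)) q)
      ... | inj₂ ex | inj₂ ey = exchange (∑-pick ps (λ e → ⟦ R x (proj₁ (proj₂ e)) ⟧ + ⟦ R (proj₁ e) y ⟧) (const 1) many)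
        where
        nx : ∑ ys (λ b → ⟦ R x b ⟧) ≡ ∑ ps (λ e → ⟦ R x (proj₁ (proj₂ e)) ⟧)
        nx rewrite sym (∑-↭ (λ b → ⟦ R x b ⟧) q) | ∑-++ (right ps) (y ∷ yr) (λ b → ⟦ R x b ⟧) | ex
                 | ∑-map (proj₁ ∘ proj₂) ps (λ b → ⟦ R x b ⟧) = +-identityʳ _
        ny : ∑ xs (λ a → ⟦ R a y ⟧) ≡ ∑ ps (λ e → ⟦ R (proj₁ e) y ⟧)
        ny rewrite sym (∑-↭ (λ a → ⟦ R a y ⟧) p) | ∑-++ (left ps) (x ∷ xr) (λ a → ⟦ R a y ⟧) | ey
                 | ∑-map proj₁ ps (λ a → ⟦ R a y ⟧) = +-identityʳ _
        short : length ps < length xs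
        short = subst (length ps <_) (trans (sym (length-++ (left ps))) (↭-length p))
          (subst (λ k → length ps < k + suc (length xr)) (sym (length-map proj₁ ps)) (subst (length ps <_) (sym (+-suc _ _)) (s≤s (m≤m+n _ _))))
        x∈ : x ∈ xs
        x∈ = ∈-resp-↭ p (∈-resp-↭ (↭-sym (shift x (left ps) xr)) (here refl))
        y∈ : y ∈ ys
        y∈ = ∈-resp-↭ q (∈-resp-↭ (↭-sym (shift y (right ps) yr)) (here refl))
        -- All neighbours of `x` and `y` lie on matched edges, so the two degrees count at least
        -- `length xs` incidences on fewer than `length xs` matched edges: one of them is counted
        -- twice.
        many : ∑ ps (const 1) < ∑ ps (λ e → ⟦ R x (proj₁ (proj₂ e)) ⟧ + ⟦ R (proj₁ e) y ⟧)
        many rewrite ∑-length ps | ∑-+ ps (λ e → ⟦ R x (proj₁ (proj₂ e)) ⟧) (λ e → ⟦ R (proj₁ e) y ⟧) | sym nx | sym ny =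
          ≤-trans short (*-cancelˡ-≤ 2 (≤-trans (≤-reflexive (cong (length xs +_) (trans (+-identityʳ _) len)))
            (≤-trans (+-monoʳ-≤ _ (degˡ x x∈)) (≤-trans (+-monoˡ-≤ _ (degʳ y y∈))
              (≤-reflexive (trans (+-comm (2 * ∑ xs _) _) (sym (*-distribˡ-+ 2 (∑ ys _) _))))))))
        exchange : (∃ λ e → e ∈ ps × 1 < ⟦ R x (proj₁ (proj₂ e)) ⟧ + ⟦ R (proj₁ e) y ⟧) →
          ∃ λ (ps : Edges) → left ps ↭ xs × right ps ↭ ys
        exchange ((a , b , r) , e∈ , h) =
          let rx , ry = ⟦⟧-both (R x b) (R a y) h
              qs , σ = ∈-↭-∷ e∈
          in augment m ((x , b , rx) ∷ (a , y , ry) ∷ qs) xr yr (suc-injective lx) (suc-injective ly)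
            (↭-trans (↭-trans (prep x (++⁺ʳ xr (↭-sym (map⁺ proj₁ σ)))) (↭-sym (shift x (left ps) xr))) p)
            (↭-trans (↭-trans (swap b y ↭-refl) (↭-trans (prep y (++⁺ʳ yr (↭-sym (map⁺ (proj₁ ∘ proj₂) σ)))) (↭-sym (shift y (right ps) yr)))) q)

      matching : ∃ λ (ps : Edges) → left ps ↭ xs × right ps ↭ ys
      matching = augment (length xs) [] xs ys refl (sym len) ↭-refl ↭-refl

  not-true : ∀ {b} → not b ≡ true → b ≡ false
  not-true {false} _ = refl

  -- Lists of vertices: membership, multiplicity, and splitting by price.

  _==_ : ∀ {n} → Fin n → Fin n → Bool
  u == v = does (u ≟ v)

  ==-refl : ∀ {n} (u : Fin n) → (u == u) ≡ true
  ==-refl u with u ≟ u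
  ... | yes _ = refl
  ... | no ¬p = ⊥-elim (¬p refl)

  ==⇒≡ : ∀ {n} (u v : Fin n) → (u == v) ≡ true → u ≡ v
  ==⇒≡ u v e with u ≟ v
  ... | yes p = p
  ==⇒≡ u v () | no _

  _∈ᵇ_ : ∀ {n} → Fin n → List (Fin n) → Bool
  v ∈ᵇ [] = false
  v ∈ᵇ (x ∷ xs) = (x == v) ∨ (v ∈ᵇ xs)

  ∈⇒∈ᵇ : ∀ {n} {v : Fin n} {xs} → v ∈ xs → v ∈ᵇ xs ≡ true
  ∈⇒∈ᵇ {v = v} (here refl) rewrite ==-refl v = refl
  ∈⇒∈ᵇ {v = v} {x ∷ xs} (there v∈) with x == v
  ... | true = refl
  ... | false = ∈⇒∈ᵇ v∈

  ∉ᵇ⇒∉ : ∀ {n} {v : Fin n} {xs} → v ∈ᵇ xs ≡ false → v ∉ xs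
  ∉ᵇ⇒∉ e v∈ with trans (sym (∈⇒∈ᵇ v∈)) e
  ... | ()

  occ : ∀ {n} → Fin n → List (Fin n) → ℕ
  occ v xs = ∑ xs (λ x → ⟦ x == v ⟧)

  Nodup : ∀ {n} → List (Fin n) → Set
  Nodup xs = ∀ v → occ v xs ≤ 1

  ∈ᵇ≤occ : ∀ {n} (v : Fin n) xs → ⟦ v ∈ᵇ xs ⟧ ≤ occ v xs
  ∈ᵇ≤occ v [] = z≤n
  ∈ᵇ≤occ v (x ∷ xs) with x == v
  ... | true = s≤s z≤n
  ... | false = ∈ᵇ≤occ v xs

  ==-comm : ∀ {n} (u v : Fin n) → (u == v) ≡ (v == u)
  ==-comm u v with u ≟ v | v ≟ u
  ... | yes _ | yes _ = refl
  ... | no _ | no _ = refl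
  ... | yes p | no q = ⊥-elim (q (sym p))
  ... | no p | yes q = ⊥-elim (p (sym q))

  -- Double counting of the pairs with `x == v`. Only `vs` has to be free of repetitions, so `xs`
  -- may be any list.
  ∑-∈ᵇ-weighted : ∀ {n} (vs : List (Fin n)) → Nodup vs → ∀ xs f → ∑ vs (λ v → f v * ⟦ v ∈ᵇ xs ⟧) ≤ ∑ xs f
  ∑-∈ᵇ-weighted vs nd xs f = begin
    ∑ vs (λ v → f v * ⟦ v ∈ᵇ xs ⟧) ≤⟨ ∑-mono′ vs (λ v → *-monoʳ-≤ (f v) (∈ᵇ≤occ v xs)) ⟩
    ∑ vs (λ v → f v * ∑ xs (λ x → ⟦ x == v ⟧)) ≡⟨ ∑-cong vs (λ v → sym (∑-* xs (f v) (λ x → ⟦ x == v ⟧))) ⟩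
    ∑ vs (λ v → ∑ xs (λ x → f v * ⟦ x == v ⟧)) ≡⟨ ∑-cong vs (λ v → ∑-cong xs (λ x → relabel v x)) ⟩
    ∑ vs (λ v → ∑ xs (λ x → f x * ⟦ v == x ⟧)) ≡⟨ ∑-swap vs xs _ ⟩
    ∑ xs (λ x → ∑ vs (λ v → f x * ⟦ v == x ⟧)) ≡⟨ ∑-cong xs (λ x → ∑-* vs (f x) _) ⟩
    ∑ xs (λ x → f x * occ x vs) ≤⟨ ∑-mono′ xs (λ x → *-monoʳ-≤ (f x) (nd x)) ⟩
    ∑ xs (λ x → f x * 1) ≡⟨ ∑-cong xs (λ x → *-identityʳ (f x)) ⟩
    ∑ xs f ∎
    where
    open ≤-Reasoning
    relabel : ∀ v x → f v * ⟦ x == v ⟧ ≡ f x * ⟦ v == x ⟧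
    relabel v x with x ≟ v | v ≟ x
    ... | yes refl | yes _ = refl
    ... | yes p | no q = ⊥-elim (q (sym p))
    ... | no p | yes q = ⊥-elim (p (sym q))
    ... | no _ | no _ = trans (*-zeroʳ (f v)) (sym (*-zeroʳ (f x)))

  ∑-∈ᵇ : ∀ {n} (vs : List (Fin n)) → Nodup vs → ∀ xs → ∑ vs (λ v → ⟦ v ∈ᵇ xs ⟧) ≤ length xs
  ∑-∈ᵇ vs nd xs = ≤-trans (≤-reflexive (∑-cong vs (λ v → sym (*-identityˡ _))))
    (≤-trans (∑-∈ᵇ-weighted vs nd xs (const 1)) (≤-reflexive (∑-length xs)))

  Nodup-++ʳ : ∀ {n} (xs : List (Fin n)) {ys zs} → zs ↭ xs ++ ys → Nodup zs → Nodup ys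
  Nodup-++ʳ xs {ys} σ nd v = ≤-trans (m≤n+m _ (occ v xs))
    (≤-trans (≤-reflexive (trans (sym (∑-++ xs ys _)) (sym (∑-↭ _ σ)))) (nd v))

  extract-max : ∀ {A : Set} (y : A → ℕ) x xs → ∃₂ λ m ys → x ∷ xs ↭ m ∷ ys × (∀ u → u ∈ m ∷ ys → y u ≤ y m)
  extract-max y x [] = x , [] , ↭-refl , λ { u (here refl) → ≤-refl }
  extract-max y x (z ∷ xs) with extract-max y z xs
  ... | m , ys , σ , h with ≤-total (y x) (y m)
  ...   | inj₁ p = m , x ∷ ys , ↭-trans (prep x σ) (swap x m ↭-refl) ,
            λ { u (here refl) → ≤-refl ; u (there (here refl)) → p ; u (there (there u∈)) → h u (there u∈) }
  ...   | inj₂ p = x , z ∷ xs , ↭-refl ,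
            λ { u (here refl) → ≤-refl ; u (there u∈) → ≤-trans (h u (∈-resp-↭ σ u∈)) p }

  split-expensive : ∀ {A : Set} (y : A → ℕ) xs t → t < length xs → ∃₂ λ top rest → ∃ λ b →
    xs ↭ top ++ rest × length top ≡ t × (∀ u → u ∈ top → b ≤ y u) × (∀ u → u ∈ rest → y u ≤ b)
  -- With nothing set aside, any upper bound for all prices is a threshold, for instance their sum.
  split-expensive y xs zero _ = [] , xs , ∑ xs y , ↭-refl , refl , (λ u ()) , λ u u∈ → ∑-∈ y u∈
  split-expensive y xs (suc t) lt with split-expensive y xs t (<⇒≤ lt)
  ... | top , [] , b , σ , refl , _ , _ =
    ⊥-elim (<⇒≱ (<⇒≤ lt) (≤-reflexive (trans (↭-length σ) (trans (length-++ top) (+-identityʳ _)))))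
  ... | top , r ∷ rest , b , σ , refl , hi , lo with extract-max y r rest
  ...   | m , ys , τ , hm = m ∷ top , ys , y m , ↭-trans σ (↭-trans (++⁺ˡ top τ) (shift m top ys)) , refl ,
          (λ { u (here refl) → ≤-refl ; u (there u∈) → ≤-trans (lo m (∈-resp-↭ (↭-sym τ) (here refl))) (hi u u∈) }) ,
          λ u u∈ → hm u (there u∈)

  -- Signed walks and cheap cycles.

  module Walks {n : ℕ} (G : Digraph n) where

    V : Set
    V = Fin n

    -- The sign selects out- or in-neighbours. An arbitrary orientation becomes a sequence of signs,
    -- and `deg` covers both semidegrees.
    E : Bool → V → V → Bool
    E true u v = adj G u v
    E false u v = adj G v u

    E-flip : ∀ σ u v → E σ u v ≡ E (not σ) v u
    E-flip true u v = refl
    E-flip false u v = refl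

    all : List V
    all = allFin n

    deg : Bool → V → List V → ℕ
    deg σ v vs = ∑ vs (λ u → ⟦ E σ v u ⟧)

    -- Walk s j a h xs: a path from a to h with j edges, the i-th one directed according to s i; xs lists its vertices, latest first.
    data Walk (s : ℕ → Bool) : ℕ → V → V → List V → Set where
      start : ∀ v → Walk s 0 v v (v ∷ [])
      step  : ∀ {j a h xs} → Walk s j a h xs → ∀ v → E (s j) h v ≡ true → v ∈ᵇ xs ≡ false → Walk s (suc j) a v (v ∷ xs)

    Walk-length : ∀ {s j a h xs} → Walk s j a h xs → length xs ≡ suc j
    Walk-length (start v) = refl
    Walk-length (step w v _ _) = cong suc (Walk-length w)

    Walk-head : ∀ {s j a h xs} → Walk s j a h xs → h ∈ xs
    Walk-head (start v) = here refl
    Walk-head (step w v _ _) = here refl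

    Walk-start : ∀ {s j a h xs} → Walk s j a h xs → a ∈ xs
    Walk-start (start v) = here refl
    Walk-start (step w v _ _) = there (Walk-start w)

    Walk-remove : ∀ {s j a h xs vs} → Walk s j a h xs → (∀ u → u ∈ xs → u ∈ vs) → ∃ λ rest → vs ↭ xs ++ rest
    Walk-remove (start v) sub = ∈-↭-∷ (sub v (here refl))
    Walk-remove {xs = _ ∷ xs} (step w v _ v∉) sub with Walk-remove w (λ u u∈ → sub u (there u∈))
    ... | rest , σ with ∈-++⁻ xs (∈-resp-↭ σ (sub v (here refl)))
    ...   | inj₁ v∈ = ⊥-elim (∉ᵇ⇒∉ v∉ v∈)
    ...   | inj₂ v∈ with ∈-↭-∷ v∈
    ...     | rest′ , τ = rest′ , ↭-trans σ (↭-trans (++⁺ˡ xs τ) (shift v xs rest′))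

    record Path (s : ℕ → Bool) (j : ℕ) : Set where
      constructor path
      field
        {first last} : V
        {verts} : List V
        walk : Walk s j first last verts
    open Path public

    -- All walks grow simultaneously, their heads always forming a permutation of vs, so that every position of a walk is equidistributed over vs.
    parallel-walks : ∀ vs Λ → Nodup vs → (∀ v σ → v ∈ vs → length vs + 2 * Λ ≤ 2 * deg σ v vs) →
      ∀ s j → j ≤ Λ → ∃ λ (ws : List (Path s j)) → map last ws ↭ vs × (∀ f → ∑ ws (λ w → ∑ (verts w) f) ≡ suc j * ∑ vs f)
    parallel-walks vs Λ nd big s zero _ = map (path ∘ start) vs ,
      ↭-reflexive (trans (sym (map-∘ vs)) (map-id vs)) ,
      λ f → trans (∑-map (path ∘ start) vs _) (trans (∑-cong vs (λ v → +-identityʳ (f v))) (sym (+-identityʳ _)))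
    parallel-walks vs Λ nd big s (suc j) j<Λ with parallel-walks vs Λ nd big s j (<⇒≤ j<Λ)
    ... | ws , heads , total = extended
      where
      ok : Path s j → V → Bool
      ok w v = E (s j) (last w) v ∧ not (v ∈ᵇ verts w)
      open Matching ok
      len : length ws ≡ length vs
      len = trans (sym (length-map last ws)) (↭-length heads)
      halve : ∀ {a b c} → length vs + 2 * Λ ≤ 2 * a → a ≤ b + c → c ≤ Λ → length vs ≤ 2 * b
      halve {a} {b} {c} h₁ h₂ h₃ = +-cancelʳ-≤ (2 * Λ) _ _ (≤-trans h₁ (≤-trans (*-monoʳ-≤ 2 (≤-trans h₂ (+-monoʳ-≤ b h₃))) (≤-reflexive (*-distribˡ-+ 2 b Λ))))
      -- A head loses only the vertices of its own walk, at most `Λ` of them.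
      degˡ : ∀ w → w ∈ ws → length vs ≤ 2 * ∑ vs (λ v → ⟦ ok w v ⟧)
      degˡ w w∈ = halve {b = ∑ vs (λ v → ⟦ ok w v ⟧)} (big (last w) (s j) (∈-resp-↭ heads (∈-map⁺ last w∈)))
        (≤-trans (∑-mono′ vs (λ v → ⟦∧not⟧ _ (v ∈ᵇ verts w))) (≤-reflexive (∑-+ vs (λ v → ⟦ ok w v ⟧) (λ v → ⟦ v ∈ᵇ verts w ⟧))))
        (≤-trans (∑-∈ᵇ vs nd (verts w)) (≤-trans (≤-reflexive (Walk-length (walk w))) j<Λ))
      -- As the heads permute `vs`, the degree of `v` counts the walks whose head is adjacent to it.
      -- By `total` for the indicator of `v`, at most `suc j ≤ Λ` walks already contain `v`.
      degʳ : ∀ v → v ∈ vs → length ws ≤ 2 * ∑ ws (λ w → ⟦ ok w v ⟧)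
      degʳ v v∈ = ≤-trans (≤-reflexive len) (halve (big v (not (s j)) v∈)
        (≤-trans (≤-reflexive heads-adjacent)
          (≤-trans (∑-mono′ ws (λ w → ⟦∧not⟧ _ (v ∈ᵇ verts w))) (≤-reflexive (∑-+ ws _ _))))
        (≤-trans (∑-mono′ ws (λ w → ∈ᵇ≤occ v (verts w)))
          (≤-trans (≤-reflexive (total (λ x → ⟦ x == v ⟧))) (≤-trans (*-monoʳ-≤ (suc j) (nd v)) (≤-trans (≤-reflexive (*-identityʳ _)) j<Λ)))))
        where
        heads-adjacent : deg (not (s j)) v vs ≡ ∑ ws (λ w → ⟦ E (s j) (last w) v ⟧)
        heads-adjacent = trans (∑-cong vs (λ u → cong ⟦_⟧ (sym (E-flip (s j) u v))))
          (trans (sym (∑-↭ _ heads)) (∑-map last ws _))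
      grow : (Σ (Path s j) λ w → Σ V λ v → ok w v ≡ true) → Path s (suc j)
      grow (w , v , r) = let e , f = ∧-true (E (s j) (last w) v) r in path (step (walk w) v e (not-true f))
      extended : ∃ λ (ws : List (Path s (suc j))) → map last ws ↭ vs × (∀ f → ∑ ws (λ w → ∑ (verts w) f) ≡ suc (suc j) * ∑ vs f)
      extended with matching ws vs len degˡ degʳ
      ... | ps , lp , rp = map grow ps , ↭-trans (↭-reflexive (sym (map-∘ ps))) rp ,
        λ f → trans (∑-map grow ps _) (trans (∑-+ ps (λ p → f (proj₁ (proj₂ p))) (λ p → ∑ (verts (proj₁ p)) f))
          (cong₂ _+_ (trans (sym (∑-map (proj₁ ∘ proj₂) ps f)) (∑-↭ f rp))
            (trans (sym (∑-map proj₁ ps (λ w → ∑ (verts w) f))) (trans (∑-↭ _ lp) (total f)))))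

    -- Inclusion-exclusion for two neighbourhoods inside `vs`, then deletion of `xs`; subtraction is
    -- avoided by bounding the degrees from above.
    common : ∀ vs h a σ τ xs → Nodup vs →
      deg σ h vs + deg τ a vs ≤ ∑ vs (λ v → ⟦ (E σ h v ∧ E τ a v) ∧ not (v ∈ᵇ xs) ⟧) + length xs + length vs
    common vs h a σ τ xs nd = begin
      deg σ h vs + deg τ a vs ≡⟨ ∑-+ vs (λ v → ⟦ E σ h v ⟧) (λ v → ⟦ E τ a v ⟧) ⟨
      ∑ vs (λ v → ⟦ E σ h v ⟧ + ⟦ E τ a v ⟧) ≤⟨ ∑-mono′ vs (λ v → ⟦∧⟧ (E σ h v) (E τ a v)) ⟩
      ∑ vs (λ v → ⟦ E σ h v ∧ E τ a v ⟧ + 1) ≡⟨ ∑-+ vs (λ v → ⟦ E σ h v ∧ E τ a v ⟧) (const 1) ⟩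
      ∑ vs (λ v → ⟦ E σ h v ∧ E τ a v ⟧) + ∑ vs (const 1)
        ≤⟨ +-mono-≤ (∑-mono′ vs (λ v → ⟦∧not⟧ (E σ h v ∧ E τ a v) (v ∈ᵇ xs))) (≤-reflexive (∑-length vs)) ⟩
      ∑ vs (λ v → ⟦ ok v ⟧ + ⟦ v ∈ᵇ xs ⟧) + length vs ≡⟨ cong (_+ length vs) (∑-+ vs (λ v → ⟦ ok v ⟧) (λ v → ⟦ v ∈ᵇ xs ⟧)) ⟩
      ∑ vs (λ v → ⟦ ok v ⟧) + ∑ vs (λ v → ⟦ v ∈ᵇ xs ⟧) + length vs
        ≤⟨ +-monoˡ-≤ (length vs) (+-monoʳ-≤ (∑ vs (λ v → ⟦ ok v ⟧)) (∑-∈ᵇ vs nd xs)) ⟩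
      ∑ vs (λ v → ⟦ ok v ⟧) + length xs + length vs ∎
      where
      open ≤-Reasoning
      ok : V → Bool
      ok v = (E σ h v ∧ E τ a v) ∧ not (v ∈ᵇ xs)

    -- `M` is the number of vertices left after setting `t` aside, `S` their total price, and `b` a
    -- price separating the two groups. Divided by `M`, `cost` says that a cycle of `m + 2` vertices
    -- costs at most `m + 1` average prices `S / M` plus one threshold price.
    record CheapCycles (vs : List V) (t Λ : ℕ) (y : V → ℕ) : Set where
      field
        M S b   : ℕ
        size    : t + M ≡ length vs
        M>0     : 0 < M
        budget  : S + t * b ≤ ∑ vs y
        cycle   : ∀ s m → suc (suc m) ≤ Λ → Path s (suc m)
        closed  : ∀ s m lt → E (s (suc m)) (last (cycle s m lt)) (first (cycle s m lt)) ≡ true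
        within  : ∀ s m lt u → u ∈ verts (cycle s m lt) → u ∈ vs
        cost    : ∀ s m lt → M * ∑ (verts (cycle s m lt)) y ≤ suc m * S + M * b

    -- The t most expensive vertices are kept out of the walks; the vertex closing a walk has more than t candidates, so one of them is not among those t.
    cheap-cycles : ∀ vs t Λ y → Nodup vs → t < length vs →
      (∀ v σ → v ∈ vs → length vs + t + 2 * Λ ≤ 2 * deg σ v vs) → CheapCycles vs t Λ y
    cheap-cycles vs t Λ y nd t< big with split-expensive y vs t t<
    ... | top , R , b , σ , refl , hi , lo = record
      { M = length R
      ; S = ∑ R y
      ; b = b
      ; size = sym len
      ; M>0 = pos
      ; budget = budget
      ; cycle = λ s m lt → proj₁ (closure s m lt)
      ; closed = λ s m lt → proj₁ (proj₂ (closure s m lt))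
      ; within = λ s m lt → proj₁ (proj₂ (proj₂ (closure s m lt)))
      ; cost = λ s m lt → proj₂ (proj₂ (proj₂ (closure s m lt)))
      }
      where
      open ≤-Reasoning
      len : length vs ≡ length top + length R
      len = trans (↭-length σ) (length-++ top)
      pos : 0 < length R
      pos = +-cancelˡ-≤ (length top) 1 (length R) (≤-trans (≤-reflexive (+-comm (length top) 1)) (≤-trans t< (≤-reflexive len)))
      split : ∀ f → ∑ vs f ≡ ∑ top f + ∑ R f
      split f = trans (∑-↭ f σ) (∑-++ top R f)
      budget : ∑ R y + length top * b ≤ ∑ vs y
      budget = begin
        ∑ R y + length top * b ≡⟨ cong (∑ R y +_) (∑-const top b) ⟨
        ∑ R y + ∑ top (const b) ≤⟨ +-monoʳ-≤ (∑ R y) (∑-mono top hi) ⟩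
        ∑ R y + ∑ top y ≡⟨ trans (+-comm (∑ R y) _) (sym (split y)) ⟩
        ∑ vs y ∎
      R⊆ : ∀ {v} → v ∈ R → v ∈ vs
      R⊆ v∈ = ∈-resp-↭ (↭-sym σ) (∈-++⁺ʳ top v∈)
      count-top : ∀ (p : V → Bool) → ∑ top (λ v → ⟦ p v ⟧) ≤ length top
      count-top p = ≤-trans (∑-mono′ top (λ v → ⟦⟧≤1 (p v))) (≤-reflexive (∑-length top))
      -- Setting `t` vertices aside shortens the list by `t` but may lower twice the degree by
      -- `2 * t`; the summand `t` in the hypothesis makes up the difference.
      bigR : ∀ v τ → v ∈ R → length R + 2 * Λ ≤ 2 * deg τ v R
      bigR v τ v∈ = +-cancelˡ-≤ (2 * length top) _ _ (begin
        2 * length top + (length R + 2 * Λ) ≡⟨ eq (length top) (length R) Λ ⟩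
        length top + length R + length top + 2 * Λ ≡⟨ cong (λ k → k + length top + 2 * Λ) len ⟨
        length vs + length top + 2 * Λ ≤⟨ big v τ (R⊆ v∈) ⟩
        2 * deg τ v vs ≡⟨ cong (2 *_) (split (λ u → ⟦ E τ v u ⟧)) ⟩
        2 * (deg τ v top + deg τ v R) ≤⟨ *-monoʳ-≤ 2 (+-monoˡ-≤ (deg τ v R) (count-top (E τ v))) ⟩
        2 * (length top + deg τ v R) ≡⟨ *-distribˡ-+ 2 (length top) _ ⟩
        2 * length top + 2 * deg τ v R ∎)
        where
        eq : ∀ a b c → 2 * a + (b + 2 * c) ≡ a + b + a + 2 * c
        eq = solve-∀
      closure : ∀ s m → suc (suc m) ≤ Λ → ∃ λ (p : Path s (suc m)) → E (s (suc m)) (last p) (first p) ≡ true ×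
        (∀ u → u ∈ verts p → u ∈ vs) × length R * ∑ (verts p) y ≤ suc m * ∑ R y + length R * b
      closure s m lt with parallel-walks R Λ (Nodup-++ʳ top σ nd) bigR s m (≤-trans (n≤1+n m) (<⇒≤ lt))
      ... | ws , heads , total = close (∑-pick≤ ws (λ w → length R * ∑ (verts w) y) (const (suc m * ∑ R y))
                                   (≤-trans pos (≤-reflexive (sym len-ws))) (≤-reflexive average))
        where
        len-ws : length ws ≡ length R
        len-ws = trans (sym (length-map last ws)) (↭-length heads)
        average : ∑ ws (λ w → length R * ∑ (verts w) y) ≡ ∑ ws (const (suc m * ∑ R y))
        average = trans (∑-* ws (length R) _) (trans (cong (length R *_) (total y))
          (trans (cong (_* (suc m * ∑ R y)) (sym len-ws)) (sym (∑-const ws _))))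
        -- Equidistribution applied to the indicator of the complement of `R`: its total over all
        -- walks is 0, so no walk leaves `R`.
        inR : ∀ w → w ∈ ws → ∀ u → u ∈ verts w → u ∈ᵇ R ≡ true
        inR w w∈ u u∈ with u ∈ᵇ R in eq
        ... | true = refl
        ... | false = ⊥-elim (<⇒≱ z<s (begin
            1 ≡⟨ cong (λ c → ⟦ not c ⟧) eq ⟨
            ⟦ not (u ∈ᵇ R) ⟧ ≤⟨ ∑-∈ (λ u → ⟦ not (u ∈ᵇ R) ⟧) u∈ ⟩
            ∑ (verts w) (λ u → ⟦ not (u ∈ᵇ R) ⟧) ≤⟨ ∑-∈ (λ w → ∑ (verts w) (λ u → ⟦ not (u ∈ᵇ R) ⟧)) w∈ ⟩
            ∑ ws (λ w → ∑ (verts w) (λ u → ⟦ not (u ∈ᵇ R) ⟧)) ≡⟨ total _ ⟩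
            suc m * ∑ R (λ u → ⟦ not (u ∈ᵇ R) ⟧) ≤⟨ *-monoʳ-≤ (suc m) (∑-mono R (λ u u∈ → ≤-reflexive (cong (λ c → ⟦ not c ⟧) (∈⇒∈ᵇ u∈)))) ⟩
            suc m * ∑ R (const 0) ≡⟨ trans (cong (suc m *_) (∑-zero R)) (*-zeroʳ (suc m)) ⟩
            0 ∎))
        close : (∃ λ w → w ∈ ws × length R * ∑ (verts w) y ≤ suc m * ∑ R y) → _
        close (w , w∈ , cheap) = found (search ok R)
          where
          xs : List V
          xs = verts w
          ok : V → Bool
          ok v = (E (s m) (last w) v ∧ E (not (s (suc m))) (first w) v) ∧ not (v ∈ᵇ xs)
          ∈R : ∀ u → u ∈ xs → u ∈ R
          ∈R u u∈ with search (λ v → v == u) R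
          ... | inj₁ (v , v∈ , e) = subst (_∈ R) (==⇒≡ v u e) v∈
          ... | inj₂ none with trans (sym (inR w w∈ u u∈)) (∉-occ R none)
            where
            ∉-occ : ∀ zs → occ u zs ≡ 0 → u ∈ᵇ zs ≡ false
            ∉-occ zs e with u ∈ᵇ zs | ∈ᵇ≤occ u zs
            ... | false | _ = refl
            ... | true | le = ⊥-elim (<⇒≱ le (≤-reflexive e))
          ...   | ()
          found : (∃ λ v → v ∈ R × ok v ≡ true) ⊎ (∑ R (λ v → ⟦ ok v ⟧) ≡ 0) → _
          -- The ends of the walk have at least `t + 2 * Λ` common neighbours, at most `m + 1` of
          -- them on the walk. If all the others were among the `t` expensive vertices, then
          -- `2 * Λ ≤ m + 1`, against `m + 2 ≤ Λ`.
          found (inj₂ none) = ⊥-elim (<⇒≱ lt (≤-trans (m≤m+n Λ Λ) (+-cancelˡ-≤ (length vs + length top) _ _ (begin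
              length vs + length top + (Λ + Λ) ≤⟨ *-cancelˡ-≤ 2 twice ⟩
              deg (s m) (last w) vs + deg (not (s (suc m))) (first w) vs ≤⟨ common vs (last w) (first w) (s m) (not (s (suc m))) xs nd ⟩
              ∑ vs (λ v → ⟦ ok v ⟧) + length xs + length vs ≡⟨ cong (λ k → k + length xs + length vs) (split (λ v → ⟦ ok v ⟧)) ⟩
              ∑ top (λ v → ⟦ ok v ⟧) + ∑ R (λ v → ⟦ ok v ⟧) + length xs + length vs
                ≡⟨ cong₂ (λ j k → ∑ top (λ v → ⟦ ok v ⟧) + j + k + length vs) none (Walk-length (walk w)) ⟩
              ∑ top (λ v → ⟦ ok v ⟧) + 0 + suc m + length vs ≤⟨ +-monoˡ-≤ (length vs) (+-monoˡ-≤ (suc m) (+-monoˡ-≤ 0 (count-top ok))) ⟩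
              length top + 0 + suc m + length vs ≡⟨ eq₂ (length top) m (length vs) ⟩
              length vs + length top + suc m ∎))))
            where
            eq₂ : ∀ a b c → a + 0 + suc b + c ≡ c + a + suc b
            eq₂ = solve-∀
            eq₁ : ∀ a b c → 2 * (a + b + (c + c)) ≡ (a + b + 2 * c) + (a + b + 2 * c)
            eq₁ = solve-∀
            twice : 2 * (length vs + length top + (Λ + Λ)) ≤ 2 * (deg (s m) (last w) vs + deg (not (s (suc m))) (first w) vs)
            twice = ≤-trans (≤-reflexive (eq₁ (length vs) (length top) Λ))
              (≤-trans (+-mono-≤ (big (last w) (s m) (R⊆ (∈R _ (Walk-head (walk w))))) (big (first w) (not (s (suc m))) (R⊆ (∈R _ (Walk-start (walk w))))))
                (≤-reflexive (sym (*-distribˡ-+ 2 (deg (s m) (last w) vs) _))))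
          found (inj₁ (v , v∈ , e)) =
            let e₁ , e₂ = ∧-true (E (s m) (last w) v ∧ E (not (s (suc m))) (first w) v) e
                e₃ , e₄ = ∧-true (E (s m) (last w) v) e₁
            in path (step (walk w) v e₃ (not-true e₂)) , trans (E-flip (s (suc m)) v (first w)) e₄ ,
               (λ { u (here refl) → R⊆ v∈ ; u (there u∈) → R⊆ (∈R u u∈) }) ,
               (begin
                 length R * (y v + ∑ xs y) ≡⟨ *-distribˡ-+ (length R) (y v) _ ⟩
                 length R * y v + length R * ∑ xs y ≤⟨ +-mono-≤ (*-monoʳ-≤ (length R) (lo v v∈)) cheap ⟩
                 length R * b + suc m * ∑ R y ≡⟨ +-comm (length R * b) _ ⟩
                 suc m * ∑ R y + length R * b ∎)

  -- The quadratic potential of truncated deficits.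

  monus-* : ∀ r d → (r ∸ d) * d ≤ (r ∸ d) * r
  monus-* r d with ≤-total r d
  ... | inj₁ p rewrite m≤n⇒m∸n≡0 p = z≤n
  ... | inj₂ p = *-monoʳ-≤ (r ∸ d) p

  square-mono : ∀ {a b} → a ≤ b → a * a ≤ b * b
  square-mono p = *-mono-≤ p p

  two-squares : ∀ x ρ → 2 * (x * ρ) ≤ x * x + ρ * ρ
  two-squares x ρ with ≤-total x ρ
  ... | inj₁ p with m≤n⇒∃[o]m+o≡n p
  ...   | d , refl = ≤-trans (m≤m+n _ (d * d)) (≤-reflexive (eq x d))
    where
    eq : ∀ x d → 2 * (x * (x + d)) + d * d ≡ x * x + (x + d) * (x + d)
    eq = solve-∀
  two-squares x ρ | inj₂ p with m≤n⇒∃[o]m+o≡n p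
  ...   | d , refl = ≤-trans (m≤m+n _ (d * d)) (≤-reflexive (eq ρ d))
    where
    eq : ∀ x d → 2 * ((x + d) * x) + d * d ≡ (x + d) * (x + d) + x * x
    eq = solve-∀

  private
    regroup : ∀ g d D z → g + d + (D + z) ≡ g + D + (z + d)
    regroup = solve-∀

  -- The square of the truncated deficit R ∸ D grows to first order by 2 x (g − ρ) when D loses g and R loses ρ.
  deficit-step : ∀ R D ρ g → let x = (ρ + R) ∸ (g + D); x′ = R ∸ D in
    x′ * x′ + 2 * (x * ρ) ≤ x * x + 2 * (x * g) + (g + ρ) * (g + ρ)
  deficit-step R D ρ g with ≤-total R D
  -- The new deficit is truncated to 0, and the mixed term is absorbed by the two squares.
  ... | inj₁ p rewrite m≤n⇒m∸n≡0 p = begin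
    2 * (x * ρ) ≤⟨ two-squares x ρ ⟩
    x * x + ρ * ρ ≤⟨ +-mono-≤ (m≤m+n (x * x) (2 * (x * g))) (square-mono (m≤n+m ρ g)) ⟩
    x * x + 2 * (x * g) + (g + ρ) * (g + ρ) ∎
    where
    open ≤-Reasoning
    x : ℕ
    x = (ρ + R) ∸ (g + D)
  ... | inj₂ p with m≤n⇒∃[o]m+o≡n p
  ...   | z , refl with ≤-total ρ g
  -- For `g = ρ + d` the old deficit may itself have been truncated, so only `z ≤ x + d` is
  -- available. In the other case `g ≤ ρ`, and the old deficit is exactly `z + d`.
  ...     | inj₁ q with m≤n⇒∃[o]m+o≡n q
  ...       | d , refl = begin
    (D + z ∸ D) * (D + z ∸ D) + 2 * (x * ρ) ≡⟨ cong (λ k → k * k + 2 * (x * ρ)) (m+n∸m≡n D z) ⟩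
    z * z + 2 * (x * ρ) ≤⟨ +-monoˡ-≤ (2 * (x * ρ)) (square-mono z≤) ⟩
    (x + d) * (x + d) + 2 * (x * ρ) ≤⟨ m≤m+n _ (4 * (ρ * ρ) + 4 * (ρ * d)) ⟩
    (x + d) * (x + d) + 2 * (x * ρ) + (4 * (ρ * ρ) + 4 * (ρ * d)) ≡⟨ eq x d ρ ⟩
    x * x + 2 * (x * (ρ + d)) + (ρ + d + ρ) * (ρ + d + ρ) ∎
    where
    open ≤-Reasoning
    x : ℕ
    x = (ρ + (D + z)) ∸ (ρ + d + D)
    z≤ : z ≤ x + d
    z≤ = +-cancelˡ-≤ (ρ + D) z (x + d) (≤-trans (≤-reflexive (e₁ ρ D z)) (≤-trans (m≤n+m∸n (ρ + (D + z)) (ρ + d + D)) (≤-reflexive (e₂ ρ d D x))))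
      where
      e₁ : ∀ ρ D z → ρ + D + z ≡ ρ + (D + z)
      e₁ = solve-∀
      e₂ : ∀ ρ d D x → ρ + d + D + x ≡ ρ + D + (x + d)
      e₂ = solve-∀
    eq : ∀ x d ρ → (x + d) * (x + d) + 2 * (x * ρ) + (4 * (ρ * ρ) + 4 * (ρ * d)) ≡ x * x + 2 * (x * (ρ + d)) + (ρ + d + ρ) * (ρ + d + ρ)
    eq = solve-∀
  deficit-step R D ρ g | inj₂ p | z , refl | inj₂ q with m≤n⇒∃[o]m+o≡n q
  ...       | d , refl rewrite m+n∸m≡n D z | regroup g d D z | m+n∸m≡n (g + D) (z + d) = begin
    z * z + 2 * ((z + d) * (g + d)) ≤⟨ m≤m+n _ (4 * (g * g) + 4 * (g * d)) ⟩
    z * z + 2 * ((z + d) * (g + d)) + (4 * (g * g) + 4 * (g * d)) ≡⟨ eq z d g ⟩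
    (z + d) * (z + d) + 2 * ((z + d) * g) + (g + (g + d)) * (g + (g + d)) ∎
    where
    open ≤-Reasoning
    eq : ∀ z d g → z * z + 2 * ((z + d) * (g + d)) + (4 * (g * g) + 4 * (g * d)) ≡ (z + d) * (z + d) + 2 * ((z + d) * g) + (g + (g + d)) * (g + (g + d))
    eq = solve-∀

  ∑-all : ∀ {n} (vs : List (Fin n)) → Nodup vs → ∀ f → ∑ vs f ≤ ∑ (allFin n) f
  ∑-all {n} vs nd f = ≤-trans (≤-reflexive (∑-cong vs (λ v → sym (trans (cong (λ b → f v * ⟦ b ⟧) (∈⇒∈ᵇ (∈-allFin v))) (*-identityʳ (f v))))))
    (∑-∈ᵇ-weighted vs nd (allFin n) f)

  -- Greedy packing steered by prices.

  module Greedy {n : ℕ} (G : Digraph n) {Tile : Set} (gap : Tile → ℕ) (sgn : Tile → ℕ → Bool) (q Λ : ℕ) where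
    open Walks G

    len : Tile → ℕ
    len τ = suc (suc (gap τ))

    -- 2q times (len τ + 1)/2 + len τ/(2q), the share of τ in the degree requirement; half of the slack is kept in reserve.
    ρ : Tile → ℕ
    ρ τ = q * suc (len τ) + len τ

    Constraint : Set
    Constraint = Bool × V

    constraints : List Constraint
    constraints = map (true ,_) all ++ map (false ,_) all

    degᶜ : Constraint → List V → ℕ
    degᶜ (σ , v) = deg σ v

    -- In units of `1 / (2 * q)`: the amount by which a signed neighbourhood inside the available
    -- vertices falls short of the total requirement of the remaining tiles. Truncated, because a
    -- surplus needs no protection and must not offset other deficits.
    deficit : List Tile → List V → Constraint → ℕ
    deficit τs vs c = ∑ τs ρ ∸ 2 * q * degᶜ c vs

    potential : List Tile → List V → ℕ
    potential τs vs = ∑ constraints (λ c → deficit τs vs c * deficit τs vs c)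

    weight : List Tile → List V → ℕ
    weight τs vs = ∑ constraints (deficit τs vs)

    -- Up to the factor `4 * q`, the first-order growth of `potential` when `u` is used up: each
    -- deficit whose neighbourhood contains `u` grows by `2 * q`.
    price : List Tile → List V → V → ℕ
    price τs vs u = ∑ constraints (λ c → deficit τs vs c * ⟦ E (proj₁ c) (proj₂ c) u ⟧)

    ∑-price : ∀ τs vs us → ∑ us (price τs vs) ≡ ∑ constraints (λ c → deficit τs vs c * degᶜ c us)
    ∑-price τs vs us = trans (∑-swap us constraints _)
      (∑-cong constraints (λ c → ∑-* us (deficit τs vs c) _))

    -- Only constraints in deficit carry weight, and for these `2 * q * degᶜ c vs` is below the
    -- total requirement.
    ∑-price≤ : ∀ τs vs → 2 * q * ∑ vs (price τs vs) ≤ weight τs vs * ∑ τs ρ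
    ∑-price≤ τs vs = begin
      2 * q * ∑ vs (price τs vs) ≡⟨ cong (2 * q *_) (∑-price τs vs vs) ⟩
      2 * q * ∑ constraints (λ c → x c * degᶜ c vs) ≡⟨ ∑-* constraints (2 * q) _ ⟨
      ∑ constraints (λ c → 2 * q * (x c * degᶜ c vs)) ≤⟨ ∑-mono′ constraints (λ c → ≤-trans (≤-reflexive (eq (2 * q) (x c) _)) (monus-* R (2 * q * degᶜ c vs))) ⟩
      ∑ constraints (λ c → x c * R) ≡⟨ ∑-cong constraints (λ c → *-comm (x c) R) ⟩
      ∑ constraints (λ c → R * x c) ≡⟨ ∑-* constraints R x ⟩
      R * weight τs vs ≡⟨ *-comm R _ ⟩
      weight τs vs * R ∎
      where
      open ≤-Reasoning
      R : ℕ
      R = ∑ τs ρ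
      x : Constraint → ℕ
      x = deficit τs vs
      eq : ∀ a b c → a * (b * c) ≡ b * (a * c)
      eq = solve-∀

    -- Summing `deficit-step` over all constraints, the last hypothesis says exactly that the
    -- first-order terms do not add up to a gain; what remains is one bounded square per constraint.
    potential-step : ∀ {τs τ τs′ vs xs vs′} → τs ↭ τ ∷ τs′ → vs ↭ xs ++ vs′ → length xs ≡ len τ → len τ ≤ Λ → 1 ≤ q →
      2 * q * ∑ xs (price τs vs) ≤ ρ τ * weight τs vs →
      potential τs′ vs′ ≤ potential τs vs + length constraints * ((5 * q * Λ) * (5 * q * Λ))
    potential-step {τs} {τ} {τs′} {vs} {xs} {vs′} τσ vσ lx lΛ q>0 cheap = +-cancelʳ-≤ (2 * (ρ τ * weight τs vs)) _ _ (begin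
      potential τs′ vs′ + 2 * (ρ τ * weight τs vs)
        ≡⟨ cong (potential τs′ vs′ +_) (trans (eq₁ (ρ τ) (weight τs vs)) (sym (∑-* constraints (2 * ρ τ) x))) ⟩
      ∑ constraints (λ c → x′ c * x′ c) + ∑ constraints (λ c → 2 * ρ τ * x c) ≡⟨ ∑-+ constraints _ _ ⟨
      ∑ constraints (λ c → x′ c * x′ c + 2 * ρ τ * x c) ≤⟨ ∑-mono′ constraints pointwise ⟩
      ∑ constraints (λ c → x c * x c + 2 * (x c * g c) + B * B) ≡⟨ ∑-+ constraints _ _ ⟩
      ∑ constraints (λ c → x c * x c + 2 * (x c * g c)) + ∑ constraints (λ _ → B * B) ≡⟨ cong₂ _+_ (∑-+ constraints _ _) (∑-const constraints (B * B)) ⟩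
      potential τs vs + ∑ constraints (λ c → 2 * (x c * g c)) + length constraints * (B * B)
        ≡⟨ cong (λ k → potential τs vs + k + length constraints * (B * B)) first-order ⟩
      potential τs vs + 2 * (2 * q * ∑ xs (price τs vs)) + length constraints * (B * B)
        ≤⟨ +-monoˡ-≤ (length constraints * (B * B)) (+-monoʳ-≤ (potential τs vs) (*-monoʳ-≤ 2 cheap)) ⟩
      potential τs vs + 2 * (ρ τ * weight τs vs) + length constraints * (B * B)
        ≡⟨ eq₂ (potential τs vs) (2 * (ρ τ * weight τs vs)) (length constraints * (B * B)) ⟩
      potential τs vs + length constraints * ( (B * B)) + 2 * (ρ τ * weight τs vs) ∎)
      where
      open ≤-Reasoning
      B : ℕ
      B = 5 * q * Λ
      x x′ g : Constraint → ℕ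
      x = deficit τs vs
      x′ = deficit τs′ vs′
      g c = 2 * q * degᶜ c xs
      eq₁ : ∀ a b → 2 * (a * b) ≡ 2 * a * b
      eq₁ = solve-∀
      eq₂ : ∀ a b c → a + b + c ≡ a + c + b
      eq₂ = solve-∀
      first-order : ∑ constraints (λ c → 2 * (x c * g c)) ≡ 2 * (2 * q * ∑ xs (price τs vs))
      first-order = trans (∑-* constraints 2 _) (cong (2 *_) (trans (∑-cong constraints (λ c → e (x c) (2 * q) _))
        (trans (∑-* constraints (2 * q) _) (cong (2 * q *_) (sym (∑-price τs vs xs))))))
        where
        e : ∀ a b c → a * (b * c) ≡ b * (a * c)
        e = solve-∀
      x-split : ∀ c → x c ≡ (ρ τ + ∑ τs′ ρ) ∸ (g c + 2 * q * degᶜ c vs′)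
      x-split c = cong₂ _∸_ (∑-↭ ρ τσ) (trans (cong (2 * q *_) (trans (∑-↭ _ vσ) (∑-++ xs vs′ _))) (*-distribˡ-+ (2 * q) _ _))
      deg≤ : ∀ c → degᶜ c xs ≤ Λ
      deg≤ c = ≤-trans (∑-mono′ xs (λ u → ⟦⟧≤1 (E (proj₁ c) (proj₂ c) u))) (≤-trans (≤-reflexive (trans (∑-length xs) lx)) lΛ)
      -- The 5 is made up of 2 from `g c`, and 3 from `ρ τ`, where `suc Λ ≤ Λ + Λ` and `Λ ≤ q * Λ`.
      small : ∀ c → g c + ρ τ ≤ B
      small c = begin
        g c + (q * suc (len τ) + len τ) ≤⟨ +-mono-≤ (*-monoʳ-≤ (2 * q) (deg≤ c)) (+-mono-≤ (*-monoʳ-≤ q (s≤s lΛ)) lΛ) ⟩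
        2 * q * Λ + (q * suc Λ + Λ) ≤⟨ +-monoʳ-≤ (2 * q * Λ) (+-mono-≤ (*-monoʳ-≤ q (+-monoˡ-≤ Λ (≤-trans (s≤s z≤n) lΛ))) (≤-trans (≤-reflexive (sym (*-identityˡ Λ))) (*-monoˡ-≤ Λ q>0))) ⟩
        2 * q * Λ + (q * (Λ + Λ) + q * Λ) ≡⟨ e q Λ ⟩
        5 * q * Λ ∎
        where
        e : ∀ q Λ → 2 * q * Λ + (q * (Λ + Λ) + q * Λ) ≡ 5 * q * Λ
        e = solve-∀
      pointwise : ∀ c → x′ c * x′ c + 2 * ρ τ * x c ≤ x c * x c + 2 * (x c * g c) + B * B
      pointwise c rewrite x-split c = begin
        x′ c * x′ c + 2 * ρ τ * z ≡⟨ cong (x′ c * x′ c +_) (e (ρ τ) z) ⟩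
        x′ c * x′ c + 2 * (z * ρ τ) ≤⟨ deficit-step (∑ τs′ ρ) (2 * q * degᶜ c vs′) (ρ τ) (g c) ⟩
        z * z + 2 * (z * g c) + (g c + ρ τ) * (g c + ρ τ) ≤⟨ +-monoʳ-≤ (z * z + 2 * (z * g c)) (square-mono (small c)) ⟩
        z * z + 2 * (z * g c) + B * B ∎
        where
        z : ℕ
        z = (ρ τ + ∑ τs′ ρ) ∸ (g c + 2 * q * degᶜ c vs′)
        e : ∀ a b → 2 * a * b ≡ 2 * (b * a)
        e = solve-∀

    ∑-constraints : ∀ f → ∑ constraints f ≡ ∑ all (λ v → f (true , v) + f (false , v))
    ∑-constraints f = trans (∑-++ (map (true ,_) all) _ f)
      (trans (cong₂ _+_ (∑-map (true ,_) all f) (∑-map (false ,_) all f)) (sym (∑-+ all _ _)))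

    len-ρ : ∀ τs → ∑ τs ρ ≡ q * (∑ τs len + length τs) + ∑ τs len
    len-ρ τs = trans (∑-+ τs (λ τ → q * suc (len τ)) len) (cong (_+ ∑ τs len)
      (trans (∑-* τs q (λ τ → suc (len τ))) (cong (q *_) (trans (∑-+ τs (const 1) len) (trans (cong (_+ ∑ τs len) (∑-length τs)) (+-comm (length τs) _))))))

    len-gap : ∀ τs → length τs + ∑ τs (λ τ → suc (gap τ)) ≡ ∑ τs len
    len-gap τs = sym (trans (∑-+ τs (const 1) (λ τ → suc (gap τ))) (cong (_+ ∑ τs (λ τ → suc (gap τ))) (∑-length τs)))

    length<len : ∀ τs → 0 < length τs → length τs < ∑ τs len
    length<len (τ ∷ τs) _ = s≤s (≤-trans (s≤s (≤-trans (≤-reflexive (sym (∑-length τs))) (∑-mono′ τs (λ _ → s≤s z≤n))))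
      (≤-trans (m≤n+m _ (gap τ)) (≤-reflexive (+-suc (gap τ) _))))

    -- `X` is the deficit from which a vertex counts as bad, `P` a cap on the potential. By `few` at
    -- most `c₀` vertices are bad, by `lower` the others still suffice for all tiles, and `s₀`
    -- bounds the surplus of vertices. `slack` requires so much remaining length that the reserve in
    -- `ρ` outweighs all these losses.
    module Step (c₀ s₀ X P : ℕ) (q>0 : 1 ≤ q) (few : P < suc c₀ * (X * X)) (τs : List Tile) (vs : List V)
      (nonempty : 0 < length τs) (short : ∀ τ → τ ∈ τs → len τ ≤ Λ) (nd : Nodup vs)
      (lower : ∑ τs len + c₀ ≤ length vs) (upper : length vs ≤ ∑ τs len + s₀) (Φ≤P : potential τs vs ≤ P)
      (slack : X + 2 * q * c₀ + q * s₀ + 2 * q * Λ ≤ ∑ τs len) where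

      open ≤-Reasoning

      x : Constraint → ℕ
      x = deficit τs vs

      -- The other vertices are few since the potential is quadratic in their deficits, and they are left out of the search.
      good : V → Bool
      good v = (x (true , v) <ᵇ X) ∧ (x (false , v) <ᵇ X)

      vg vb : List V
      vg = filterᵇ good vs
      vb = filterᵇ (not ∘ good) vs

      split : ∀ f → ∑ vs f ≡ ∑ vg f + ∑ vb f
      split = ∑-filter good vs

      <ᵇ-false : ∀ a b → (a <ᵇ b) ≡ false → b ≤ a
      <ᵇ-false a b e = ≮⇒≥ (λ lt → case trans (sym (T⇒true (<⇒<ᵇ lt))) e of λ ())
        where
        T⇒true : ∀ {b} → T b → b ≡ true
        T⇒true {true} _ = refl

      <ᵇ-true : ∀ a b → (a <ᵇ b) ≡ true → a < b
      <ᵇ-true a b e = <ᵇ⇒< a b (subst T (sym e) _)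

      bad-large : ∀ v → v ∈ vb → X * X ≤ x (true , v) * x (true , v) + x (false , v) * x (false , v)
      bad-large v v∈ with (x (true , v) <ᵇ X) in e₁ | (x (false , v) <ᵇ X) in e₂ | proj₂ (∈-filterᵇ (not ∘ good) vs v∈)
      ... | false | _ | _ = ≤-trans (square-mono (<ᵇ-false _ X e₁)) (m≤m+n _ _)
      ... | true | false | _ = ≤-trans (square-mono (<ᵇ-false _ X e₂)) (m≤n+m _ _)
      ... | true | true | ()

      few-bad : length vb ≤ c₀
      few-bad = ≮⇒≥ (λ lt → <⇒≱ few (begin
        suc c₀ * (X * X) ≤⟨ *-monoˡ-≤ (X * X) lt ⟩
        length vb * (X * X) ≡⟨ ∑-const vb (X * X) ⟨
        ∑ vb (const (X * X)) ≤⟨ ∑-mono vb bad-large ⟩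
        ∑ vb two ≤⟨ m≤n+m _ (∑ vg two) ⟩
        ∑ vg two + ∑ vb two ≡⟨ split two ⟨
        ∑ vs two ≤⟨ ∑-all vs nd two ⟩
        ∑ all two ≡⟨ ∑-constraints (λ c → x c * x c) ⟨
        potential τs vs ≤⟨ Φ≤P ⟩
        P ∎))
        where
        two : V → ℕ
        two v = x (true , v) * x (true , v) + x (false , v) * x (false , v)

      length-split : length vs ≡ length vg + length vb
      length-split = trans (sym (∑-length vs)) (trans (split (const 1)) (cong₂ _+_ (∑-length vg) (∑-length vb)))

      enough : ∑ τs len ≤ length vg
      enough = +-cancelʳ-≤ c₀ _ _ (≤-trans lower (≤-trans (≤-reflexive length-split) (+-monoʳ-≤ (length vg) few-bad)))

      nd-vg : Nodup vg
      nd-vg v = ≤-trans (≤-trans (m≤m+n _ _) (≤-reflexive (sym (split (λ u → ⟦ u == v ⟧))))) (nd v)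

      deficit-small : ∀ v σ → v ∈ vg → x (σ , v) < X
      deficit-small v σ v∈ with ∧-true (x (true , v) <ᵇ X) (proj₂ (∈-filterᵇ good vs v∈))
      deficit-small v true v∈ | e , _ = <ᵇ-true _ X e
      deficit-small v false v∈ | _ , e = <ᵇ-true _ X e

      deg-vg : ∀ σ v → deg σ v vs ≤ deg σ v vg + c₀
      deg-vg σ v = ≤-trans (≤-reflexive (split (λ u → ⟦ E σ v u ⟧))) (+-monoʳ-≤ (deg σ v vg)
        (≤-trans (∑-mono′ vb (λ u → ⟦⟧≤1 (E σ v u))) (≤-trans (≤-reflexive (∑-length vb)) few-bad)))

      -- The reserve `∑ τs len` within the requirement pays, through `slack`, for the deficit `X`,
      -- for `c₀` neighbours lost to bad vertices, for the surplus `s₀` of vertices over positions,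
      -- and for the margin `2 * Λ` of the walks.
      big : ∀ v σ → v ∈ vg → length vg + length τs + 2 * Λ ≤ 2 * deg σ v vg
      big v σ v∈ = *-cancelˡ-≤ q {{>-nonZero q>0}} (linear (q * length vb) total
        (eq q (length vg) (length vb) (length τs) Λ (deg σ v vg) X c₀ s₀ (∑ τs len)))
        where
        total : ((q * (∑ τs len + length τs) + ∑ τs len) + (X + 2 * q * c₀ + q * s₀ + 2 * q * Λ) + q * (length vg + length vb)) ≤ (2 * q * (deg σ v vg + c₀) + X) + ∑ τs len + q * (∑ τs len + s₀)
        total = +-mono-≤ (+-mono-≤ (begin
          q * (∑ τs len + length τs) + ∑ τs len ≡⟨ len-ρ τs ⟨
          ∑ τs ρ ≤⟨ m≤n+m∸n (∑ τs ρ) (2 * q * deg σ v vs) ⟩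
          2 * q * deg σ v vs + x (σ , v) ≤⟨ +-mono-≤ (*-monoʳ-≤ (2 * q) (deg-vg σ v)) (<⇒≤ (deficit-small v σ v∈)) ⟩
          2 * q * (deg σ v vg + c₀) + X ∎) slack)
          (*-monoʳ-≤ q (≤-trans (≤-reflexive (sym length-split)) upper))
        eq : ∀ q g b T Λ d X c s N → q * (g + T + 2 * Λ) + ((2 * q * (d + c) + X) + N + q * (N + s)) + q * b ≡
          q * (2 * d) + ((q * (N + T) + N) + (X + 2 * q * c + q * s + 2 * q * Λ) + q * (g + b))
        eq = solve-∀

      CheapTile : Set
      CheapTile = ∃ λ τ → τ ∈ τs × ∃ λ (p : Path (sgn τ) (suc (gap τ))) → E (sgn τ (suc (gap τ))) (last p) (first p) ≡ true ×
        (∀ u → u ∈ verts p → u ∈ vs) × 2 * q * ∑ (verts p) (price τs vs) ≤ ρ τ * weight τs vs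

      module Average (cc : CheapCycles vg (length τs) Λ (price τs vs)) where
        module CC = CheapCycles cc

        rest-small : ∑ τs (λ τ → suc (gap τ)) ≤ CC.M
        rest-small = +-cancelˡ-≤ (length τs) _ _ (≤-trans (≤-reflexive (len-gap τs)) (≤-trans enough (≤-reflexive (sym CC.size))))

        -- One cycle for every remaining tile would use one threshold price `b` per tile and at most
        -- `M` average prices `S / M` in all. By `budget` this is within the total price of `vs`, so
        -- not every tile can exceed its share.
        average : ∑ τs (λ τ → 2 * q * (suc (gap τ) * CC.S + CC.M * CC.b)) ≤ ∑ τs (λ τ → CC.M * (ρ τ * weight τs vs))
        average = begin
          ∑ τs (λ τ → 2 * q * (suc (gap τ) * CC.S + CC.M * CC.b)) ≡⟨ ∑-* τs (2 * q) _ ⟩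
          2 * q * ∑ τs (λ τ → suc (gap τ) * CC.S + CC.M * CC.b) ≡⟨ cong (2 * q *_) (trans (∑-+ τs _ _) (cong₂ _+_ (∑-*ʳ τs CC.S _) (∑-const τs _))) ⟩
          2 * q * (∑ τs (λ τ → suc (gap τ)) * CC.S + length τs * (CC.M * CC.b)) ≤⟨ *-monoʳ-≤ (2 * q) (+-monoˡ-≤ _ (*-monoˡ-≤ CC.S rest-small)) ⟩
          2 * q * (CC.M * CC.S + length τs * (CC.M * CC.b)) ≡⟨ eq q CC.M CC.S (length τs) CC.b ⟩
          CC.M * (2 * q * (CC.S + length τs * CC.b)) ≤⟨ *-monoʳ-≤ CC.M (*-monoʳ-≤ (2 * q) CC.budget) ⟩
          CC.M * (2 * q * ∑ vg (price τs vs))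
            ≤⟨ *-monoʳ-≤ CC.M (*-monoʳ-≤ (2 * q) (≤-trans (m≤m+n _ (∑ vb (price τs vs))) (≤-reflexive (sym (split (price τs vs)))))) ⟩
          CC.M * (2 * q * ∑ vs (price τs vs)) ≤⟨ *-monoʳ-≤ CC.M (∑-price≤ τs vs) ⟩
          CC.M * (weight τs vs * ∑ τs ρ) ≡⟨ cong (CC.M *_) (trans (*-comm (weight τs vs) _) (sym (∑-*ʳ τs (weight τs vs) ρ))) ⟩
          CC.M * ∑ τs (λ τ → ρ τ * weight τs vs) ≡⟨ ∑-* τs CC.M _ ⟨
          ∑ τs (λ τ → CC.M * (ρ τ * weight τs vs)) ∎
          where
          eq : ∀ q M S t b → 2 * q * (M * S + t * (M * b)) ≡ M * (2 * q * (S + t * b))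
          eq = solve-∀

        tile-of-average : CheapTile
        tile-of-average with ∑-pick≤ τs _ _ nonempty average
        ... | τ , τ∈ , h = τ , τ∈ , CC.cycle (sgn τ) (gap τ) lt , CC.closed (sgn τ) (gap τ) lt ,
          (λ u u∈ → proj₁ (∈-filterᵇ good vs (CC.within (sgn τ) (gap τ) lt u u∈))) ,
          *-cancelˡ-≤ CC.M {{>-nonZero CC.M>0}} (begin
            CC.M * (2 * q * ∑ us (price τs vs)) ≡⟨ eq CC.M (2 * q) (∑ us (price τs vs)) ⟩
            2 * q * (CC.M * ∑ us (price τs vs)) ≤⟨ *-monoʳ-≤ (2 * q) (CC.cost (sgn τ) (gap τ) lt) ⟩
            2 * q * (suc (gap τ) * CC.S + CC.M * CC.b) ≤⟨ h ⟩
            CC.M * (ρ τ * weight τs vs) ∎)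
          where
          lt : suc (suc (gap τ)) ≤ Λ
          lt = short τ τ∈
          us : List V
          us = verts (CC.cycle (sgn τ) (gap τ) lt)
          eq : ∀ a b c → a * (b * c) ≡ b * (a * c)
          eq = solve-∀

      cheap-tile : CheapTile
      cheap-tile = Average.tile-of-average (cheap-cycles vg (length τs) Λ (price τs vs) nd-vg (≤-trans (length<len τs nonempty) enough) big)

    -- `State` is any invariant kept by placing a closed walk, which separates the pricing from the
    -- embedding. Each placement removes `len τ` on both sides of the two length bounds, and the
    -- potential has a fixed allowance for each of the `T` tiles still to come.
    greedy : ∀ (State : List Tile → List V → Set) (c₀ s₀ X P N₁ : ℕ) → 1 ≤ q → P < suc c₀ * (X * X) →
      X + 2 * q * c₀ + q * s₀ + 2 * q * Λ ≤ N₁ →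
      (∀ {τs τ τs′ vs vs′} → State τs vs → τs ↭ τ ∷ τs′ → (p : Path (sgn τ) (suc (gap τ))) →
        E (sgn τ (suc (gap τ))) (last p) (first p) ≡ true → vs ↭ verts p ++ vs′ → State τs′ vs′) →
      ∀ T τs vs → length τs ≡ T → State τs vs → (∀ τ → τ ∈ τs → len τ ≤ Λ) → Nodup vs →
      ∑ τs len + c₀ ≤ length vs → length vs ≤ ∑ τs len + s₀ →
      potential τs vs + T * (length constraints * ((5 * q * Λ) * (5 * q * Λ))) ≤ P →
      ∃₂ λ τs vs → State τs vs × ∑ τs len ≤ N₁
    greedy State c₀ s₀ X P N₁ q>0 few slack place = loop
      where
      loop : ∀ T τs vs → length τs ≡ T → State τs vs → (∀ τ → τ ∈ τs → len τ ≤ Λ) → Nodup vs →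
        ∑ τs len + c₀ ≤ length vs → length vs ≤ ∑ τs len + s₀ →
        potential τs vs + T * (length constraints * ((5 * q * Λ) * (5 * q * Λ))) ≤ P →
        ∃₂ λ τs vs → State τs vs × ∑ τs len ≤ N₁
      loop zero [] vs _ st _ _ _ _ _ = [] , vs , st , z≤n
      loop (suc T) τs vs lT st short nd lower upper pot with ∑ τs len ≤? N₁
      ... | yes p = τs , vs , st , p
      ... | no ¬p = continue (Step.cheap-tile c₀ s₀ X P q>0 few τs vs (subst (0 <_) (sym lT) z<s) short nd lower upper
                                (≤-trans (m≤m+n _ _) pot) (≤-trans slack (<⇒≤ (≰⇒> ¬p))))
        where
        K : ℕ
        K = length constraints * ((5 * q * Λ) * (5 * q * Λ))
        continue : (∃ λ τ → τ ∈ τs × ∃ λ (p : Path (sgn τ) (suc (gap τ))) → E (sgn τ (suc (gap τ))) (last p) (first p) ≡ true ×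
          (∀ u → u ∈ verts p → u ∈ vs) × 2 * q * ∑ (verts p) (price τs vs) ≤ ρ τ * weight τs vs) →
          ∃₂ λ τs vs → State τs vs × ∑ τs len ≤ N₁
        continue (τ , τ∈ , p , closed , within , cheap) with ∈-↭-∷ τ∈ | Walk-remove (walk p) within
        ... | τs′ , τσ | vs′ , vσ = loop T τs′ vs′ (suc-injective (trans (sym (↭-length τσ)) lT)) (place st τσ p closed vσ)
          (λ τ τ∈ → short τ (∈-resp-↭ (↭-sym τσ) (there τ∈))) (Nodup-++ʳ (verts p) vσ nd)
          (+-cancelˡ-≤ (len τ) _ _ (≤-trans (≤-reflexive (trans (sym (+-assoc (len τ) _ c₀)) (cong (_+ c₀) (sym N-split)))) (≤-trans lower (≤-reflexive vs-split))))
          (+-cancelˡ-≤ (len τ) _ _ (≤-trans (≤-reflexive (sym vs-split)) (≤-trans upper (≤-reflexive (trans (cong (_+ s₀) N-split) (+-assoc (len τ) _ s₀))))))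
          (≤-trans (+-monoˡ-≤ (T * K) (potential-step {xs = verts p} {vs′} τσ vσ (Walk-length (walk p)) (short τ τ∈) q>0 cheap)) (≤-trans (≤-reflexive (+-assoc (potential τs vs) K _)) pot))
          where
          N-split : ∑ τs len ≡ len τ + ∑ τs′ len
          N-split = ∑-↭ len τσ
          vs-split : length vs ≡ len τ + length vs′
          vs-split = trans (↭-length vσ) (trans (length-++ (verts p)) (cong (_+ length vs′) (Walk-length (walk p))))

  -- Partial embeddings of the positions.

  module Positions {n t : ℕ} (G : Digraph n) (ℓ : Fin t → ℕ) (3≤ℓ : ∀ k → 3 ≤ ℓ k) (s : Fin t × ℕ → Bool) where
    open Walks G

    -- (k , a) is the a-th position along the k-th cycle, and s (k , a) the direction of the edge from there to the next one.
    Pos : Set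
    Pos = Fin t × ℕ

    _≟ₚ_ : (p p′ : Pos) → Dec (p ≡ p′)
    _≟ₚ_ = ≡-dec _≟_ ℕ._≟_

    Valid : Pos → Set
    Valid (k , a) = a < ℓ k

    next : Pos → Pos
    next (k , a) with suc a Data.Nat.≟ ℓ k
    ... | yes _ = k , 0
    ... | no _ = k , suc a

    prev : Pos → Pos
    prev (k , zero) = k , ℓ k ∸ 1
    prev (k , suc a) = k , a

    next-wrap : ∀ k a → suc a ≡ ℓ k → next (k , a) ≡ (k , 0)
    next-wrap k a e with suc a Data.Nat.≟ ℓ k
    ... | yes _ = refl
    ... | no ¬e = ⊥-elim (¬e e)

    next-suc : ∀ k a → suc a < ℓ k → next (k , a) ≡ (k , suc a)
    next-suc k a lt with suc a Data.Nat.≟ ℓ k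
    ... | yes e = ⊥-elim (<⇒≢ lt e)
    ... | no _ = refl

    next-inv : ∀ k a k′ b → next (k , a) ≡ (k′ , b) → k ≡ k′ × ((suc a ≡ ℓ k × b ≡ 0) ⊎ b ≡ suc a)
    next-inv k a k′ b e with suc a Data.Nat.≟ ℓ k
    next-inv k a k′ b refl | yes e = refl , inj₁ (e , refl)
    next-inv k a k′ b refl | no _ = refl , inj₂ refl

    prev-next : ∀ p u → Valid u → next p ≡ u → p ≡ prev u
    prev-next (k , a) (k′ , b) _ e with next-inv k a k′ b e
    ... | refl , inj₁ (e′ , refl) = cong (λ m → k , m ∸ 1) e′
    ... | refl , inj₂ refl = refl

    next≢ : ∀ p → next p ≢ p
    next≢ (k , a) e with next-inv k a k a e
    ... | _ , inj₂ ()
    ... | _ , inj₁ (e′ , refl) with subst (3 ≤_) (sym e′) (3≤ℓ k)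
    ...   | s≤s ()

    -- Edges are required only where both consecutive positions are assigned, so pieces can be
    -- placed in any order.
    record Embedding (φ : Pos → Maybe V) : Set where
      field
        dom  : ∀ p v → φ p ≡ just v → Valid p
        inj  : ∀ p p′ v → φ p ≡ just v → φ p′ ≡ just v → p ≡ p′
        edge : ∀ p u v → φ p ≡ just u → φ (next p) ≡ just v → E (s p) u v ≡ true
    open Embedding public

    _[_↦_] : (Pos → Maybe V) → Pos → V → Pos → Maybe V
    (φ [ u ↦ r ]) p with p ≟ₚ u
    ... | yes _ = just r
    ... | no _ = φ p

    update-here : ∀ φ u r → (φ [ u ↦ r ]) u ≡ just r
    update-here φ u r with u ≟ₚ u
    ... | yes _ = refl
    ... | no ¬p = ⊥-elim (¬p refl)

    update-there : ∀ φ u r p → p ≢ u → (φ [ u ↦ r ]) p ≡ φ p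
    update-there φ u r p p≢ with p ≟ₚ u
    ... | yes e = ⊥-elim (p≢ e)
    ... | no _ = refl

    update-inv : ∀ φ u r p v → (φ [ u ↦ r ]) p ≡ just v → (p ≡ u × r ≡ v) ⊎ (p ≢ u × φ p ≡ just v)
    update-inv φ u r p v e with p ≟ₚ u
    ... | yes p≡ = inj₁ (p≡ , just-injective e)
    ... | no p≢ = inj₂ (p≢ , e)

    Unused : (Pos → Maybe V) → V → Set
    Unused φ v = ∀ p → φ p ≢ just v

    record Compatible (φ : Pos → Maybe V) (u : Pos) (r : V) : Set where
      field
        from-prev : ∀ p a → next p ≡ u → φ p ≡ just a → E (s p) a r ≡ true
        to-next   : ∀ b → φ (next u) ≡ just b → E (s u) r b ≡ true
    open Compatible public

    update-embedding : ∀ {φ u r} → Embedding φ → Valid u → Unused φ r → Compatible φ u r → Embedding (φ [ u ↦ r ])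
    update-embedding {φ} {u} {r} emb val fresh comp = record { dom = dom′ ; inj = inj′ ; edge = edge′ }
      where
      dom′ : ∀ p v → (φ [ u ↦ r ]) p ≡ just v → Valid p
      dom′ p v e with update-inv φ u r p v e
      ... | inj₁ (refl , _) = val
      ... | inj₂ (_ , e′) = dom emb p v e′
      inj′ : ∀ p p′ v → (φ [ u ↦ r ]) p ≡ just v → (φ [ u ↦ r ]) p′ ≡ just v → p ≡ p′
      inj′ p p′ v e e′ with update-inv φ u r p v e | update-inv φ u r p′ v e′
      ... | inj₁ (refl , _) | inj₁ (refl , _) = refl
      ... | inj₁ (_ , refl) | inj₂ (_ , f) = ⊥-elim (fresh p′ f)
      ... | inj₂ (_ , f) | inj₁ (_ , refl) = ⊥-elim (fresh p f)
      ... | inj₂ (_ , f) | inj₂ (_ , f′) = inj emb p p′ v f f′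
      edge′ : ∀ p a b → (φ [ u ↦ r ]) p ≡ just a → (φ [ u ↦ r ]) (next p) ≡ just b → E (s p) a b ≡ true
      edge′ p a b e e′ with update-inv φ u r p a e | update-inv φ u r (next p) b e′
      ... | inj₁ (refl , _) | inj₁ (q , _) = ⊥-elim (next≢ p q)
      ... | inj₁ (refl , refl) | inj₂ (_ , f) = to-next comp b f
      ... | inj₂ (_ , f) | inj₁ (q , refl) = from-prev comp p a q f
      ... | inj₂ (_ , f) | inj₂ (_ , f′) = edge emb p a b f f′

    -- Whatever is assigned around u, two signed vertices suffice to express compatibility.
    compatible-pair : ∀ {φ} → V → ∀ {u} → Valid u → ∃₂ λ a σ → ∃₂ λ b τ → ∀ r →
      E σ a r ≡ true → E τ b r ≡ true → Compatible φ u r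
    compatible-pair {φ} v₀ {u} val with before | after
      where
      before : ∃₂ λ a σ → ∀ r → E σ a r ≡ true → ∀ p b → next p ≡ u → φ p ≡ just b → E (s p) b r ≡ true
      before with φ (prev u) in eq
      -- An unassigned neighbour imposes no condition. The dummy pair `v₀ , true` gives every slot
      -- the same form of two signed vertices.
      ... | nothing = v₀ , true , λ r _ p b e f → case trans (sym eq) (trans (cong φ (sym (prev-next p u val e))) f) of λ ()
      ... | just a = a , s (prev u) , λ r h p b e f → found r h p b (prev-next p u val e) f
        where
        found : ∀ r → E (s (prev u)) a r ≡ true → ∀ p b → p ≡ prev u → φ p ≡ just b → E (s p) b r ≡ true
        found r h p b refl f with just-injective (trans (sym eq) f)
        ... | refl = h
      after : ∃₂ λ b τ → ∀ r → E τ b r ≡ true → ∀ c → φ (next u) ≡ just c → E (s u) r c ≡ true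
      after with φ (next u)
      ... | nothing = v₀ , true , λ r _ c ()
      ... | just b = b , not (s u) , λ { r h c refl → trans (E-flip (s u) r c) h }
    ... | a , σ , h | b , τ , h′ = a , σ , b , τ , λ r e e′ → record { from-prev = h r e ; to-next = h′ r e′ }

    -- The neighbours on both sides are included, so that a walk placed on the segment meets no edge
    -- to anything placed earlier.
    Free : (Pos → Maybe V) → Fin t → ℕ → ℕ → Set
    Free φ k o m = ∀ p v → φ p ≡ just v → ∀ i → i < m → p ≢ (k , o + i) × next p ≢ (k , o + i) × p ≢ next (k , o + i)

    at : ∀ {s j a h xs} → Walk s j a h xs → ℕ → V
    at (start v) i = v
    at (step {j} w v _ _) i with i Data.Nat.≟ suc j
    ... | yes _ = v
    ... | no _ = at w i

    at-step : ∀ {s j a h xs} (w : Walk s j a h xs) v e f i → i ≤ j → at (step w v e f) i ≡ at w i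
    at-step {j = j} w v e f i i≤ with i Data.Nat.≟ suc j
    ... | yes refl = ⊥-elim (<⇒≱ ≤-refl i≤)
    ... | no _ = refl

    at-last : ∀ {s j a h xs} (w : Walk s j a h xs) → at w j ≡ h
    at-last (start v) = refl
    at-last (step {j} w v _ _) with suc j Data.Nat.≟ suc j
    ... | yes _ = refl
    ... | no ¬p = ⊥-elim (¬p refl)

    at-first : ∀ {s j a h xs} (w : Walk s j a h xs) → at w 0 ≡ a
    at-first (start v) = refl
    at-first (step w v _ _) = at-first w

    record Extension (φ : Pos → Maybe V) (k : Fin t) (o : ℕ) {j a h xs} (w : Walk (λ i → s (k , o + i)) j a h xs) : Set where
      field
        map′      : Pos → Maybe V
        embedding : Embedding map′
        old       : ∀ p v → φ p ≡ just v → map′ p ≡ just v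
        new       : ∀ p v → map′ p ≡ just v → φ p ≡ just v ⊎ (∃ λ i → i ≤ j × p ≡ (k , o + i) × v ∈ xs)
        placed    : ∀ i → i ≤ j → map′ (k , o + i) ≡ just (at w i)

    -- Positions are filled in the order of the walk, so each new vertex has to fit its predecessor
    -- on the walk only. The exception is a segment forming the whole cycle, where the last vertex
    -- also precedes the first; `closing` covers this case.
    embed-walk : ∀ {φ k o m j a h xs} → Embedding φ → o + m ≤ ℓ k → Free φ k o m →
      (w : Walk (λ i → s (k , o + i)) j a h xs) → suc j ≤ m → (∀ u → u ∈ xs → Unused φ u) →
      (o ≡ 0 → suc (o + j) ≡ ℓ k → E (s (k , o + j)) h a ≡ true) → Extension φ k o w
    embed-walk {φ} {k} {o} {m} emb om free (start v) 1≤m unused closing = record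
      { map′ = φ [ (k , o + 0) ↦ v ]
      ; embedding = update-embedding emb (<-≤-trans (+-monoʳ-< o 1≤m) om) (unused v (here refl)) (record
          { from-prev = λ p a e f → ⊥-elim (proj₁ (proj₂ (free p a f 0 1≤m)) e)
          ; to-next = λ b f → ⊥-elim (proj₂ (proj₂ (free _ b f 0 1≤m)) refl) })
      ; old = λ p u f → trans (update-there φ _ v p (proj₁ (free p u f 0 1≤m))) f
      ; new = λ p u f → [ (λ { (e , refl) → inj₂ (0 , z≤n , e , here refl) }) , (λ { (_ , f) → inj₁ f }) ]′ (update-inv φ _ v p u f)
      ; placed = λ { zero _ → update-here φ (k , o + 0) v }
      }
    embed-walk {φ} {k} {o} {m} {suc j} {a} {h′} emb om free (step {h = h} {xs = xs} w v e v∉) jm unused closing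
      with embed-walk emb om free w (<⇒≤ jm) (λ u u∈ → unused u (there u∈))
             -- A proper initial part of the walk cannot reach the end of the cycle.
             (λ _ e → ⊥-elim (<⇒≢ (<-≤-trans (≤-<-trans (≤-reflexive (sym (+-suc o j))) (+-monoʳ-< o jm)) om) e))
    ... | ext = record
      { map′ = map′ [ u ↦ v ]
      ; embedding = update-embedding embedding val fresh (record { from-prev = before ; to-next = after })
      ; old = λ p x f → trans (update-there map′ u v p (proj₁ (free p x f (suc j) jm))) (old p x f)
      ; new = λ p x f → [ (λ { (e , refl) → inj₂ (suc j , ≤-refl , e , here refl) }) , (λ { (_ , f) → weaken (new p x f) }) ]′ (update-inv map′ u v p x f)
      ; placed = placed′
      }
      where
      open Extension ext
      u : Pos
      u = k , o + suc j
      val : o + suc j < ℓ k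
      val = <-≤-trans (+-monoʳ-< o jm) om
      weaken : ∀ {p x} → φ p ≡ just x ⊎ (∃ λ i → i ≤ j × p ≡ (k , o + i) × x ∈ xs) →
        φ p ≡ just x ⊎ (∃ λ i → i ≤ suc j × p ≡ (k , o + i) × x ∈ (v ∷ xs))
      weaken (inj₁ f) = inj₁ f
      weaken (inj₂ (i , i≤ , e , x∈)) = inj₂ (i , m≤n⇒m≤1+n i≤ , e , there x∈)
      fresh : Unused map′ v
      fresh p f with new p v f
      ... | inj₁ f′ = unused v (here refl) p f′
      ... | inj₂ (_ , _ , _ , v∈) = ∉ᵇ⇒∉ v∉ v∈
      before : ∀ p x → next p ≡ u → map′ p ≡ just x → E (s p) x v ≡ true
      before p x eq f with new p x f
      ... | inj₁ f′ = ⊥-elim (proj₁ (proj₂ (free p x f′ (suc j) jm)) eq)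
      ... | inj₂ (i , i≤ , refl , _) with next-inv k (o + i) k (o + suc j) eq
      ...   | _ , inj₁ (_ , z) = ⊥-elim (case trans (sym (+-suc o j)) z of λ ())
      ...   | _ , inj₂ z with +-cancelˡ-≡ o j i (suc-injective (trans (sym (+-suc o j)) z))
      ...     | refl with just-injective (trans (sym f) (trans (placed j ≤-refl) (cong just (at-last w))))
      ...       | refl = e
      -- An assigned successor of `u` can only be the start of the walk, reached by wrapping around;
      -- this forces `o ≡ 0`.
      after : ∀ b → map′ (next u) ≡ just b → E (s u) v b ≡ true
      after b f with new (next u) b f
      ... | inj₁ f′ = ⊥-elim (proj₂ (proj₂ (free (next u) b f′ (suc j) jm)) refl)
      ... | inj₂ (i , i≤ , eq , _) with next-inv k (o + suc j) k (o + i) eq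
      ...   | _ , inj₂ z = ⊥-elim (<⇒≢ (s≤s (+-monoʳ-≤ o (m≤n⇒m≤1+n i≤))) z)
      ...   | _ , inj₁ (wrap , z) with m+n≡0⇒m≡0 o z | m+n≡0⇒n≡0 o z
      ...     | refl | refl with just-injective (trans (sym f) (trans (cong map′ eq) (trans (placed 0 z≤n) (cong just (at-first w)))))
      ...       | refl = closing refl wrap
      placed′ : ∀ i → i ≤ suc j → (map′ [ u ↦ v ]) (k , o + i) ≡ just (at (step w v e v∉) i)
      placed′ i i≤ with m≤n⇒m<n∨m≡n i≤
      ... | inj₂ refl = trans (update-here map′ u v) (cong just (sym (at-last (step w v e v∉))))
      ... | inj₁ (s≤s i≤j) = trans (update-there map′ u v _ (λ z → <⇒≢ (s≤s i≤j) (+-cancelˡ-≡ o i (suc j) (,-injectiveʳ z))))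
        (trans (placed i i≤j) (cong just (sym (at-step w v e v∉ i i≤j))))

  ∑-allFin-suc : ∀ n f → ∑ (allFin (suc n)) f ≡ f Fin.zero + ∑ (allFin n) (f ∘ Fin.suc)
  ∑-allFin-suc n f = cong (f Fin.zero +_) (trans (cong (λ vs → ∑ vs f) (sym (map-tabulate {n = n} id Fin.suc))) (∑-map Fin.suc (allFin n) f))

  occ-allFin : ∀ {n} (v : Fin n) → occ v (allFin n) ≤ 1
  occ-allFin {suc n} Fin.zero = ≤-reflexive (trans (∑-allFin-suc n (λ x → ⟦ x == Fin.zero ⟧)) (cong suc (∑-zero (allFin n))))
  occ-allFin {suc n} (Fin.suc v) = ≤-trans (≤-reflexive (∑-allFin-suc n (λ x → ⟦ x == Fin.suc v ⟧))) (occ-allFin v)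

  ∑-concatMap : ∀ {A B : Set} (f : A → List B) xs g → ∑ (concatMap f xs) g ≡ ∑ xs (λ x → ∑ (f x) g)
  ∑-concatMap f [] g = refl
  ∑-concatMap f (x ∷ xs) g = trans (∑-++ (f x) (concatMap f xs) g) (cong (∑ (f x) g +_) (∑-concatMap f xs g))

  length-concatMap : ∀ {A B : Set} (f : A → List B) xs → length (concatMap f xs) ≡ ∑ xs (length ∘ f)
  length-concatMap f xs = trans (sym (∑-length (concatMap f xs))) (trans (∑-concatMap f xs (const 1)) (∑-cong xs (λ x → ∑-length (f x))))

  ∈-concatMap : ∀ {A B : Set} (f : A → List B) {xs x y} → x ∈ xs → y ∈ f x → y ∈ concatMap f xs
  ∈-concatMap f x∈ y∈ = concatMap⁺ f (lose x∈ y∈)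

  AllPairs-↭ : ∀ {A : Set} {R : A → A → Set} → (∀ {x y} → R x y → R y x) → ∀ {xs ys} → xs ↭ ys → AllPairs R xs → AllPairs R ys
  AllPairs-↭ {A} {R} sy p = PermutationSetoid.AllPairs-resp-↭ (setoid A) sy ((λ e → subst (R _) e) , (λ e → subst (λ x → R x _) e)) (↭⇒↭ₛ p)

  -- Absorption: gadgets and the exchange that fills a slot.

  module Absorption {n t : ℕ} (G : Digraph n) (ℓ : Fin t → ℕ) (3≤ℓ : ∀ k → 3 ≤ ℓ k) (s : Fin t × ℕ → Bool) (n≡ : n ≡ ∑ (allFin t) ℓ) where
    open Walks G
    open Positions G ℓ 3≤ℓ s

    positions : List Pos
    positions = concatMap (λ k → map (k ,_) (upTo (ℓ k))) (allFin t)

    length-positions : length positions ≡ n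
    length-positions = trans (length-concatMap _ (allFin t))
      (trans (∑-cong (allFin t) (λ k → trans (length-map (k ,_) (upTo (ℓ k))) (length-upTo (ℓ k)))) (sym n≡))

    ∈-positions : ∀ {p} → Valid p → p ∈ positions
    ∈-positions {k , a} val = ∈-concatMap (λ k → map (k ,_) (upTo (ℓ k))) (∈-allFin k) (∈-map⁺ (k ,_) (∈-upTo⁺ val))

    occupies : Maybe V → V → Bool
    occupies nothing w = false
    occupies (just v) w = v == w

    ∑-occupies : ∀ m → ∑ (allFin n) (λ w → ⟦ occupies m w ⟧) ≤ ⟦ is-just m ⟧
    ∑-occupies nothing = ≤-reflexive (∑-zero (allFin n))
    ∑-occupies (just v) = ≤-trans (≤-reflexive (∑-cong (allFin n) (λ w → cong ⟦_⟧ (==-comm v w)))) (occ-allFin v)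

    -- There are exactly `n` positions; with `u` empty, the assigned ones use at most `n ∸ 1`
    -- vertices.
    some-unused : ∀ {φ u} → Embedding φ → Valid u → φ u ≡ nothing → ∃ λ w → Unused φ w
    some-unused {φ} {u} emb val none with ∑-pick (allFin n) (const 1) (λ w → ∑ positions (λ p → ⟦ occupies (φ p) w ⟧)) fewer
      where
      length-allFin : length (allFin n) ≡ n
      length-allFin = length-tabulate id
      unassigned : ∃ λ ps → positions ↭ u ∷ ps
      unassigned = ∈-↭-∷ (∈-positions val)
      open ≤-Reasoning
      fewer : ∑ (allFin n) (λ w → ∑ positions (λ p → ⟦ occupies (φ p) w ⟧)) < ∑ (allFin n) (const 1)
      fewer = begin-strict
        ∑ (allFin n) (λ w → ∑ positions (λ p → ⟦ occupies (φ p) w ⟧)) ≡⟨ ∑-swap (allFin n) positions _ ⟩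
        ∑ positions (λ p → ∑ (allFin n) (λ w → ⟦ occupies (φ p) w ⟧)) ≤⟨ ∑-mono′ positions (λ p → ∑-occupies (φ p)) ⟩
        ∑ positions (λ p → ⟦ is-just (φ p) ⟧) ≡⟨ ∑-↭ _ (proj₂ unassigned) ⟩
        ⟦ is-just (φ u) ⟧ + ∑ (proj₁ unassigned) (λ p → ⟦ is-just (φ p) ⟧)
          ≡⟨ cong (λ m → ⟦ is-just m ⟧ + ∑ (proj₁ unassigned) (λ p → ⟦ is-just (φ p) ⟧)) none ⟩
        ∑ (proj₁ unassigned) (λ p → ⟦ is-just (φ p) ⟧) ≤⟨ ∑-mono′ (proj₁ unassigned) (λ p → ⟦⟧≤1 _) ⟩
        ∑ (proj₁ unassigned) (const 1) <⟨ ≤-refl ⟩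
        ∑ (u ∷ proj₁ unassigned) (const 1) ≡⟨ ∑-↭ (const 1) (proj₂ unassigned) ⟨
        ∑ positions (const 1) ≡⟨ trans (∑-length positions) (trans length-positions (sym length-allFin)) ⟩
        length (allFin n) ≡⟨ ∑-length (allFin n) ⟨
        ∑ (allFin n) (const 1) ∎
    ... | w , _ , h = w , λ p e → <⇒≱ h (≤-trans (≤-reflexive (cong ⟦_⟧ (sym (trans (cong (λ m → occupies m w) e) (==-refl w)))))
            (∑-∈ (λ p → ⟦ occupies (φ p) w ⟧) (∈-positions (dom emb p w e))))

    record Gadget : Set where
      constructor gadget
      field
        cyc   : Fin t
        off   : ℕ
        x r z : V
      spot : ℕ → Pos
      spot i = cyc , off + i
    open Gadget public

    record Placed (φ : Pos → Maybe V) (g : Gadget) : Set where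
      field
        inside : off g + 2 < ℓ (cyc g)
        at-x   : φ (spot g 0) ≡ just (x g)
        at-r   : φ (spot g 1) ≡ just (r g)
        at-z   : φ (spot g 2) ≡ just (z g)
    open Placed public

    Apart : Gadget → Gadget → Set
    Apart g g′ = ∀ i i′ → i < 3 → i′ < 3 → spot g i ≢ spot g′ i′

    Apart-sym : ∀ {g g′} → Apart g g′ → Apart g′ g
    Apart-sym h i i′ i< i′< e = h i′ i i′< i< (sym e)

    -- A slot is represented only by the two signed vertices that `compatible-pair` finds around it.
    -- This makes the number of demands polynomial and independent of the partial embedding reached
    -- later.
    record Demand : Set where
      constructor demand
      field
        w a b : V
        σ τ   : Bool
    open Demand public

    -- w can take over the place of r in the gadget while r moves to a slot between a and b.
    good : Demand → Gadget → Bool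
    good d g = (E (s (spot g 0)) (x g) (w d) ∧ E (s (spot g 1)) (w d) (z g)) ∧ (E (σ d) (a d) (r g) ∧ E (τ d) (b d) (r g))

    -- `kept` preserves only that a position is assigned, since the middle vertex of a gadget gets
    -- exchanged.
    record Absorbed (φ : Pos → Maybe V) (us : List Pos) : Set where
      field
        map′      : Pos → Maybe V
        embedding : Embedding map′
        kept      : ∀ p v → φ p ≡ just v → ∃ λ v′ → map′ p ≡ just v′
        filled    : ∀ u → u ∈ us → ∃ λ v → map′ u ≡ just v

    -- Two updates: `w₀` overwrites the middle of the gadget, which releases `r g`, and `r g` then
    -- goes to `u`.
    module Switch {φ : Pos → Maybe V} {u : Pos} {w₀ : V} {g : Gadget} (emb : Embedding φ) (val : Valid u) (none : φ u ≡ nothing)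
      (fresh : Unused φ w₀) (pl : Placed φ g) (e₁ : E (s (spot g 0)) (x g) w₀ ≡ true) (e₂ : E (s (spot g 1)) w₀ (z g) ≡ true)
      (comp : Compatible φ u (r g)) where

      c : Pos
      c = spot g 1

      next-x : next (spot g 0) ≡ c
      next-x = trans (next-suc (cyc g) (off g + 0) (≤-trans (≤-reflexive (cong suc (sym (+-suc (off g) 0)))) (≤-trans (s≤s (+-monoʳ-≤ (off g) (s≤s z≤n))) (inside pl))))
        (cong (cyc g ,_) (sym (+-suc (off g) 0)))

      next-c : next c ≡ spot g 2
      next-c = trans (next-suc (cyc g) (off g + 1) (≤-trans (≤-reflexive (cong suc (sym (+-suc (off g) 1)))) (inside pl)))
        (cong (cyc g ,_) (sym (+-suc (off g) 1)))

      c-valid : Valid c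
      c-valid = dom emb c (r g) (at-r pl)

      u≢c : u ≢ c
      u≢c refl = case trans (sym none) (at-r pl) of λ ()

      φ₁ φ₂ : Pos → Maybe V
      φ₁ = φ [ c ↦ w₀ ]
      φ₂ = φ₁ [ u ↦ r g ]

      emb₁ : Embedding φ₁
      emb₁ = update-embedding emb c-valid fresh (record { from-prev = before ; to-next = after })
        where
        before : ∀ p y → next p ≡ c → φ p ≡ just y → E (s p) y w₀ ≡ true
        before p y e f with trans (prev-next p c c-valid e) (sym (prev-next (spot g 0) c c-valid next-x))
        ... | refl with just-injective (trans (sym f) (at-x pl))
        ...   | refl = e₁
        after : ∀ y → φ (next c) ≡ just y → E (s c) w₀ y ≡ true
        after y f with just-injective (trans (sym f) (trans (cong φ next-c) (at-z pl)))
        ... | refl = e₂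

      emb₂ : Embedding φ₂
      emb₂ = update-embedding emb₁ val unused (record { from-prev = before ; to-next = after })
        where
        unused : Unused φ₁ (r g)
        unused p f with update-inv φ c w₀ p (r g) f
        ... | inj₁ (_ , refl) = fresh c (at-r pl)
        ... | inj₂ (p≢ , f′) = p≢ (inj emb p c (r g) f′ (at-r pl))
        -- Both neighbours of `c` are assigned and `u` is not, so `u` is not next to `c`, and the
        -- first update leaves the surroundings of `u` unchanged.
        before : ∀ p y → next p ≡ u → φ₁ p ≡ just y → E (s p) y (r g) ≡ true
        before p y e f with update-inv φ c w₀ p y f
        ... | inj₁ (refl , _) = case trans (sym none) (trans (cong φ (trans (sym e) next-c)) (at-z pl)) of λ ()
        ... | inj₂ (_ , f′) = from-prev comp p y e f′
        after : ∀ y → φ₁ (next u) ≡ just y → E (s u) (r g) y ≡ true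
        after y f with update-inv φ c w₀ (next u) y f
        ... | inj₁ (e , _) = case trans (sym none) (trans (cong φ (trans (prev-next u c c-valid e) (sym (prev-next (spot g 0) c c-valid next-x)))) (at-x pl)) of λ ()
        ... | inj₂ (_ , f′) = to-next comp y f′

      u-filled : φ₂ u ≡ just (r g)
      u-filled = update-here φ₁ u (r g)

      elsewhere : ∀ p v → φ p ≡ just v → p ≢ c → φ₂ p ≡ just v
      elsewhere p v f p≢ = trans (update-there φ₁ u (r g) p (λ { refl → case trans (sym none) f of λ () })) (trans (update-there φ c w₀ p p≢) f)

      kept₂ : ∀ p v → φ p ≡ just v → ∃ λ v′ → φ₂ p ≡ just v′
      kept₂ p v f with p ≟ₚ c
      ... | yes refl = w₀ , trans (update-there φ₁ u (r g) c (λ e → u≢c (sym e))) (update-here φ c w₀)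
      ... | no p≢ = v , elsewhere p v f p≢

      placed₂ : ∀ g′ → Placed φ g′ → Apart g g′ → Placed φ₂ g′
      placed₂ g′ pl′ ap = record
        { inside = inside pl′
        ; at-x = elsewhere _ _ (at-x pl′) (away 0 (s≤s z≤n))
        ; at-r = elsewhere _ _ (at-r pl′) (away 1 (s≤s (s≤s z≤n)))
        ; at-z = elsewhere _ _ (at-z pl′) (away 2 (s≤s (s≤s (s≤s z≤n))))
        }
        where
        away : ∀ i → i < 3 → spot g′ i ≢ c
        away i i< e = ap 1 i (s≤s (s≤s z≤n)) i< (sym e)

    -- A slot consumes at most one gadget, which lowers the hits of each demand by at most one, in
    -- step with `length us`. The remaining gadgets are apart from the consumed one and stay intact.
    absorb : ∀ us φ gs → Embedding φ → (∀ u → u ∈ us → Valid u) → (∀ g → g ∈ gs → Placed φ g) → AllPairs Apart gs →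
      (∀ d → length us ≤ ∑ gs (λ g → ⟦ good d g ⟧)) → Absorbed φ us
    absorb [] φ gs emb val pl ap hits = record { map′ = φ ; embedding = emb ; kept = λ p v f → v , f ; filled = λ u () }
    absorb (u ∷ us) φ gs emb val pl ap hits with φ u in eq
    ... | just v = record
      { map′ = map′ ; embedding = embedding ; kept = kept
      ; filled = λ { u (here refl) → kept u v eq ; u (there u∈) → filled u u∈ } }
      where
      open Absorbed (absorb us φ gs emb (λ u u∈ → val u (there u∈)) pl ap (λ d → ≤-trans (n≤1+n _) (hits d)))
    ... | nothing with some-unused emb (val u (here refl)) eq
    ...   | w₀ , fresh with compatible-pair {φ} w₀ (val u (here refl))
    ...     | a₀ , σ₀ , b₀ , τ₀ , comp with search (good (demand w₀ a₀ b₀ σ₀ τ₀)) gs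
    ...       | inj₂ zero-hits = ⊥-elim (<⇒≱ z<s (≤-trans (hits (demand w₀ a₀ b₀ σ₀ τ₀)) (≤-reflexive zero-hits)))
    ...       | inj₁ (g , g∈ , ok) with ∈-↭-∷ g∈
    ...         | gs′ , gσ with AllPairs-↭ (λ {g} {g′} → Apart-sym {g} {g′}) gσ ap | ∧-true (E (s (spot g 0)) (x g) w₀ ∧ E (s (spot g 1)) w₀ (z g)) ok
    ...           | apart ∷ ap′ | fit , free with ∧-true (E (s (spot g 0)) (x g) w₀) fit | ∧-true (E σ₀ a₀ (r g)) free
    ...             | e₁ , e₂ | e₃ , e₄ = record
      { map′ = map′ ; embedding = embedding
      ; kept = λ p v f → let v′ , f′ = kept₂ p v f in kept p v′ f′
      ; filled = λ { u (here refl) → kept u (r g) u-filled ; u (there u∈) → filled u u∈ } }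
      where
      open Switch emb (val u (here refl)) eq fresh (pl g g∈) e₁ e₂ (comp (r g) e₃ e₄)
      open Absorbed (absorb us φ₂ gs′ emb₂ (λ u u∈ → val u (there u∈))
        (λ g′ g′∈ → placed₂ g′ (pl g′ (∈-resp-↭ (↭-sym gσ) (there g′∈))) (All.lookup apart g′∈)) ap′
        (λ d → ≤-pred (≤-trans (hits d) (≤-trans (≤-reflexive (∑-↭ _ gσ)) (+-monoˡ-≤ _ (⟦⟧≤1 (good d g)))))))

  -- Choosing gadgets by exponential weights.

  pick³ : ∀ {A : Set} (xs : List A) (f : A → A → A → ℕ) k → 0 < length xs →
    length xs * (length xs * (length xs * k)) ≤ ∑ xs (λ a → ∑ xs (λ b → ∑ xs (f a b))) → ∃ λ a → ∃ λ b → ∃ λ c → k ≤ f a b c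
  pick³ xs f k pos h =
    let a , _ , ha = ∑-pick≤ xs (const (length xs * (length xs * k))) _ pos (≤-trans (≤-reflexive (∑-const xs _)) h)
        b , _ , hb = ∑-pick≤ xs (const (length xs * k)) _ pos (≤-trans (≤-reflexive (∑-const xs _)) ha)
        c , _ , hc = ∑-pick≤ xs (const k) _ pos (≤-trans (≤-reflexive (∑-const xs _)) hb)
    in a , b , c , hc

  *-pos⁻ : ∀ a b → 0 < a * b → 0 < a × 0 < b
  *-pos⁻ zero b ()
  *-pos⁻ (suc a) zero h = ⊥-elim (<⇒≱ h (≤-reflexive (*-zeroʳ a)))
  *-pos⁻ (suc a) (suc b) h = z<s , z<s

  -- (1 + 1/c)^m ≥ 1 + m/c, cleared of denominators.
  bernoulli : ∀ c m → c ^ m * (c + m) ≤ suc c ^ m * c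
  bernoulli c zero = ≤-reflexive (cong (_+ 0) (+-identityʳ c))
  bernoulli c (suc m) = begin
    c * c ^ m * (c + suc m) ≤⟨ m≤m+n _ (c ^ m * m) ⟩
    c * c ^ m * (c + suc m) + c ^ m * m ≡⟨ eq c (c ^ m) m ⟩
    suc c * (c ^ m * (c + m)) ≤⟨ *-monoʳ-≤ (suc c) (bernoulli c m) ⟩
    suc c * (suc c ^ m * c) ≡⟨ *-assoc (suc c) (suc c ^ m) c ⟨
    suc c * suc c ^ m * c ∎
    where
    open ≤-Reasoning
    eq : ∀ c p m → c * p * (c + suc m) + p * m ≡ suc c * (p * (c + m))
    eq = solve-∀

  doubling : ∀ c → 0 < c → 2 * c ^ c ≤ suc c ^ c
  doubling c pos = *-cancelʳ-≤ _ _ c {{>-nonZero pos}} (≤-trans (≤-reflexive (eq (c ^ c) c)) (bernoulli c c))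
    where
    eq : ∀ p c → 2 * p * c ≡ p * (c + c)
    eq = solve-∀

  -- Cut the exponent into `k` blocks of length `c`, each giving a factor 2, and drop the rest. This
  -- converts the decay of the weights into a power of 2.
  doubling-pow : ∀ c k f → 0 < c → c * k ≤ f → 2 ^ k * c ^ f ≤ suc c ^ f
  doubling-pow c k f pos h with m≤n⇒∃[o]m+o≡n h
  ... | o , refl = begin
    2 ^ k * c ^ (c * k + o) ≡⟨ cong (2 ^ k *_) (trans (^-distribˡ-+-* c (c * k) o) (cong (_* c ^ o) (sym (^-*-assoc c c k)))) ⟩
    2 ^ k * ((c ^ c) ^ k * c ^ o) ≡⟨ *-assoc (2 ^ k) _ _ ⟨
    2 ^ k * (c ^ c) ^ k * c ^ o ≡⟨ cong (_* c ^ o) (^-distribʳ-* k 2 (c ^ c)) ⟨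
    (2 * c ^ c) ^ k * c ^ o ≤⟨ *-mono-≤ (^-monoˡ-≤ k (doubling c pos)) (^-monoˡ-≤ o (n≤1+n c)) ⟩
    (suc c ^ c) ^ k * suc c ^ o ≡⟨ trans (^-distribˡ-+-* (suc c) (c * k) o) (cong (_* suc c ^ o) (sym (^-*-assoc (suc c) c k))) ⟨
    suc c ^ (c * k + o) ∎
    where
    open ≤-Reasoning
    ^-distribʳ-* : ∀ k a b → (a * b) ^ k ≡ a ^ k * b ^ k
    ^-distribʳ-* zero a b = refl
    ^-distribʳ-* (suc k) a b rewrite ^-distribʳ-* k a b = eq a b (a ^ k) (b ^ k)
      where
      eq : ∀ a b x y → a * b * (x * y) ≡ a * x * (b * y)
      eq = solve-∀

  ^-pos : ∀ m k → 0 < m → 0 < m ^ k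
  ^-pos m zero h = z<s
  ^-pos m (suc k) h = *-mono-≤ h (^-pos m k h)

  module Selection {n t : ℕ} (G : Digraph n) (ℓ : Fin t → ℕ) (3≤ℓ : ∀ k → 3 ≤ ℓ k) (s : Fin t × ℕ → Bool) (n≡ : n ≡ ∑ (allFin t) ℓ)
    (n>0 : 0 < n) (q : ℕ) where
    open Walks G
    open Positions G ℓ 3≤ℓ s
    open Absorption G ℓ 3≤ℓ s n≡

    length-all : length all ≡ n
    length-all = length-tabulate id

    signs : List Bool
    signs = true ∷ false ∷ []

    demands : List Demand
    demands = concatMap (λ w → concatMap (λ a → concatMap (λ b → concatMap (λ σ → map (λ τ → demand w a b σ τ) signs) signs) all) all) all

    ∈-signs : ∀ σ → σ ∈ signs
    ∈-signs true = here refl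
    ∈-signs false = there (here refl)

    ∈-demands : ∀ d → d ∈ demands
    ∈-demands (demand w a b σ τ) = ∈-concatMap _ (∈-allFin w) (∈-concatMap _ (∈-allFin a) (∈-concatMap _ (∈-allFin b)
      (∈-concatMap (λ σ → map (λ τ → demand w a b σ τ) signs) (∈-signs σ) (∈-map⁺ (demand w a b σ) (∈-signs τ)))))

    length-demands : length demands ≡ 4 * (n * (n * n))
    length-demands = trans (length-concatMap _ all) (trans (∑-cong all (λ w →
      trans (length-concatMap _ all) (trans (∑-cong all (λ a → trans (length-concatMap _ all) (trans (∑-const all 4) (cong (_* 4) length-all))))
        (trans (∑-const all (n * 4)) (cong (_* (n * 4)) length-all)))))
      (trans (∑-const all (n * (n * 4))) (trans (cong (_* (n * (n * 4))) length-all) (eq n))))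
      where
      eq : ∀ n → n * (n * (n * 4)) ≡ 4 * (n * (n * n))
      eq = solve-∀

    -- The extra edge from z to x is only demanded when gadgets are to be placed on triangles.
    module Choose (closing : Pos → V → V → Bool) (B : ℕ)
      (dense : ∀ h a σ τ p x us → length us ≤ B → n ≤ q * ∑ all (λ z → ⟦ ((E σ h z ∧ E τ a z) ∧ closing p z x) ∧ not (z ∈ᵇ us) ⟧)) where

      dense₂ : ∀ h a σ τ us → length us ≤ B → Pos → n ≤ q * ∑ all (λ z → ⟦ (E σ h z ∧ E τ a z) ∧ not (z ∈ᵇ us) ⟧)
      dense₂ h a σ τ us le p = ≤-trans (dense h a σ τ p h us le) (*-monoʳ-≤ q (∑-mono′ all (λ z → forget (E σ h z ∧ E τ a z) (closing p z h))))
        where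
        forget : ∀ a b {c} → ⟦ (a ∧ b) ∧ c ⟧ ≤ ⟦ a ∧ c ⟧
        forget true true = ≤-refl
        forget true false = z≤n
        forget false b = z≤n

      module Triple (p : Pos) (us : List V) (room : suc (suc (length us)) ≤ B) (W : Demand → ℕ) (W>0 : 0 < ∑ demands W) where
        s₀ s₁ : Bool
        s₀ = s (proj₁ p , proj₂ p + 0)
        s₁ = s (proj₁ p , proj₂ p + 1)

        gad : V → V → V → Gadget
        gad r x z = gadget (proj₁ p) (proj₂ p) x r z

        Rᵇ : Demand → V → Bool
        Rᵇ d r = (E (σ d) (a d) r ∧ E (τ d) (b d) r) ∧ not (r ∈ᵇ us)

        Xᵇ : Demand → V → V → Bool
        Xᵇ d r x = (E (not s₀) (w d) x ∧ E (not s₀) r x) ∧ not (x ∈ᵇ (r ∷ us))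

        Zᵇ : Demand → V → V → V → Bool
        Zᵇ d r x z = ((E s₁ (w d) z ∧ E s₁ r z) ∧ closing p z x) ∧ not (z ∈ᵇ (x ∷ r ∷ us))

        ind : Demand → V → V → V → ℕ
        ind d r x z = ⟦ Rᵇ d r ⟧ * (⟦ Xᵇ d r x ⟧ * ⟦ Zᵇ d r x z ⟧)

        -- Choose `r`, then `x`, then `z`: by `dense`, each has at least `n / q` candidates whatever
        -- was chosen before.
        many : ∀ d → n * (n * n) ≤ q * (q * q) * ∑ all (λ r → ∑ all (λ x → ∑ all (ind d r x)))
        many d = begin
          n * (n * n) ≤⟨ *-monoˡ-≤ (n * n) (dense₂ (a d) (b d) (σ d) (τ d) us (≤-trans (n≤1+n _) (≤-trans (n≤1+n _) room)) p) ⟩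
          q * ∑ all (λ r → ⟦ Rᵇ d r ⟧) * (n * n) ≡⟨ trans (*-assoc q _ (n * n)) (cong (q *_) (sym (∑-*ʳ all (n * n) _))) ⟩
          q * ∑ all (λ r → ⟦ Rᵇ d r ⟧ * (n * n)) ≤⟨ *-monoʳ-≤ q (∑-mono′ all (λ r → *-monoʳ-≤ ⟦ Rᵇ d r ⟧ (inner r))) ⟩
          q * ∑ all (λ r → ⟦ Rᵇ d r ⟧ * (q * q * ∑ all (λ x → ∑ all (λ z → ⟦ Xᵇ d r x ⟧ * ⟦ Zᵇ d r x z ⟧))))
            ≡⟨ cong (q *_) (∑-cong all (λ r → trans (eq ⟦ Rᵇ d r ⟧ (q * q) _) (cong (q * q *_) (pull r)))) ⟩
          q * ∑ all (λ r → q * q * ∑ all (λ x → ∑ all (ind d r x))) ≡⟨ cong (q *_) (∑-* all (q * q) _) ⟩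
          q * (q * q * ∑ all (λ r → ∑ all (λ x → ∑ all (ind d r x)))) ≡⟨ *-assoc q (q * q) _ ⟨
          q * (q * q) * ∑ all (λ r → ∑ all (λ x → ∑ all (ind d r x))) ∎
          where
          open ≤-Reasoning
          eq : ∀ a b c → a * (b * c) ≡ b * (a * c)
          eq = solve-∀
          pull : ∀ r → ⟦ Rᵇ d r ⟧ * ∑ all (λ x → ∑ all (λ z → ⟦ Xᵇ d r x ⟧ * ⟦ Zᵇ d r x z ⟧)) ≡ ∑ all (λ x → ∑ all (ind d r x))
          pull r = trans (sym (∑-* all ⟦ Rᵇ d r ⟧ _)) (∑-cong all (λ x → sym (∑-* all ⟦ Rᵇ d r ⟧ _)))
          inner : ∀ r → n * n ≤ q * q * ∑ all (λ x → ∑ all (λ z → ⟦ Xᵇ d r x ⟧ * ⟦ Zᵇ d r x z ⟧))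
          inner r = begin
            n * n ≤⟨ *-monoˡ-≤ n (dense₂ (w d) r (not s₀) (not s₀) (r ∷ us) (≤-trans (n≤1+n _) room) p) ⟩
            q * ∑ all (λ x → ⟦ Xᵇ d r x ⟧) * n ≡⟨ trans (*-assoc q _ n) (cong (q *_) (sym (∑-*ʳ all n _))) ⟩
            q * ∑ all (λ x → ⟦ Xᵇ d r x ⟧ * n) ≤⟨ *-monoʳ-≤ q (∑-mono′ all (λ x → *-monoʳ-≤ ⟦ Xᵇ d r x ⟧ (dense (w d) r s₁ s₁ p x (x ∷ r ∷ us) room))) ⟩
            q * ∑ all (λ x → ⟦ Xᵇ d r x ⟧ * (q * ∑ all (λ z → ⟦ Zᵇ d r x z ⟧)))
              ≡⟨ cong (q *_) (∑-cong all (λ x → trans (eq ⟦ Xᵇ d r x ⟧ q _) (cong (q *_) (sym (∑-* all ⟦ Xᵇ d r x ⟧ _))))) ⟩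
            q * ∑ all (λ x → q * ∑ all (λ z → ⟦ Xᵇ d r x ⟧ * ⟦ Zᵇ d r x z ⟧)) ≡⟨ cong (q *_) (∑-* all q _) ⟩
            q * (q * ∑ all (λ x → ∑ all (λ z → ⟦ Xᵇ d r x ⟧ * ⟦ Zᵇ d r x z ⟧))) ≡⟨ *-assoc q q _ ⟨
            q * q * ∑ all (λ x → ∑ all (λ z → ⟦ Xᵇ d r x ⟧ * ⟦ Zᵇ d r x z ⟧)) ∎

        F : V → V → V → ℕ
        F r x z = q * (q * q) * ∑ demands (λ d → W d * ind d r x z)

        -- Weighted double counting of demands against triples. By averaging, some triple serves
        -- demands carrying at least `1 / Q` of the whole weight.
        total : length all * (length all * (length all * ∑ demands W)) ≤ ∑ all (λ r → ∑ all (λ x → ∑ all (F r x)))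
        total = begin
          length all * (length all * (length all * ∑ demands W)) ≡⟨ cong (λ k → k * (k * (k * ∑ demands W))) length-all ⟩
          n * (n * (n * ∑ demands W)) ≡⟨ trans (eq n (∑ demands W)) (sym (∑-*ʳ demands (n * (n * n)) W)) ⟩
          ∑ demands (λ d → W d * (n * (n * n))) ≤⟨ ∑-mono′ demands (λ d → *-monoʳ-≤ (W d) (many d)) ⟩
          ∑ demands (λ d → W d * (Q * ∑ all (λ r → ∑ all (λ x → ∑ all (ind d r x)))))
            ≡⟨ ∑-cong demands (λ d → trans (eq₂ (W d) Q _) (cong (Q *_) (push d))) ⟩
          ∑ demands (λ d → Q * ∑ all (λ r → ∑ all (λ x → ∑ all (λ z → W d * ind d r x z)))) ≡⟨ ∑-* demands Q _ ⟩
          Q * ∑ demands (λ d → ∑ all (λ r → ∑ all (λ x → ∑ all (λ z → W d * ind d r x z)))) ≡⟨ cong (Q *_) swapped ⟩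
          Q * ∑ all (λ r → ∑ all (λ x → ∑ all (λ z → ∑ demands (λ d → W d * ind d r x z))))
            ≡⟨ trans (sym (∑-* all Q _)) (∑-cong all (λ r → trans (sym (∑-* all Q _)) (∑-cong all (λ x → sym (∑-* all Q _))))) ⟩
          ∑ all (λ r → ∑ all (λ x → ∑ all (F r x))) ∎
          where
          open ≤-Reasoning
          Q : ℕ
          Q = q * (q * q)
          eq : ∀ n k → n * (n * (n * k)) ≡ k * (n * (n * n))
          eq = solve-∀
          eq₂ : ∀ a b c → a * (b * c) ≡ b * (a * c)
          eq₂ = solve-∀
          push : ∀ d → W d * ∑ all (λ r → ∑ all (λ x → ∑ all (ind d r x))) ≡ ∑ all (λ r → ∑ all (λ x → ∑ all (λ z → W d * ind d r x z)))
          push d = trans (sym (∑-* all (W d) _)) (∑-cong all (λ r → trans (sym (∑-* all (W d) _)) (∑-cong all (λ x → sym (∑-* all (W d) _)))))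
          swapped : ∑ demands (λ d → ∑ all (λ r → ∑ all (λ x → ∑ all (λ z → W d * ind d r x z)))) ≡
            ∑ all (λ r → ∑ all (λ x → ∑ all (λ z → ∑ demands (λ d → W d * ind d r x z))))
          swapped = trans (∑-swap demands all _) (∑-cong all (λ r → trans (∑-swap demands all _) (∑-cong all (λ x → ∑-swap demands all _))))

        record Found : Set where
          field
            r x z   : V
            xr      : E s₀ x r ≡ true
            rz      : E s₁ r z ≡ true
            zx      : closing p z x ≡ true
            r∉      : r ∈ᵇ us ≡ false
            x∉      : x ∈ᵇ (r ∷ us) ≡ false
            z∉      : z ∈ᵇ (x ∷ r ∷ us) ≡ false
            hits    : ∑ demands W ≤ q * (q * q) * ∑ demands (λ d → W d * ⟦ good d (gad r x z) ⟧)

        -- That the triple is a path avoiding `us` does not depend on the demand, but it is recorded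
        -- only inside `ind`; a single demand with a nonzero contribution certifies it.
        module Extract (r x z : V) (h : ∑ demands W ≤ F r x z) (d : Demand) (pos : 0 < W d * ind d r x z) where
          ind>0 : 0 < ind d r x z
          ind>0 = proj₂ (*-pos⁻ (W d) (ind d r x z) pos)

          XZ>0 : 0 < ⟦ Xᵇ d r x ⟧ * ⟦ Zᵇ d r x z ⟧
          XZ>0 = proj₂ (*-pos⁻ ⟦ Rᵇ d r ⟧ _ ind>0)

          R-true : Rᵇ d r ≡ true
          R-true = ⟦⟧-true (Rᵇ d r) (proj₁ (*-pos⁻ ⟦ Rᵇ d r ⟧ _ ind>0))

          X-true : (E (not s₀) (w d) x ∧ E (not s₀) r x) ≡ true × not (x ∈ᵇ (r ∷ us)) ≡ true
          X-true = ∧-true _ (⟦⟧-true (Xᵇ d r x) (proj₁ (*-pos⁻ ⟦ Xᵇ d r x ⟧ ⟦ Zᵇ d r x z ⟧ XZ>0)))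

          Z-true : ((E s₁ (w d) z ∧ E s₁ r z) ∧ closing p z x) ≡ true × not (z ∈ᵇ (x ∷ r ∷ us)) ≡ true
          Z-true = ∧-true _ (⟦⟧-true (Zᵇ d r x z) (proj₂ (*-pos⁻ ⟦ Xᵇ d r x ⟧ ⟦ Zᵇ d r x z ⟧ XZ>0)))

          Z-edges : (E s₁ (w d) z ∧ E s₁ r z) ≡ true × closing p z x ≡ true
          Z-edges = ∧-true _ (proj₁ Z-true)

          ind≤good : ∀ d → ind d r x z ≤ ⟦ good d (gad r x z) ⟧
          ind≤good d = subst₂ (λ e f → ind d r x z ≤ ⟦ (e ∧ f) ∧ (E (σ d) (a d) r ∧ E (τ d) (b d) r) ⟧)
            (sym (E-flip s₀ x (w d))) refl
            (bool (E (not s₀) (w d) x) (E s₁ (w d) z) (E (σ d) (a d) r ∧ E (τ d) (b d) r)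
              (not (r ∈ᵇ us)) (E (not s₀) r x) (not (x ∈ᵇ (r ∷ us))) (E s₁ r z) (closing p z x) (not (z ∈ᵇ (x ∷ r ∷ us))))
            where
            bool : ∀ e f g c₁ c₂ c₃ c₄ c₅ c₆ → ⟦ g ∧ c₁ ⟧ * (⟦ (e ∧ c₂) ∧ c₃ ⟧ * ⟦ ((f ∧ c₄) ∧ c₅) ∧ c₆ ⟧) ≤ ⟦ (e ∧ f) ∧ g ⟧
            bool e f false c₁ c₂ c₃ c₄ c₅ c₆ = z≤n
            bool false f true c₁ c₂ c₃ c₄ c₅ c₆ = ≤-reflexive (*-zeroʳ ⟦ c₁ ⟧)
            bool true false true c₁ c₂ c₃ c₄ c₅ c₆ = ≤-reflexive (trans (cong (⟦ c₁ ⟧ *_) (*-zeroʳ ⟦ c₂ ∧ c₃ ⟧)) (*-zeroʳ ⟦ c₁ ⟧))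
            bool true true true c₁ c₂ c₃ c₄ c₅ c₆ = *-mono-≤ (⟦⟧≤1 c₁) (*-mono-≤ (⟦⟧≤1 (c₂ ∧ c₃)) (⟦⟧≤1 ((c₄ ∧ c₅) ∧ c₆)))

          result : Found
          result = record
            { r = r ; x = x ; z = z
            ; xr = trans (E-flip s₀ x r) (proj₂ (∧-true (E (not s₀) (w d) x) (proj₁ X-true)))
            ; rz = proj₂ (∧-true (E s₁ (w d) z) (proj₁ Z-edges))
            ; zx = proj₂ Z-edges
            ; r∉ = not-true (proj₂ (∧-true (E (σ d) (a d) r ∧ E (τ d) (b d) r) R-true))
            ; x∉ = not-true (proj₂ X-true)
            ; z∉ = not-true (proj₂ Z-true)
            ; hits = ≤-trans h (*-monoʳ-≤ (q * (q * q)) (∑-mono′ demands (λ d → *-monoʳ-≤ (W d) (ind≤good d))))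
            }

        found : Found
        found = locate (pick³ all F (∑ demands W) (≤-trans n>0 (≤-reflexive (sym length-all))) total)
          where
          locate : (∃ λ r → ∃ λ x → ∃ λ z → ∑ demands W ≤ F r x z) → Found
          locate (r , x , z , h) = let d , _ , pos = ∑-pick demands (λ d → W d * ind d r x z) (const 0)
                                         (≤-trans (s≤s (≤-reflexive (∑-zero demands))) (proj₂ (*-pos⁻ (q * (q * q)) _ (≤-trans W>0 h))))
                                   in Extract.result r x z h d pos

    spotᵇ : Pos → ℕ → Pos
    spotᵇ p i = proj₁ p , proj₂ p + i

    -- A block is given by its first position and its size.
    Block : Set
    Block = Pos × ℕ

    Separated : Block → Block → Set
    Separated (p , m) (p′ , m′) = ∀ i i′ → i < m → i′ < m′ →
      spotᵇ p i ≢ spotᵇ p′ i′ × next (spotᵇ p i) ≢ spotᵇ p′ i′ × spotᵇ p i ≢ next (spotᵇ p′ i′)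

    Separated-sym : ∀ {b b′} → Separated b b′ → Separated b′ b
    Separated-sym h i i′ i< i′< = let a , b , c = h i′ i i′< i< in
      (λ e → a (sym e)) , (λ e → c (sym e)) , (λ e → b (sym e))

    -- 2 to the number of gadgets that do not serve d.
    misses : List Gadget → Demand → ℕ
    misses [] d = 1
    misses (g ∷ gs) d = (if good d g then 1 else 2) * misses gs d

    misses-pos : ∀ gs d → 0 < misses gs d
    misses-pos [] d = z<s
    misses-pos (g ∷ gs) d with good d g
    ... | true = ≤-trans (misses-pos gs d) (m≤m+n _ 0)
    ... | false = ≤-trans (misses-pos gs d) (m≤m+n _ _)

    misses-hits : ∀ gs d → misses gs d * 2 ^ ∑ gs (λ g → ⟦ good d g ⟧) ≡ 2 ^ length gs
    misses-hits [] d = refl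
    misses-hits (g ∷ gs) d with good d g
    ... | true = trans (eq (misses gs d) (2 ^ ∑ gs (λ g → ⟦ good d g ⟧))) (cong (2 *_) (misses-hits gs d))
      where
      eq : ∀ a b → 1 * a * (2 * b) ≡ 2 * (a * b)
      eq = solve-∀
    ... | false = trans (*-assoc 2 (misses gs d) _) (cong (2 *_) (misses-hits gs d))

    misses-step : ∀ gs g → ∑ demands (misses (g ∷ gs)) + ∑ demands (λ d → misses gs d * ⟦ good d g ⟧) ≡ 2 * ∑ demands (misses gs)
    misses-step gs g = trans (sym (∑-+ demands (misses (g ∷ gs)) _)) (trans (∑-cong demands step-eq) (∑-* demands 2 (misses gs)))
      where
      step-eq : ∀ d → misses (g ∷ gs) d + misses gs d * ⟦ good d g ⟧ ≡ 2 * misses gs d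
      step-eq d with good d g
      ... | true = eq (misses gs d)
        where
        eq : ∀ m → 1 * m + m * 1 ≡ 2 * m
        eq = solve-∀
      ... | false = eq (misses gs d)
        where
        eq : ∀ m → 2 * m + m * 0 ≡ 2 * m
        eq = solve-∀

    Q : ℕ
    Q = q * (q * q)

    -- `decay` states that each gadget multiplied the total weight of the demands, initially their
    -- number, by at most `2 - 1 / Q`. `used` lists the vertices that later choices must avoid.
    record Selected (sites : List Pos) : Set where
      field
        φ         : Pos → Maybe V
        emb       : Embedding φ
        gs        : List Gadget
        used      : List V
        image     : ∀ p v → φ p ≡ just v → v ∈ used
        domain    : ∀ p v → φ p ≡ just v → ∃₂ λ p₀ i → p₀ ∈ sites × i < 3 × p ≡ spotᵇ p₀ i
        used-size : length used ≡ 3 * length sites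
        placed    : ∀ g → g ∈ gs → Placed φ g
        origin    : ∀ g → g ∈ gs → (cyc g , off g) ∈ sites
        apart     : AllPairs Apart gs
        gs-size   : length gs ≡ length sites
        decay     : Q ^ length gs * ∑ demands (misses gs) ≤ (2 * Q ∸ 1) ^ length gs * length demands

    module Select (closing : Pos → V → V → Bool) (B : ℕ)
      (dense : ∀ h a σ τ p x us → length us ≤ B → n ≤ q * ∑ all (λ z → ⟦ ((E σ h z ∧ E τ a z) ∧ closing p z x) ∧ not (z ∈ᵇ us) ⟧)) where
      open Choose closing B dense

      demands-pos : 0 < length demands
      demands-pos = ≤-trans (*-mono-≤ {1} {4} (s≤s z≤n) (*-mono-≤ n>0 (*-mono-≤ n>0 n>0))) (≤-reflexive (sym length-demands))

      Site : Pos → Set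
      Site p = proj₂ p + 3 ≤ ℓ (proj₁ p) × (∀ z x → proj₂ p ≡ 0 → suc (proj₂ p + 2) ≡ ℓ (proj₁ p) → closing p z x ≡ true → E (s (spotᵇ p 2)) z x ≡ true)

      weights-pos : ∀ gs → 0 < ∑ demands (misses gs)
      weights-pos gs = ≤-trans demands-pos (≤-trans (≤-reflexive (sym (∑-length demands))) (∑-mono′ demands (misses-pos gs)))

      module Grow (p : Pos) (sites : List Pos) (site : Site p) (sep₀ : All (λ p′ → Separated (p , 3) (p′ , 3)) sites) (S : Selected sites)
        (room : suc (suc (length (Selected.used S))) ≤ B) (found : Triple.Found p (Selected.used S) room (misses (Selected.gs S)) (weights-pos (Selected.gs S))) where

        module T = Triple.Found found
        k : Fin t
        k = proj₁ p
        o : ℕ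
        o = proj₂ p
        φ₁ = Selected.φ S
        gs₁ = Selected.gs S
        used₁ = Selected.used S
        g : Gadget
        g = gadget k o T.x T.r T.z
        r∉x : T.r ∈ᵇ (T.x ∷ []) ≡ false
        r∉x with T.x == T.r in eq
        ... | false = refl
        ... | true = case trans (sym T.x∉) (cong (_∨ (T.x ∈ᵇ used₁)) (trans (==-comm T.r T.x) eq)) of λ ()
        ∨-false : ∀ a {b} → a ∨ b ≡ false → a ≡ false × b ≡ false
        ∨-false false e = refl , e
        z∉rx : T.z ∈ᵇ (T.r ∷ T.x ∷ []) ≡ false
        z∉rx with ∨-false (T.x == T.z) T.z∉
        ... | e₁ , e with ∨-false (T.r == T.z) e
        ...   | e₂ , _ rewrite e₁ | e₂ = refl
        w₀ : Walk (λ i → s (k , o + i)) 2 T.x T.z (T.z ∷ T.r ∷ T.x ∷ [])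
        w₀ = step (step (start T.x) T.r T.xr r∉x) T.z T.rz z∉rx
        free : Free φ₁ k o 3
        free p′ v f i i< with Selected.domain S p′ v f
        ... | p₀ , i₀ , p₀∈ , i₀< , refl = let a , b , c = All.lookup sep₀ p₀∈ i i₀ i< i₀< in
          (λ e → a (sym e)) , (λ e → c (sym e)) , (λ e → b (sym e))
        unused : ∀ u → u ∈ T.z ∷ T.r ∷ T.x ∷ [] → Unused φ₁ u
        unused u (here refl) p′ f = ∉ᵇ⇒∉ {v = T.z} {xs = T.x ∷ T.r ∷ used₁} T.z∉ (there (there (Selected.image S p′ u f)))
        unused u (there (here refl)) p′ f = ∉ᵇ⇒∉ {v = T.r} {xs = used₁} T.r∉ (Selected.image S p′ u f)
        unused u (there (there (here refl))) p′ f = ∉ᵇ⇒∉ {v = T.x} {xs = T.r ∷ used₁} T.x∉ (there (Selected.image S p′ u f))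
        ext : Extension φ₁ k o w₀
        ext = embed-walk (Selected.emb S) (proj₁ site) free w₀ ≤-refl unused
          (λ e₀ e₃ → proj₂ site T.z T.x e₀ e₃ T.zx)
        open Extension ext
        image₂ : ∀ p′ v → map′ p′ ≡ just v → v ∈ T.z ∷ T.r ∷ T.x ∷ used₁
        image₂ p′ v f with new p′ v f
        ... | inj₁ f′ = there (there (there (Selected.image S p′ v f′)))
        ... | inj₂ (_ , _ , _ , v∈) = ∈-++⁺ˡ v∈
        domain₂ : ∀ p′ v → map′ p′ ≡ just v → ∃₂ λ p₀ i → p₀ ∈ p ∷ sites × i < 3 × p′ ≡ spotᵇ p₀ i
        domain₂ p′ v f with new p′ v f
        ... | inj₁ f′ = let p₀ , i , p₀∈ , i< , e = Selected.domain S p′ v f′ in p₀ , i , there p₀∈ , i< , e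
        ... | inj₂ (i , i≤ , e , _) = p , i , here refl , s≤s i≤ , e
        decay₂ : Q * Q ^ length gs₁ * ∑ demands (misses (g ∷ gs₁)) ≤ (2 * Q ∸ 1) * (2 * Q ∸ 1) ^ length gs₁ * length demands
        decay₂ = begin
          Q * Q ^ length gs₁ * ∑ demands (misses (g ∷ gs₁)) ≡⟨ eq Q (Q ^ length gs₁) _ ⟩
          Q ^ length gs₁ * (Q * ∑ demands (misses (g ∷ gs₁))) ≤⟨ *-monoʳ-≤ (Q ^ length gs₁) shrink ⟩
          Q ^ length gs₁ * ((2 * Q ∸ 1) * ∑ demands (misses (Selected.gs S))) ≡⟨ eq₂ (Q ^ length gs₁) (2 * Q ∸ 1) _ ⟩
          (2 * Q ∸ 1) * (Q ^ length gs₁ * ∑ demands (misses (Selected.gs S))) ≤⟨ *-monoʳ-≤ (2 * Q ∸ 1) (Selected.decay S) ⟩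
          (2 * Q ∸ 1) * ((2 * Q ∸ 1) ^ length gs₁ * length demands) ≡⟨ *-assoc (2 * Q ∸ 1) _ _ ⟨
          (2 * Q ∸ 1) * (2 * Q ∸ 1) ^ length gs₁ * length demands ∎
          where
          open ≤-Reasoning
          eq : ∀ a b c → a * b * c ≡ b * (a * c)
          eq = solve-∀
          eq₂ : ∀ a b c → a * (b * c) ≡ b * (a * c)
          eq₂ = solve-∀
          H : ℕ
          H = ∑ demands (λ d → misses (Selected.gs S) d * ⟦ good d g ⟧)
          -- Adding a gadget doubles every weight and takes back the weight of the demands it
          -- serves, at least `1 / Q` of the former total.
          shrink : Q * ∑ demands (misses (g ∷ gs₁)) ≤ (2 * Q ∸ 1) * ∑ demands (misses (Selected.gs S))
          shrink = begin
            Q * ∑ demands (misses (g ∷ gs₁)) ≡⟨ m+n∸n≡m _ (Q * H) ⟨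
            Q * ∑ demands (misses (g ∷ gs₁)) + Q * H ∸ Q * H ≡⟨ cong (_∸ Q * H) (trans (sym (*-distribˡ-+ Q _ H)) (trans (cong (Q *_) (misses-step gs₁ g)) (eq₃ Q (∑ demands (misses (Selected.gs S)))))) ⟩
            2 * Q * ∑ demands (misses (Selected.gs S)) ∸ Q * H ≤⟨ ∸-monoʳ-≤ (2 * Q * ∑ demands (misses (Selected.gs S))) T.hits ⟩
            2 * Q * ∑ demands (misses (Selected.gs S)) ∸ ∑ demands (misses (Selected.gs S)) ≡⟨ trans (cong (2 * Q * ∑ demands (misses (Selected.gs S)) ∸_) (sym (*-identityˡ (∑ demands (misses (Selected.gs S)))))) (sym (*-distribʳ-∸ (∑ demands (misses (Selected.gs S))) (2 * Q) 1)) ⟩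
            (2 * Q ∸ 1) * ∑ demands (misses (Selected.gs S)) ∎
            where
            eq₃ : ∀ a b → a * (2 * b) ≡ 2 * a * b
            eq₃ = solve-∀

        grown : Selected (p ∷ sites)
        grown = record
          { φ = map′ ; emb = embedding
          ; gs = g ∷ gs₁ ; used = T.z ∷ T.r ∷ T.x ∷ used₁
          ; image = image₂
          ; domain = domain₂
          ; used-size = trans (cong (3 +_) (Selected.used-size S)) (sym (*-suc 3 (length sites)))
          ; placed = λ { g (here refl) → record
                { inside = ≤-trans (≤-reflexive (sym (+-suc o 2))) (proj₁ site)
                ; at-x = placed 0 z≤n ; at-r = placed 1 (s≤s z≤n) ; at-z = placed 2 ≤-refl }
              ; g (there g∈) → let pl = Selected.placed S g g∈ in record
                { inside = inside pl ; at-x = old _ _ (at-x pl) ; at-r = old _ _ (at-r pl) ; at-z = old _ _ (at-z pl) } }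
          ; origin = λ { g (here refl) → here refl ; g (there g∈) → there (Selected.origin S g g∈) }
          ; apart = All.tabulate (λ {g} g∈ i i′ i< i′< → proj₁ (All.lookup sep₀ (Selected.origin S g g∈) i i′ i< i′<)) ∷ Selected.apart S
          ; gs-size = cong suc (Selected.gs-size S)
          ; decay = decay₂
          }

      -- The last gadget to be chosen avoids the vertices of all others and its own first two,
      -- `3 * length sites ∸ 1` in total; hence `suc B`.
      select : ∀ sites → (∀ p → p ∈ sites → Site p) → AllPairs (λ p p′ → Separated (p , 3) (p′ , 3)) sites →
        3 * length sites ≤ suc B → Selected sites
      select [] ok sep room = record
        { φ = const nothing ; emb = record { dom = λ _ _ () ; inj = λ _ _ _ () ; edge = λ _ _ _ () }
        ; gs = [] ; used = [] ; image = λ _ _ () ; domain = λ _ _ () ; used-size = refl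
        ; placed = λ _ () ; origin = λ _ () ; apart = [] ; gs-size = refl
        ; decay = ≤-reflexive (trans (+-identityʳ _) (trans (∑-length demands) (sym (+-identityʳ _)))) }
      select (p ∷ sites) ok (sep₀ ∷ sep) room = extend (select sites (λ p p∈ → ok p (there p∈)) sep (≤-trans (*-monoʳ-≤ 3 (n≤1+n _)) room))
        where
        extend : Selected sites → Selected (p ∷ sites)
        extend S = Grow.grown p sites (ok p (here refl)) sep₀ S room′ (Triple.found p (Selected.used S) room′ (misses (Selected.gs S)) (weights-pos (Selected.gs S)))
          where
          room′ : suc (suc (length (Selected.used S))) ≤ B
          room′ = ≤-pred (≤-trans (≤-reflexive (trans (cong (3 +_) (Selected.used-size S)) (sym (*-suc 3 (length sites))))) room)

      -- With `h` hits among `f` gadgets, the weight of `d` is `2 ^ (f ∸ h)`, and it is at most the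
      -- total weight. So `2 ^ (e + h)` is at least `(2 * Q / c) ^ f` for `c = 2 * Q ∸ 1`, which
      -- `doubling-pow` bounds below by `2 ^ F`.
      many-hits : ∀ {sites} (S : Selected sites) F e → 1 ≤ Q → (2 * Q ∸ 1) * F ≤ length sites → length demands ≤ 2 ^ e →
        ∀ d → F ≤ e + ∑ (Selected.gs S) (λ g → ⟦ good d g ⟧)
      many-hits {sites} S F e Q>0 small de d = ≮⇒≥ (λ lt → <⇒≱ (^-monoʳ-< 2 (s≤s (s≤s z≤n)) lt) bound)
        where
        open Selected S
        open ≤-Reasoning
        f c h : ℕ
        f = length gs
        c = 2 * Q ∸ 1
        h = ∑ gs (λ g → ⟦ good d g ⟧)
        suc-c : suc c ≡ 2 * Q
        suc-c = m+[n∸m]≡n (≤-trans Q>0 (m≤m+n Q _))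
        c>0 : 0 < c
        c>0 = ∸-monoˡ-≤ 1 (*-monoʳ-≤ 2 Q>0)
        2Q : ∀ f → (2 * Q) ^ f ≡ Q ^ f * 2 ^ f
        2Q zero = refl
        2Q (suc f) rewrite 2Q f = eq Q (Q ^ f) (2 ^ f)
          where
          eq : ∀ a b c → 2 * a * (b * c) ≡ a * b * (2 * c)
          eq = solve-∀
        bound : 2 ^ F ≤ 2 ^ (e + h)
        bound = *-cancelʳ-≤ _ _ (c ^ f) {{>-nonZero (^-pos c f c>0)}} (begin
          2 ^ F * c ^ f ≤⟨ doubling-pow c F f c>0 (≤-trans small (≤-reflexive (sym gs-size))) ⟩
          suc c ^ f ≡⟨ trans (cong (_^ f) suc-c) (2Q f) ⟩
          Q ^ f * 2 ^ f ≡⟨ cong (Q ^ f *_) (misses-hits gs d) ⟨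
          Q ^ f * (misses gs d * 2 ^ h) ≤⟨ *-monoʳ-≤ (Q ^ f) (*-monoˡ-≤ (2 ^ h) (∑-∈ (misses gs) (∈-demands d))) ⟩
          Q ^ f * (∑ demands (misses gs) * 2 ^ h) ≡⟨ *-assoc (Q ^ f) _ _ ⟨
          Q ^ f * ∑ demands (misses gs) * 2 ^ h ≤⟨ *-monoˡ-≤ (2 ^ h) decay ⟩
          c ^ f * length demands * 2 ^ h ≤⟨ *-monoˡ-≤ (2 ^ h) (*-monoʳ-≤ (c ^ f) de) ⟩
          c ^ f * 2 ^ e * 2 ^ h ≡⟨ trans (eq (c ^ f) (2 ^ e) (2 ^ h)) (cong (_* c ^ f) (sym (^-distribˡ-+-* 2 e h))) ⟩
          2 ^ (e + h) * c ^ f ∎)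
          where
          eq : ∀ a b c → a * b * c ≡ b * c * a
          eq = solve-∀

      record Filled (φ : Pos → Maybe V) (us : List Pos) (N : ℕ) : Set where
        field
          map′      : Pos → Maybe V
          emb′      : Embedding map′
          used′     : List V
          image′    : ∀ p v → map′ p ≡ just v → v ∈ used′
          size′     : length used′ ≤ N
          old′      : ∀ p v → φ p ≡ just v → map′ p ≡ just v
          domain′   : ∀ p v → map′ p ≡ just v → φ p ≡ just v ⊎ p ∈ us
          filled′   : ∀ u → u ∈ us → ∃ λ v → map′ u ≡ just v

      -- Host tiles also have positions outside the gadgets. Each gets a common neighbour of the two
      -- signed vertices around it; `dense₂` guarantees one since `n` is positive.
      fill : ∀ us φ used → Embedding φ → (∀ p v → φ p ≡ just v → v ∈ used) → (∀ u → u ∈ us → Valid u) →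
        length used + length us ≤ B → Filled φ us (length used + length us)
      fill [] φ used emb im val room = record
        { map′ = φ ; emb′ = emb ; used′ = used ; image′ = im ; size′ = m≤m+n _ 0 ; old′ = λ _ _ f → f ; domain′ = λ _ _ → inj₁ ; filled′ = λ u () }
      fill (u ∷ us) φ used emb im val room with φ u in eq
      ... | just v = record
        { map′ = map′ ; emb′ = emb′ ; used′ = used′ ; image′ = image′ ; size′ = ≤-trans size′ (+-monoʳ-≤ (length used) (n≤1+n _))
        ; old′ = old′ ; domain′ = λ p v f → [ inj₁ , (λ p∈ → inj₂ (there p∈)) ]′ (domain′ p v f)
        ; filled′ = λ { u (here refl) → v , old′ u v eq ; u (there u∈) → filled′ u u∈ } }
        where
        open Filled (fill us φ used emb im (λ u u∈ → val u (there u∈)) (≤-trans (+-monoʳ-≤ (length used) (n≤1+n _)) room))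
      ... | nothing with compatible-pair {φ} v₀ (val u (here refl))
        where
        v₀ : V
        v₀ = subst Fin (suc-pred n {{>-nonZero n>0}}) Fin.zero
      ...   | a , σ , b , τ , comp with search (λ r → (E σ a r ∧ E τ b r) ∧ not (r ∈ᵇ used)) all
      ...     | inj₂ none = ⊥-elim (<⇒≱ n>0 (≤-trans (dense₂ a b σ τ used (≤-trans (m≤m+n _ _) room) u) (≤-reflexive (trans (cong (q *_) none) (*-zeroʳ q)))))
      ...     | inj₁ (r , _ , ok) with ∧-true (E σ a r ∧ E τ b r) ok
      ...       | ok₁ , r∉ with ∧-true (E σ a r) ok₁
      ...         | e₁ , e₂ = record
        { map′ = map′ ; emb′ = emb′ ; used′ = used′ ; image′ = image′ ; size′ = ≤-trans size′ (≤-reflexive (sym (+-suc (length used) _)))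
        ; old′ = λ p v f → old′ p v (trans (update-there φ u r p (λ { refl → case trans (sym eq) f of λ () })) f)
        ; domain′ = domain₂
        ; filled′ = λ { u (here refl) → r , old′ u r (update-here φ u r) ; u (there u∈) → filled′ u u∈ } }
        where
        im₁ : ∀ p v → (φ [ u ↦ r ]) p ≡ just v → v ∈ r ∷ used
        im₁ p v f with update-inv φ u r p v f
        ... | inj₁ (_ , refl) = here refl
        ... | inj₂ (_ , f′) = there (im p v f′)
        open Filled (fill us (φ [ u ↦ r ]) (r ∷ used)
          (update-embedding emb (val u (here refl)) (λ p f → ∉ᵇ⇒∉ (not-true r∉) (im p r f)) (comp r e₁ e₂))
          im₁ (λ u u∈ → val u (there u∈)) (≤-trans (≤-reflexive (sym (+-suc (length used) _))) room))
        domain₂ : ∀ p v → map′ p ≡ just v → φ p ≡ just v ⊎ p ∈ u ∷ us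
        domain₂ p v f with domain′ p v f
        ... | inj₂ p∈ = inj₂ (there p∈)
        ... | inj₁ f′ with update-inv φ u r p v f′
        ...   | inj₁ (refl , _) = inj₂ (here refl)
        ...   | inj₂ (_ , f″) = inj₁ f″

  -- Cutting cycles, and the vertices that remain available.

  concatMap-∈ : ∀ {A B : Set} (f : A → List B) xs {y} → y ∈ concatMap f xs → ∃ λ x → x ∈ xs × y ∈ f x
  concatMap-∈ f xs y∈ = let x , x∈ , h = find (concatMap⁻ f y∈) in x , x∈ , h

  AllPairs-concatMap : ∀ {A B : Set} {R : B → B → Set} {S : A → A → Set} (f : A → List B) xs →
    (∀ x → x ∈ xs → AllPairs R (f x)) → AllPairs S xs →
    (∀ x y → x ∈ xs → y ∈ xs → S x y → ∀ a b → a ∈ f x → b ∈ f y → R a b) → AllPairs R (concatMap f xs)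
  AllPairs-concatMap f [] inner [] cross = []
  AllPairs-concatMap f (x ∷ xs) inner (sx ∷ sxs) cross = AllPairsₚ.++⁺ (inner x (here refl))
    (AllPairs-concatMap f xs (λ y y∈ → inner y (there y∈)) sxs (λ y z y∈ z∈ → cross y z (there y∈) (there z∈)))
    (All.tabulate (λ {a} a∈ → All.tabulate (λ {b} b∈ → let y , y∈ , b∈y = concatMap-∈ f xs b∈ in
      cross x y (here refl) (there y∈) (All.lookup sx y∈) a b a∈ b∈y)))

  -- The segment of length c (L + 1) + m starting at o is cut into c blocks of length L, each followed by a single slot, and m further slots.
  module Cut (L : ℕ) where
    blocks : ℕ → ℕ → List ℕ
    blocks zero o = []
    blocks (suc c) o = o ∷ blocks c (o + suc L)

    slots : ℕ → ℕ → ℕ → List ℕ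
    slots zero m o = map (o +_) (upTo m)
    slots (suc c) m o = o + L ∷ slots c m (o + suc L)

    length-blocks : ∀ c o → length (blocks c o) ≡ c
    length-blocks zero o = refl
    length-blocks (suc c) o = cong suc (length-blocks c (o + suc L))

    length-slots : ∀ c m o → length (slots c m o) ≡ c + m
    length-slots zero m o = trans (length-map (o +_) (upTo m)) (length-upTo m)
    length-slots (suc c) m o = cong suc (length-slots c m (o + suc L))

    blocks-bounds : ∀ c m o b → b ∈ blocks c o → o ≤ b × b + L < o + (c * suc L + m)
    blocks-bounds (suc c) m o b (here refl) = ≤-refl , ≤-trans (≤-reflexive (sym (+-suc o L))) (+-monoʳ-≤ o (≤-trans (m≤m+n (suc L) (c * suc L)) (m≤m+n _ m)))
    blocks-bounds (suc c) m o b (there b∈) = let lo , hi = blocks-bounds c m (o + suc L) b b∈ in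
      ≤-trans (m≤m+n o _) lo , ≤-trans hi (≤-reflexive (eq o L (c * suc L) m))
      where
      eq : ∀ o L x m → o + suc L + (x + m) ≡ o + (suc L + x + m)
      eq = solve-∀

    blocks-apart : ∀ c o → AllPairs (λ b b′ → b + L < b′) (blocks c o)
    blocks-apart zero o = []
    blocks-apart (suc c) o = All.tabulate (λ b∈ → ≤-trans (≤-reflexive (sym (+-suc o L))) (proj₁ (blocks-bounds c 0 (o + suc L) _ b∈))) ∷ blocks-apart c (o + suc L)

    slots-bounds : ∀ c m o a → a ∈ slots c m o → a < o + (c * suc L + m)
    slots-bounds zero m o a a∈ = let i , i∈ , e = ∈-map⁻ (o +_) a∈ in ≤-trans (s≤s (≤-reflexive e)) (+-monoʳ-< o (∈-upTo⁻ i∈))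
    slots-bounds (suc c) m o a (here refl) = ≤-trans (≤-reflexive (sym (+-suc o L))) (+-monoʳ-≤ o (≤-trans (m≤m+n (suc L) (c * suc L)) (m≤m+n _ m)))
    slots-bounds (suc c) m o a (there a∈) = ≤-trans (slots-bounds c m (o + suc L) a a∈) (≤-reflexive (eq o L (c * suc L) m))
      where
      eq : ∀ o L x m → o + suc L + (x + m) ≡ o + (suc L + x + m)
      eq = solve-∀

    cover : ∀ c m o a → o ≤ a → a < o + (c * suc L + m) → (∃₂ λ b i → b ∈ blocks c o × i < L × a ≡ b + i) ⊎ a ∈ slots c m o
    cover zero m o a lo hi with m≤n⇒∃[o]m+o≡n lo
    ... | i , refl = inj₂ (∈-map⁺ (o +_) (∈-upTo⁺ (+-cancelˡ-< o i m hi)))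
    cover (suc c) m o a lo hi with m≤n⇒∃[o]m+o≡n lo
    ... | i , refl with <-cmp i L
    ...   | tri< i<L _ _ = inj₁ (o , i , here refl , i<L , refl)
    ...   | tri≈ _ refl _ = inj₂ (here refl)
    ...   | tri> _ _ L<i with cover c m (o + suc L) (o + i) (+-monoʳ-≤ o L<i) (≤-trans hi (≤-reflexive (eq o L (c * suc L) m)))
      where
      eq : ∀ o L x m → o + (suc L + x + m) ≡ o + suc L + (x + m)
      eq = solve-∀
    ...     | inj₁ (b , j , b∈ , j< , e) = inj₁ (b , j , there b∈ , j< , e)
    ...     | inj₂ a∈ = inj₂ (there a∈)

  ∑-cong-∈ : ∀ {A : Set} (xs : List A) {f g : A → ℕ} → (∀ x → x ∈ xs → f x ≡ g x) → ∑ xs f ≡ ∑ xs g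
  ∑-cong-∈ xs h = ≤-antisym (∑-mono xs (λ x x∈ → ≤-reflexive (h x x∈))) (∑-mono xs (λ x x∈ → ≤-reflexive (sym (h x x∈))))

  AllPairs-++⁻ : ∀ {A : Set} {R : A → A → Set} xs {ys} → AllPairs R (xs ++ ys) → AllPairs R xs × AllPairs R ys × (∀ x y → x ∈ xs → y ∈ ys → R x y)
  AllPairs-++⁻ [] ps = [] , ps , λ x y ()
  AllPairs-++⁻ (x ∷ xs) (p ∷ ps) with AllPairs-++⁻ xs ps
  ... | a , b , c = All.tabulate (λ y∈ → All.lookup p (∈-++⁺ˡ y∈)) ∷ a , b ,
    λ { x y (here refl) y∈ → All.lookup p (∈-++⁺ʳ xs y∈) ; x y (there x∈) y∈ → c x y x∈ y∈ }

  values : ∀ {A B : Set} → (A → Maybe B) → List A → List B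
  values f [] = []
  values f (x ∷ xs) with f x
  ... | just y = y ∷ values f xs
  ... | nothing = values f xs

  length-values : ∀ {A B : Set} (f : A → Maybe B) xs → length (values f xs) ≤ length xs
  length-values f [] = z≤n
  length-values f (x ∷ xs) with f x
  ... | just y = s≤s (length-values f xs)
  ... | nothing = m≤n⇒m≤1+n (length-values f xs)

  ∈-values : ∀ {A B : Set} (f : A → Maybe B) {xs x y} → x ∈ xs → f x ≡ just y → y ∈ values f xs
  ∈-values f {x ∷ xs} (here refl) e with f x
  ∈-values f {x ∷ xs} (here refl) refl | just y = here refl
  ∈-values f {x ∷ xs} (there x∈) e with f x
  ... | just _ = there (∈-values f x∈ e)
  ... | nothing = ∈-values f x∈ e

  length-filterᵇ : ∀ {A : Set} (p : A → Bool) xs → length (filterᵇ p xs) ≡ ∑ xs (λ x → ⟦ p x ⟧)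
  length-filterᵇ p [] = refl
  length-filterᵇ p (x ∷ xs) with p x
  ... | true = cong suc (length-filterᵇ p xs)
  ... | false = length-filterᵇ p xs

  ∈-take : ∀ {A : Set} m {xs : List A} {x} → x ∈ take m xs → x ∈ xs
  ∈-take (suc m) {_ ∷ xs} (here refl) = here refl
  ∈-take (suc m) {_ ∷ xs} (there x∈) = there (∈-take m x∈)

  -- Subtraction-free, loss says that at most n − m of the vertices with p are missing from vs.
  record Remaining {n : ℕ} (used : List (Fin n)) (m : ℕ) : Set where
    field
      vs      : List (Fin n)
      size    : length vs ≡ m
      fresh   : ∀ v → v ∈ vs → v ∉ used
      nodup   : Nodup vs
      loss    : ∀ (p : Fin n → Bool) → m + ∑ (allFin n) (λ v → ⟦ p v ⟧) ≤ n + ∑ vs (λ v → ⟦ p v ⟧)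

  remaining : ∀ {n} (used : List (Fin n)) m → m + length used ≤ n → Remaining used m
  remaining {n} used m h = record { vs = take m un ; size = size ; fresh = fresh ; nodup = nodup ; loss = loss }
    where
    open ≤-Reasoning
    free : Fin n → Bool
    free v = not (v ∈ᵇ used)
    un un′ : List (Fin n)
    un = filterᵇ free (allFin n)
    un′ = filterᵇ (not ∘ free) (allFin n)
    split : ∀ f → ∑ (allFin n) f ≡ ∑ (take m un) f + ∑ (drop m un) f + ∑ un′ f
    split f = trans (∑-filter free (allFin n) f) (cong (_+ ∑ un′ f) (trans (cong (λ l → ∑ l f) (sym (take++drop≡id m un))) (∑-++ (take m un) (drop m un) f)))
    n-count : n ≡ ∑ (allFin n) (const 1)
    n-count = sym (trans (∑-length (allFin n)) (length-tabulate id))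
    m≤un : m ≤ length un
    m≤un = +-cancelʳ-≤ (length used) _ _ (begin
      m + length used ≤⟨ h ⟩
      n ≡⟨ n-count ⟩
      ∑ (allFin n) (const 1) ≤⟨ ∑-mono′ (allFin n) (λ v → ⟦∧not⟧ true (v ∈ᵇ used)) ⟩
      ∑ (allFin n) (λ v → ⟦ free v ⟧ + ⟦ v ∈ᵇ used ⟧) ≡⟨ ∑-+ (allFin n) _ _ ⟩
      ∑ (allFin n) (λ v → ⟦ free v ⟧) + ∑ (allFin n) (λ v → ⟦ v ∈ᵇ used ⟧) ≤⟨ +-mono-≤ (≤-reflexive (sym (length-filterᵇ free (allFin n)))) (∑-∈ᵇ (allFin n) occ-allFin used) ⟩
      length un + length used ∎)
    size : length (take m un) ≡ m
    size = trans (length-take m un) (m≤n⇒m⊓n≡m m≤un)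
    fresh : ∀ v → v ∈ take m un → v ∉ used
    fresh v v∈ = ∉ᵇ⇒∉ (not-true (proj₂ (∈-filterᵇ free (allFin n) (∈-take m v∈))))
    nodup : Nodup (take m un)
    nodup v = ≤-trans (≤-trans (≤-trans (m≤m+n _ _) (m≤m+n _ _)) (≤-reflexive (sym (split (λ x → ⟦ x == v ⟧))))) (occ-allFin v)
    loss : ∀ (p : Fin n → Bool) → m + ∑ (allFin n) (λ v → ⟦ p v ⟧) ≤ n + ∑ (take m un) (λ v → ⟦ p v ⟧)
    loss p = begin
      m + ∑ (allFin n) f ≡⟨ cong (m +_) (split f) ⟩
      m + (∑ (take m un) f + ∑ (drop m un) f + ∑ un′ f) ≤⟨ +-monoʳ-≤ m (+-mono-≤ (+-monoʳ-≤ (∑ (take m un) f) (∑-mono′ (drop m un) (λ v → ⟦⟧≤1 (p v)))) (∑-mono′ un′ (λ v → ⟦⟧≤1 (p v)))) ⟩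
      m + (∑ (take m un) f + ∑ (drop m un) (const 1) + ∑ un′ (const 1))
        ≡⟨ cong (_+ (∑ (take m un) f + ∑ (drop m un) (const 1) + ∑ un′ (const 1))) (sym (trans (∑-length (take m un)) size)) ⟩
      ∑ (take m un) (const 1) + (∑ (take m un) f + ∑ (drop m un) (const 1) + ∑ un′ (const 1)) ≡⟨ eq (∑ (take m un) (const 1)) _ _ _ ⟩
      ∑ (take m un) (const 1) + ∑ (drop m un) (const 1) + ∑ un′ (const 1) + ∑ (take m un) f ≡⟨ cong (_+ ∑ (take m un) f) (trans (sym (split (const 1))) (sym n-count)) ⟩
      n + ∑ (take m un) f ∎
      where
      f : Fin n → ℕ
      f v = ⟦ p v ⟧
      eq : ∀ a b c d → a + (b + c + d) ≡ a + c + d + b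
      eq = solve-∀

  filter-↭ : ∀ {A : Set} (p : A → Bool) xs → xs ↭ filterᵇ p xs ++ filterᵇ (not ∘ p) xs
  filter-↭ p [] = ↭-refl
  filter-↭ p (x ∷ xs) with p x
  ... | true = prep x (filter-↭ p xs)
  ... | false = ↭-trans (prep x (filter-↭ p xs)) (↭-sym (shift x (filterᵇ p xs) _))

  -- Elements are taken until the sum reaches `m`; the last of them overshoots by at most `b`.
  prefix : ∀ {A : Set} (xs : List A) (f : A → ℕ) m b → (∀ x → x ∈ xs → f x ≤ b) → m ≤ ∑ xs f →
    ∃₂ λ hs rs → xs ≡ hs ++ rs × m ≤ ∑ hs f × ∑ hs f ≤ m + b
  prefix [] f m b bd h = [] , [] , refl , h , z≤n
  prefix (x ∷ xs) f m b bd h with m ≤? f x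
  ... | yes p = x ∷ [] , xs , refl , ≤-trans p (≤-reflexive (sym (+-identityʳ (f x)))) ,
    ≤-trans (≤-reflexive (+-identityʳ (f x))) (≤-trans (bd x (here refl)) (m≤n+m b m))
  ... | no ¬p with m≤n⇒∃[o]m+o≡n (<⇒≤ (≰⇒> ¬p))
  ...   | o , refl with prefix xs f o b (λ y y∈ → bd y (there y∈)) (+-cancelˡ-≤ (f x) _ _ h)
  ...     | hs , rs , refl , lo , hi = x ∷ hs , rs , refl , +-monoʳ-≤ (f x) lo , ≤-trans (+-monoʳ-≤ (f x) hi) (≤-reflexive (sym (+-assoc (f x) o b)))

  triple-overlap : ∀ a b c d → ⟦ a ⟧ + ⟦ b ⟧ + ⟦ c ⟧ ≤ ⟦ ((a ∧ b) ∧ c) ∧ not d ⟧ + ⟦ d ⟧ + 2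
  triple-overlap true true true true = ≤-refl
  triple-overlap true true true false = ≤-refl
  triple-overlap true true false d = ≤-trans (≤-reflexive (+-comm 0 2)) (m≤n+m 2 ⟦ d ⟧)
  triple-overlap true false c d = ≤-trans (s≤s (⟦⟧≤1 c)) (m≤n+m 2 ⟦ d ⟧)
  triple-overlap false b c d = ≤-trans (+-mono-≤ (⟦⟧≤1 b) (⟦⟧≤1 c)) (m≤n+m 2 ⟦ d ⟧)

  -- Tiles, slots, and windows for gadgets.

  module Packing {n t : ℕ} (G : Digraph n) (ℓ : Fin t → ℕ) (3≤ℓ : ∀ k → 3 ≤ ℓ k) (s : Fin t × ℕ → Bool) (n≡ : n ≡ ∑ (allFin t) ℓ)
    (n>0 : 0 < n) (q L Λ : ℕ) (4≤L : 4 ≤ L) (L*L≤Λ : L * L ≤ Λ) where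
    open Walks G
    open Positions G ℓ 3≤ℓ s
    open Selection G ℓ 3≤ℓ s n≡ n>0 q

    cycle : Block → Fin t
    cycle b = proj₁ (proj₁ b)

    offset size : Block → ℕ
    offset b = proj₂ (proj₁ b)
    size b = proj₂ b

    L≤Λ : L ≤ Λ
    L≤Λ = ≤-trans (≤-trans (≤-reflexive (sym (*-identityʳ L))) (*-monoʳ-≤ L (≤-trans (s≤s z≤n) 4≤L))) L*L≤Λ

    other-cycle : ∀ b b′ → cycle b ≢ cycle b′ → Separated b b′
    other-cycle ((k , o) , m) ((k′ , o′) , m′) ne i i′ _ _ = (λ e → ne (,-injectiveˡ e)) ,
      (λ e → ne (proj₁ (next-inv k _ k′ _ e))) , (λ e → ne (sym (proj₁ (next-inv k′ _ k _ (sym e)))))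

    -- The first strict inequality leaves a position between the blocks, the second one before the
    -- cycle wraps around.
    same-cycle : ∀ k o m o′ m′ → o + m < o′ → o′ + m′ < ℓ k → Separated ((k , o) , m) ((k , o′) , m′)
    same-cycle k o m o′ m′ lt lt′ i i′ i< i′< = (λ e → <⇒≢ a<a′ (,-injectiveʳ e)) , ahead , behind
      where
      step₁ : suc (o + i) ≤ o + m
      step₁ = +-monoʳ-< o i<
      a<a′ : o + i < o′ + i′
      a<a′ = ≤-trans step₁ (≤-trans (<⇒≤ lt) (m≤m+n o′ i′))
      ahead : next (k , o + i) ≢ (k , o′ + i′)
      ahead e with next-inv k (o + i) k (o′ + i′) e
      ... | _ , inj₁ (wrap , _) = <⇒≢ (≤-<-trans step₁ (<-trans lt (≤-<-trans (m≤m+n o′ m′) lt′))) wrap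
      ... | _ , inj₂ e′ = <⇒≢ (≤-<-trans step₁ (<-≤-trans lt (m≤m+n o′ i′))) (sym e′)
      behind : (k , o + i) ≢ next (k , o′ + i′)
      behind e with next-inv k (o′ + i′) k (o + i) (sym e)
      ... | _ , inj₁ (wrap , _) = <⇒≢ (≤-<-trans (+-monoʳ-< o′ i′<) lt′) wrap
      ... | _ , inj₂ e′ = <⇒≢ (<-trans a<a′ ≤-refl) e′

    sub-blocks : ∀ b b′ o m o′ m′ → offset b ≤ o → o + m ≤ offset b + size b → offset b′ ≤ o′ → o′ + m′ ≤ offset b′ + size b′ →
      Separated b b′ → Separated ((cycle b , o) , m) ((cycle b′ , o′) , m′)
    sub-blocks ((k , p) , l) ((k′ , p′) , l′) o m o′ m′ lo hi lo′ hi′ sep i i′ i< i′<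
      with m≤n⇒∃[o]m+o≡n lo | m≤n⇒∃[o]m+o≡n lo′
    ... | d , refl | d′ , refl = subst₂ (λ a a′ → (k , a) ≢ (k′ , a′) × next (k , a) ≢ (k′ , a′) × (k , a) ≢ next (k′ , a′))
      (sym (+-assoc p d i)) (sym (+-assoc p′ d′ i′)) (sep (d + i) (d′ + i′) (inside p d i m l hi i<) (inside p′ d′ i′ m′ l′ hi′ i′<))
      where
      open import Relation.Binary.PropositionalEquality using (subst₂)
      inside : ∀ p d i m l → p + d + m ≤ p + l → i < m → d + i < l
      inside p d i m l h i< = <-≤-trans (+-monoʳ-< d i<) (+-cancelˡ-≤ p _ _ (≤-trans (≤-reflexive (sym (+-assoc p d m))) h))

    pieces : Fin t → ℕ
    pieces k = ℓ k / suc L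

    remainder : Fin t → ℕ
    remainder k = ℓ k % suc L

    ℓ-split : ∀ k → ℓ k ≡ pieces k * suc L + remainder k
    ℓ-split k = trans (m≡m%n+[m/n]*n (ℓ k) (suc L)) (+-comm (remainder k) _)

    module C = Cut L

    tilesOf : Fin t → List Block
    tilesOf k with ℓ k ≤? Λ
    ... | yes _ = ((k , 0) , ℓ k) ∷ []
    ... | no _ = map (λ o → (k , o) , L) (C.blocks (pieces k) 0)

    slotsOf : Fin t → List Pos
    slotsOf k with ℓ k ≤? Λ
    ... | yes _ = []
    ... | no _ = map (k ,_) (C.slots (pieces k) (remainder k) 0)

    tiles : List Block
    tiles = concatMap tilesOf (allFin t)

    slots : List Pos
    slots = concatMap slotsOf (allFin t)

    record Tile (b : Block) : Set where
      field
        3≤size  : 3 ≤ size b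
        size≤Λ  : size b ≤ Λ
        shape   : (offset b ≡ 0 × size b ≡ ℓ (cycle b)) ⊎ (4 ≤ size b × offset b + size b < ℓ (cycle b))

      inside : offset b + size b ≤ ℓ (cycle b)
      inside with shape
      ... | inj₁ (e , e′) = ≤-reflexive (cong₂ _+_ e e′)
      ... | inj₂ (_ , lt) = <⇒≤ lt

    tilesOf-tile : ∀ k b → b ∈ tilesOf k → cycle b ≡ k × Tile b
    tilesOf-tile k b b∈ with ℓ k ≤? Λ
    tilesOf-tile k b (here refl) | yes p = refl , record { 3≤size = 3≤ℓ k ; size≤Λ = p ; shape = inj₁ (refl , refl) }
    tilesOf-tile k b b∈ | no ¬p with ∈-map⁻ _ b∈
    ... | o , o∈ , refl = refl , record
      { 3≤size = ≤-trans (n≤1+n 3) 4≤L ; size≤Λ = L≤Λ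
      ; shape = inj₂ (4≤L , <-≤-trans (proj₂ (C.blocks-bounds (pieces k) (remainder k) 0 o o∈)) (≤-reflexive (sym (ℓ-split k)))) }

    tile : ∀ b → b ∈ tiles → Tile b
    tile b b∈ = let k , _ , b∈k = concatMap-∈ tilesOf (allFin t) b∈ in proj₂ (tilesOf-tile k b b∈k)

    tiles-separated : AllPairs Separated tiles
    tiles-separated = AllPairs-concatMap tilesOf (allFin t) (λ k _ → within k) (allFin⁺ t)
      (λ k k′ _ _ ne b b′ b∈ b′∈ → other-cycle b b′ (λ e → ne (trans (sym (proj₁ (tilesOf-tile k b b∈))) (trans e (proj₁ (tilesOf-tile k′ b′ b′∈))))))
      where
      ordered : ∀ k os → AllPairs (λ o o′ → o + L < o′) os → (∀ o → o ∈ os → o + L < ℓ k) → AllPairs Separated (map (λ o → (k , o) , L) os)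
      ordered k [] [] bd = []
      ordered k (o ∷ os) (h ∷ hs) bd = All.tabulate (λ {b} b∈ → one b b∈) ∷ ordered k os hs (λ o o∈ → bd o (there o∈))
        where
        one : ∀ b → b ∈ map (λ o → (k , o) , L) os → Separated ((k , o) , L) b
        one b b∈ with ∈-map⁻ _ b∈
        ... | o′ , o′∈ , refl = same-cycle k o L o′ L (All.lookup h o′∈) (bd o′ (there o′∈))
      within : ∀ k → AllPairs Separated (tilesOf k)
      within k with ℓ k ≤? Λ
      ... | yes _ = [] ∷ []
      ... | no _ = ordered k _ (C.blocks-apart (pieces k) 0)
        (λ o o∈ → <-≤-trans (proj₂ (C.blocks-bounds (pieces k) (remainder k) 0 o o∈)) (≤-reflexive (sym (ℓ-split k))))

    coverOf : ∀ k a → a < ℓ k → (∃₂ λ b i → b ∈ tilesOf k × i < size b × (k , a) ≡ spotᵇ (proj₁ b) i) ⊎ (k , a) ∈ slotsOf k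
    coverOf k a a< with ℓ k ≤? Λ
    ... | yes _ = inj₁ (_ , a , here refl , a< , refl)
    ... | no _ with C.cover (pieces k) (remainder k) 0 a z≤n (≤-trans a< (≤-reflexive (ℓ-split k)))
    ...   | inj₁ (o , i , o∈ , i< , e) = inj₁ (_ , i , ∈-map⁺ _ o∈ , i< , cong (k ,_) e)
    ...   | inj₂ a∈ = inj₂ (∈-map⁺ (k ,_) a∈)

    tiles-cover : ∀ p → Valid p → (∃₂ λ b i → b ∈ tiles × i < size b × p ≡ spotᵇ (proj₁ b) i) ⊎ p ∈ slots
    tiles-cover (k , a) val with coverOf k a val
    ... | inj₁ (b , i , b∈ , i< , e) = inj₁ (b , i , ∈-concatMap tilesOf (∈-allFin k) b∈ , i< , e)
    ... | inj₂ p∈ = inj₂ (∈-concatMap slotsOf (∈-allFin k) p∈)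

    slots-valid : ∀ p → p ∈ slots → Valid p
    slots-valid p p∈ with concatMap-∈ slotsOf (allFin t) p∈
    ... | k , _ , p∈k with ℓ k ≤? Λ
    slots-valid p p∈ | k , _ , () | yes _
    ... | no _ with ∈-map⁻ (k ,_) p∈k
    ...   | a , a∈ , refl = ≤-trans (C.slots-bounds (pieces k) (remainder k) 0 a a∈) (≤-reflexive (sym (ℓ-split k)))

    countOf : ∀ k → ∑ (tilesOf k) size + length (slotsOf k) ≡ ℓ k
    countOf k with ℓ k ≤? Λ
    ... | yes _ = trans (+-identityʳ _) (+-identityʳ _)
    ... | no _ = trans (cong₂ _+_ (trans (∑-map _ (C.blocks (pieces k) 0) size) (trans (∑-const (C.blocks (pieces k) 0) L) (cong (_* L) (C.length-blocks (pieces k) 0))))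
        (trans (length-map (k ,_) (C.slots (pieces k) (remainder k) 0)) (C.length-slots (pieces k) (remainder k) 0)))
      (trans (eq (pieces k) L (remainder k)) (sym (ℓ-split k)))
      where
      eq : ∀ c L m → c * L + (c + m) ≡ c * suc L + m
      eq = solve-∀

    tiles-count : ∑ tiles size + length slots ≡ n
    tiles-count = trans (cong₂ _+_ (∑-concatMap tilesOf (allFin t) size) (length-concatMap slotsOf (allFin t)))
      (trans (sym (∑-+ (allFin t) _ _)) (trans (∑-cong (allFin t) countOf) (sym n≡)))

    -- A cut cycle has one slot per block and at most `L` in its remainder. As its length exceeds
    -- `Λ ≥ L * L`, both numbers are at most `ℓ k / L`.
    slots-few : L * length slots ≤ 2 * n
    slots-few = begin
      L * length slots ≡⟨ cong (L *_) (length-concatMap slotsOf (allFin t)) ⟩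
      L * ∑ (allFin t) (length ∘ slotsOf) ≡⟨ ∑-* (allFin t) L _ ⟨
      ∑ (allFin t) (λ k → L * length (slotsOf k)) ≤⟨ ∑-mono′ (allFin t) few ⟩
      ∑ (allFin t) (λ k → 2 * ℓ k) ≡⟨ trans (∑-* (allFin t) 2 ℓ) (cong (2 *_) (sym n≡)) ⟩
      2 * n ∎
      where
      open ≤-Reasoning
      few : ∀ k → L * length (slotsOf k) ≤ 2 * ℓ k
      few k with ℓ k ≤? Λ
      ... | yes _ = ≤-trans (≤-reflexive (*-zeroʳ L)) z≤n
      ... | no ¬p = begin
        L * length (map (k ,_) (C.slots c m 0)) ≡⟨ cong (L *_) (trans (length-map (k ,_) (C.slots c m 0)) (C.length-slots c m 0)) ⟩
        L * (c + m) ≡⟨ *-distribˡ-+ L c m ⟩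
        L * c + L * m ≤⟨ +-mono-≤ (≤-trans (≤-reflexive (*-comm L c)) (≤-trans (*-monoʳ-≤ c (n≤1+n L)) (≤-trans (m≤m+n _ m) (≤-reflexive (sym (ℓ-split k))))))
                                                                 (≤-trans (*-monoʳ-≤ L (≤-pred (m%n<n (ℓ k) (suc L)))) (≤-trans L*L≤Λ (<⇒≤ (≰⇒> ¬p)))) ⟩
        ℓ k + ℓ k ≡⟨ cong (ℓ k +_) (+-identityʳ (ℓ k)) ⟨
        2 * ℓ k ∎
        where
        c m : ℕ
        c = pieces k
        m = remainder k

    -- An uncut cycle is one tile and a cut one yields at most `ℓ k / suc L`, so cutting raises the
    -- number of tiles, and thereby the degree requirement, only slightly.
    tiles-few : suc L * length tiles ≤ suc L * t + n
    tiles-few = begin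
      suc L * length tiles ≡⟨ cong (suc L *_) (length-concatMap tilesOf (allFin t)) ⟩
      suc L * ∑ (allFin t) (length ∘ tilesOf) ≡⟨ ∑-* (allFin t) (suc L) _ ⟨
      ∑ (allFin t) (λ k → suc L * length (tilesOf k)) ≤⟨ ∑-mono′ (allFin t) few ⟩
      ∑ (allFin t) (λ k → suc L + ℓ k) ≡⟨ trans (∑-+ (allFin t) (const (suc L)) ℓ) (cong₂ _+_ (trans (∑-const (allFin t) (suc L)) (trans (cong (_* suc L) (length-tabulate {n = t} id)) (*-comm t _))) (sym n≡)) ⟩
      suc L * t + n ∎
      where
      open ≤-Reasoning
      few : ∀ k → suc L * length (tilesOf k) ≤ suc L + ℓ k
      few k with ℓ k ≤? Λ
      ... | yes _ = ≤-trans (≤-reflexive (*-identityʳ (suc L))) (m≤m+n (suc L) (ℓ k))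
      ... | no _ = ≤-trans (≤-reflexive (trans (cong (suc L *_) (trans (length-map _ (C.blocks (pieces k) 0)) (C.length-blocks (pieces k) 0))) (*-comm (suc L) (pieces k))))
        (≤-trans (≤-trans (m≤m+n _ (remainder k)) (≤-reflexive (sym (ℓ-split k)))) (m≤n+m (ℓ k) (suc L)))

    -- true: gadgets span triangles, whose third edge must be present; false: gadgets lie in tiles of size at least 4.
    closing : Bool → Pos → V → V → Bool
    closing true p z x = E (s (spotᵇ p 2)) z x
    closing false p z x = true

    module W = Cut 3

    -- `Cut 3` leaves an idle position after every window, which keeps the windows separated. A
    -- triangle is a single window.
    windowsOf : Block → List Pos
    windowsOf b with 4 ≤? size b
    ... | yes _ = map (cycle b ,_) (W.blocks (size b / 4) (offset b))
    ... | no _ = proj₁ b ∷ []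

    4-split : ∀ m → m ≡ m / 4 * 4 + m % 4
    4-split m = trans (m≡m%n+[m/n]*n m 4) (+-comm (m % 4) _)

    windows-inside : ∀ b → Tile b → ∀ p → p ∈ windowsOf b → proj₁ p ≡ cycle b × offset b ≤ proj₂ p × proj₂ p + 3 ≤ offset b + size b
    windows-inside b tl p p∈ with 4 ≤? size b
    windows-inside b tl p p∈ | yes _ with ∈-map⁻ (cycle b ,_) p∈
    ... | o , o∈ , refl = let lo , hi = W.blocks-bounds (size b / 4) (size b % 4) (offset b) o o∈ in
      refl , lo , ≤-trans (<⇒≤ hi) (≤-reflexive (cong (offset b +_) (sym (4-split (size b)))))
    windows-inside b tl p (here refl) | no _ = refl , ≤-refl , +-monoʳ-≤ (offset b) (Tile.3≤size tl)

    windows-separated : ∀ b → Tile b → AllPairs (λ p p′ → Separated (p , 3) (p′ , 3)) (windowsOf b)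
    windows-separated b tl with 4 ≤? size b
    ... | no _ = [] ∷ []
    ... | yes _ = ordered (W.blocks (size b / 4) (offset b)) (W.blocks-apart (size b / 4) (offset b))
        (λ o o∈ → <-≤-trans (proj₂ (W.blocks-bounds (size b / 4) (size b % 4) (offset b) o o∈))
          (≤-trans (≤-reflexive (cong (offset b +_) (sym (4-split (size b))))) (Tile.inside tl)))
      where
      ordered : ∀ os → AllPairs (λ o o′ → o + 3 < o′) os → (∀ o → o ∈ os → o + 3 < ℓ (cycle b)) →
        AllPairs (λ p p′ → Separated (p , 3) (p′ , 3)) (map (cycle b ,_) os)
      ordered [] [] bd = []
      ordered (o ∷ os) (h ∷ hs) bd = All.tabulate (λ {p} p∈ → one p p∈) ∷ ordered os hs (λ o o∈ → bd o (there o∈))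
        where
        one : ∀ p → p ∈ map (cycle b ,_) os → Separated ((cycle b , o) , 3) (p , 3)
        one p p∈ with ∈-map⁻ (cycle b ,_) p∈
        ... | o′ , o′∈ , refl = same-cycle (cycle b) o 3 o′ 3 (All.lookup h o′∈) (bd o′ (there o′∈))

    -- For `size b = 4 * c + r` with `r ≤ 3` and `c ≥ 1` there are `c` windows, and
    -- `4 * c + 3 ≤ 7 * c`; a tile of size 7 attains the 7, a triangle the 3.
    windows-many : ∀ b → Tile b → size b ≤ 7 * length (windowsOf b) × 3 * length (windowsOf b) ≤ size b
    windows-many b tl with 4 ≤? size b
    ... | no ¬p = ≤-trans (<⇒≤ (≰⇒> ¬p)) (s≤s (s≤s (s≤s (s≤s z≤n)))) , Tile.3≤size tl
    ... | yes p = count (size b / 4) (size b % 4) (≤-pred (m%n<n (size b) 4)) (4-split (size b))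
        (trans (length-map (cycle b ,_) (W.blocks (size b / 4) (offset b))) (W.length-blocks (size b / 4) (offset b)))
      where
      count : ∀ c r {k} → r ≤ 3 → size b ≡ c * 4 + r → k ≡ c → size b ≤ 7 * k × 3 * k ≤ size b
      count zero r r≤ e refl = ⊥-elim (<⇒≱ (s≤s r≤) (≤-trans p (≤-reflexive e)))
      count (suc c) r r≤ e refl =
        ≤-trans (≤-reflexive e) (≤-trans (+-monoʳ-≤ (suc c * 4) r≤) (≤-trans (m≤m+n _ (3 * c)) (≤-reflexive (eq₁ c)))) ,
        ≤-trans (m≤m+n _ (suc c + r)) (≤-reflexive (trans (eq₂ c r) (sym e)))
        where
        eq₁ : ∀ c → suc c * 4 + 3 + 3 * c ≡ 7 * suc c
        eq₁ = solve-∀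
        eq₂ : ∀ c r → 3 * suc c + (suc c + r) ≡ suc c * 4 + r
        eq₂ = solve-∀

    positionsOf : Block → List Pos
    positionsOf b = map (spotᵇ (proj₁ b)) (upTo (size b))

    length-positionsOf : ∀ b → length (positionsOf b) ≡ size b
    length-positionsOf b = trans (length-map (spotᵇ (proj₁ b)) (upTo (size b))) (length-upTo (size b))

    ∈-positionsOf : ∀ b i → i < size b → spotᵇ (proj₁ b) i ∈ positionsOf b
    ∈-positionsOf b i i< = ∈-map⁺ (spotᵇ (proj₁ b)) (∈-upTo⁺ i<)

    positionsOf-∈ : ∀ b p → p ∈ positionsOf b → ∃ λ i → i < size b × p ≡ spotᵇ (proj₁ b) i
    positionsOf-∈ b p p∈ = let i , i∈ , e = ∈-map⁻ (spotᵇ (proj₁ b)) p∈ in i , ∈-upTo⁻ i∈ , e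

    module Hosts (mode : Bool) (hosts : List Block) (host-tile : ∀ b → b ∈ hosts → Tile b) (host-sep : AllPairs Separated hosts)
      (host-mode : mode ≡ true ⊎ (∀ b → b ∈ hosts → 4 ≤ size b)) where

      sites : List Pos
      sites = concatMap windowsOf hosts

      host-positions : List Pos
      host-positions = concatMap positionsOf hosts

      length-host-positions : length host-positions ≡ ∑ hosts size
      length-host-positions = trans (length-concatMap positionsOf hosts) (∑-cong hosts length-positionsOf)

      sites-many : ∑ hosts size ≤ 7 * length sites
      sites-many = ≤-trans (∑-mono hosts (λ b b∈ → proj₁ (windows-many b (host-tile b b∈))))
        (≤-reflexive (trans (∑-* hosts 7 _) (cong (7 *_) (sym (length-concatMap windowsOf hosts)))))

      sites-few : 3 * length sites ≤ ∑ hosts size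
      sites-few = ≤-trans (≤-reflexive (trans (cong (3 *_) (length-concatMap windowsOf hosts)) (sym (∑-* hosts 3 _))))
        (∑-mono hosts (λ b b∈ → proj₂ (windows-many b (host-tile b b∈))))

      site : ∀ p → p ∈ sites → proj₂ p + 3 ≤ ℓ (proj₁ p) ×
        (∀ z x → proj₂ p ≡ 0 → suc (proj₂ p + 2) ≡ ℓ (proj₁ p) → closing mode p z x ≡ true → E (s (spotᵇ p 2)) z x ≡ true)
      site p p∈ with concatMap-∈ windowsOf hosts p∈
      ... | b , b∈ , p∈b with windows-inside b (host-tile b b∈) p p∈b
      ...   | refl , lo , hi = ≤-trans hi (Tile.inside (host-tile b b∈)) , closed mode host-mode
        where
        closed : ∀ mode → mode ≡ true ⊎ (∀ b → b ∈ hosts → 4 ≤ size b) → ∀ z x → proj₂ p ≡ 0 → suc (proj₂ p + 2) ≡ ℓ (proj₁ p) →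
          closing mode p z x ≡ true → E (s (spotᵇ p 2)) z x ≡ true
        closed true _ z x _ _ e = e
        -- A window forming a whole cycle would make the cycle a triangle, but the host has at least
        -- four positions.
        closed false (inj₂ big) z x e₀ e₃ _ = ⊥-elim (<⇒≱ (big b b∈) (≤-trans (m≤n+m (size b) (offset b))
          (≤-trans (Tile.inside (host-tile b b∈)) (≤-reflexive (trans (sym e₃) (cong (λ o → suc (o + 2)) e₀))))))

      sites-separated : AllPairs (λ p p′ → Separated (p , 3) (p′ , 3)) sites
      sites-separated = AllPairs-concatMap windowsOf hosts (λ b b∈ → windows-separated b (host-tile b b∈)) host-sep cross
        where
        cross : ∀ b b′ → b ∈ hosts → b′ ∈ hosts → Separated b b′ → ∀ p p′ → p ∈ windowsOf b → p′ ∈ windowsOf b′ → Separated (p , 3) (p′ , 3)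
        cross b b′ b∈ b′∈ sep p p′ p∈ p′∈ with windows-inside b (host-tile b b∈) p p∈ | windows-inside b′ (host-tile b′ b′∈) p′ p′∈
        ... | refl , lo , hi | refl , lo′ , hi′ = sub-blocks b b′ (proj₂ p) 3 (proj₂ p′) 3 lo hi lo′ hi′ sep

      site-in-host : ∀ p i → p ∈ sites → i < 3 → spotᵇ p i ∈ host-positions
      site-in-host p i p∈ i< with concatMap-∈ windowsOf hosts p∈
      ... | b , b∈ , p∈b with windows-inside b (host-tile b b∈) p p∈b
      ...   | refl , lo , hi with m≤n⇒∃[o]m+o≡n lo
      ...     | d , refl = ∈-concatMap positionsOf b∈ (subst (_∈ positionsOf b) (cong (cycle b ,_) (sym (+-assoc (offset b) d i)))
          (∈-positionsOf b (d + i) (<-≤-trans (+-monoʳ-< d i<) (+-cancelˡ-≤ (offset b) _ _ (≤-trans (≤-reflexive (sym (+-assoc (offset b) d 3))) hi)))))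

      host-positions-valid : ∀ p → p ∈ host-positions → Valid p
      host-positions-valid p p∈ with concatMap-∈ positionsOf hosts p∈
      ... | b , b∈ , p∈b with positionsOf-∈ b p p∈b
      ...   | i , i< , refl = <-≤-trans (+-monoʳ-< (offset b) i<) (Tile.inside (host-tile b b∈))

    open Absorption G ℓ 3≤ℓ s n≡

    gap : Block → ℕ
    gap b = size b ∸ 2

    sgn : Block → ℕ → Bool
    sgn b i = s (spotᵇ (proj₁ b) i)

    open Greedy G gap sgn q Λ

    len-size : ∀ {b} → Tile b → len b ≡ size b
    len-size tl = m+[n∸m]≡n (≤-trans (n≤1+n 2) (Tile.3≤size tl))

    ∑-len : ∀ bs → (∀ b → b ∈ bs → Tile b) → ∑ bs len ≡ ∑ bs size
    ∑-len bs tl = ∑-cong-∈ bs (λ b b∈ → len-size (tl b b∈))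

    record State (φ₀ : Pos → Maybe V) (spare : List Pos) (bs : List Block) (vs : List V) : Set where
      field
        φ       : Pos → Maybe V
        emb     : Embedding φ
        unused  : ∀ v → v ∈ vs → Unused φ v
        nodup   : Nodup vs
        tiled   : ∀ b → b ∈ bs → Tile b
        sep     : AllPairs Separated bs
        free    : ∀ b → b ∈ bs → Free φ (cycle b) (offset b) (size b)
        keeps   : ∀ p v → φ₀ p ≡ just v → φ p ≡ just v
        done    : ∀ p → Valid p → (∃ λ v → φ p ≡ just v) ⊎ (∃ λ b → b ∈ bs × p ∈ positionsOf b) ⊎ p ∈ spare

    Nodup-disjoint : ∀ (xs : List V) {ys v} → Nodup (xs ++ ys) → v ∈ xs → v ∈ ys → ⊥
    Nodup-disjoint xs {ys} {v} nd v∈ v∈′ = <⇒≱ ≤-refl (≤-trans (+-mono-≤ (once xs v∈) (once ys v∈′)) (≤-trans (≤-reflexive (sym (∑-++ xs ys _))) (nd v)))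
      where
      once : ∀ zs → v ∈ zs → 1 ≤ occ v zs
      once zs v∈ = ≤-trans (≤-reflexive (cong ⟦_⟧ (sym (==-refl v)))) (∑-∈ (λ x → ⟦ x == v ⟧) v∈)

    module Place {φ₀ spare bs b bs′ vs vs′} (st : State φ₀ spare bs vs) (bσ : bs ↭ b ∷ bs′) (p : Path (sgn b) (suc (gap b)))
      (closed : E (sgn b (suc (gap b))) (last p) (first p) ≡ true) (vσ : vs ↭ verts p ++ vs′) where
      open State st

      b∈ : b ∈ bs
      b∈ = ∈-resp-↭ (↭-sym bσ) (here refl)

      bs′⊆ : ∀ {b′} → b′ ∈ bs′ → b′ ∈ bs
      bs′⊆ b′∈ = ∈-resp-↭ (↭-sym bσ) (there b′∈)

      tl : Tile b
      tl = tiled b b∈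

      sep′ : All (Separated b) bs′ × AllPairs Separated bs′
      sep′ with AllPairs-↭ (λ {b} {b′} → Separated-sym {b} {b′}) bσ sep
      ... | h ∷ hs = h , hs

      ext : Extension φ (cycle b) (offset b) (walk p)
      -- Whole cycles and blocks of longer ones are packed alike as closed walks, so the wrap-around
      -- edge is at hand whenever the tile is a whole cycle.
      ext = embed-walk emb (Tile.inside tl) (free b b∈) (walk p) (≤-reflexive (len-size tl))
        (λ u u∈ → unused u (∈-resp-↭ (↭-sym vσ) (∈-++⁺ˡ u∈))) (λ _ _ → closed)

      open Extension ext

      nodup-all : Nodup (verts p ++ vs′)
      nodup-all v = ≤-trans (≤-reflexive (sym (∑-↭ _ vσ))) (nodup v)

      unused′ : ∀ v → v ∈ vs′ → Unused map′ v
      unused′ v v∈ p′ f with new p′ v f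
      ... | inj₁ f′ = unused v (∈-resp-↭ (↭-sym vσ) (∈-++⁺ʳ (verts p) v∈)) p′ f′
      ... | inj₂ (_ , _ , _ , v∈′) = Nodup-disjoint (verts p) nodup-all v∈′ v∈

      free′ : ∀ b′ → b′ ∈ bs′ → Free map′ (cycle b′) (offset b′) (size b′)
      free′ b′ b′∈ p′ v f i′ i′< with new p′ v f
      ... | inj₁ f′ = free b′ (bs′⊆ b′∈) p′ v f′ i′ i′<
      ... | inj₂ (i , i≤ , refl , _) = All.lookup (proj₁ sep′) b′∈ i i′ (≤-trans (s≤s i≤) (≤-reflexive (len-size tl))) i′<

      done′ : ∀ p′ → Valid p′ → (∃ λ v → map′ p′ ≡ just v) ⊎ (∃ λ b → b ∈ bs′ × p′ ∈ positionsOf b) ⊎ p′ ∈ spare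
      done′ p′ val with done p′ val
      ... | inj₁ (v , f) = inj₁ (v , old p′ v f)
      ... | inj₂ (inj₂ p∈) = inj₂ (inj₂ p∈)
      ... | inj₂ (inj₁ (b₁ , b₁∈ , p∈)) with ∈-resp-↭ bσ b₁∈
      ...   | there b₁∈′ = inj₂ (inj₁ (b₁ , b₁∈′ , p∈))
      ...   | here refl with positionsOf-∈ b p′ p∈
      ...     | i , i< , refl = inj₁ (_ , placed i (≤-pred (≤-trans i< (≤-reflexive (sym (len-size tl))))))

      place : State φ₀ spare bs′ vs′
      place = record
        { φ = map′ ; emb = embedding ; unused = unused′ ; nodup = Nodup-++ʳ (verts p) vσ nodup
        ; tiled = λ b′ b′∈ → tiled b′ (bs′⊆ b′∈) ; sep = proj₂ sep′ ; free = free′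
        ; keeps = λ p′ v f → old p′ v (keeps p′ v f) ; done = done′ }

    Spanning : Set
    Spanning = ∃ λ φ → Embedding φ × (∀ p → Valid p → ∃ λ v → φ p ≡ just v)

    positionsOf-valid : ∀ b → Tile b → ∀ p → p ∈ positionsOf b → Valid p
    positionsOf-valid b tl p p∈ with positionsOf-∈ b p p∈
    ... | i , i< , refl = <-≤-trans (+-monoʳ-< (offset b) i<) (Tile.inside tl)

    -- From reserved hosts to a spanning embedding.

    module Pipeline (mode : Bool) (hosts rest : List Block) (tσ : tiles ↭ hosts ++ rest)
      (host-mode : mode ≡ true ⊎ (∀ b → b ∈ hosts → 4 ≤ size b)) (B : ℕ)
      (dense : ∀ h a σ τ p x us → length us ≤ B → n ≤ q * ∑ all (λ z → ⟦ ((E σ h z ∧ E τ a z) ∧ closing mode p z x) ∧ not (z ∈ᵇ us) ⟧))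
      (room : 2 * ∑ hosts size ≤ B) where

      part-tile : ∀ b → b ∈ hosts ++ rest → Tile b
      part-tile b b∈ = tile b (∈-resp-↭ (↭-sym tσ) b∈)

      part-sep : AllPairs Separated hosts × AllPairs Separated rest × (∀ b b′ → b ∈ hosts → b′ ∈ rest → Separated b b′)
      part-sep = AllPairs-++⁻ hosts (AllPairs-↭ (λ {b} {b′} → Separated-sym {b} {b′}) tσ tiles-separated)

      host-tile : ∀ b → b ∈ hosts → Tile b
      host-tile b b∈ = part-tile b (∈-++⁺ˡ b∈)

      open Hosts mode hosts host-tile (proj₁ part-sep) host-mode
      open Selection.Choose G ℓ 3≤ℓ s n≡ n>0 q (closing mode) B dense
      open Select (closing mode) B dense

      selected : Selected sites
      selected = select sites site sites-separated (≤-trans sites-few (≤-trans (m≤m+n _ _) (≤-trans room (n≤1+n B))))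

      module Finish (S : Selected sites) (N₁ c₀ X P : ℕ) where
        open Selected S renaming (φ to φₛ; emb to embₛ; used to usedₛ; placed to placedₛ)

        host-room : length usedₛ + length host-positions ≤ B
        host-room = ≤-trans (+-mono-≤ (≤-trans (≤-reflexive used-size) sites-few) (≤-reflexive length-host-positions))
          (≤-trans (≤-reflexive (cong (∑ hosts size +_) (sym (+-identityʳ _)))) room)

        filled : Filled φₛ host-positions (length usedₛ + length host-positions)
        filled = fill host-positions φₛ usedₛ embₛ image host-positions-valid host-room

        module Pack (fl : Filled φₛ host-positions (length usedₛ + length host-positions)) where
          open Filled fl renaming (map′ to φ₀; emb′ to emb₀)

          in-host : ∀ p v → φ₀ p ≡ just v → p ∈ host-positions
          in-host p v f with domain′ p v f
          ... | inj₂ p∈ = p∈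
          ... | inj₁ f′ with domain p v f′
          ...   | p₀ , i , p₀∈ , i< , refl = site-in-host p₀ i p₀∈ i<

          -- Read off from `φ₀`: the bound on `used′` counts gadget vertices twice, whereas this
          -- list is no longer than `host-positions`, as needed for `M` vertices to remain.
          used₀ : List V
          used₀ = values φ₀ host-positions

          M : ℕ
          M = ∑ rest size + length slots

          host-split : ∑ hosts size + M ≡ n
          host-split = trans (sym (+-assoc (∑ hosts size) (∑ rest size) _)) (trans (cong (_+ length slots) (trans (sym (∑-++ hosts rest size)) (sym (∑-↭ size tσ)))) tiles-count)

          rem : Remaining used₀ M
          rem = remaining used₀ M (≤-trans (+-monoʳ-≤ M (≤-trans (length-values φ₀ host-positions) (≤-reflexive length-host-positions)))
            (≤-reflexive (trans (+-comm M _) host-split)))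

          -- The first `c₀` remaining tiles are not packed. Each has at least one position, which
          -- gives `greedy` the `c₀` surplus vertices that let it leave out the bad ones; their
          -- positions are absorbed along with the slots.
          spare : List Pos
          spare = slots ++ concatMap positionsOf (take c₀ rest)

          todo : List Block
          todo = drop c₀ rest

          rest-split : ∀ (f : Block → ℕ) → ∑ rest f ≡ ∑ (take c₀ rest) f + ∑ todo f
          rest-split f = trans (cong (λ l → ∑ l f) (sym (take++drop≡id c₀ rest))) (∑-++ (take c₀ rest) todo f)

          todo⊆ : ∀ {b} → b ∈ todo → b ∈ rest
          todo⊆ {b} b∈ = subst (b ∈_) (take++drop≡id c₀ rest) (∈-++⁺ʳ (take c₀ rest) b∈)

          rest-tile : ∀ b → b ∈ rest → Tile b
          rest-tile b b∈ = part-tile b (∈-++⁺ʳ hosts b∈)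

          initial : State φ₀ spare todo (Remaining.vs rem)
          initial = record
            { φ = φ₀ ; emb = emb₀
            ; unused = λ v v∈ p f → Remaining.fresh rem v v∈ (∈-values φ₀ (in-host p v f) f)
            ; nodup = Remaining.nodup rem
            ; tiled = λ b b∈ → rest-tile b (todo⊆ b∈)
            ; sep = proj₁ (proj₂ (AllPairs-++⁻ (take c₀ rest) (subst (AllPairs Separated) (sym (take++drop≡id c₀ rest)) (proj₁ (proj₂ part-sep)))))
            ; free = free
            ; keeps = λ _ _ f → f
            ; done = done
            }
            where
            free : ∀ b → b ∈ todo → Free φ₀ (cycle b) (offset b) (size b)
            free b b∈ p v f i′ i′< with concatMap-∈ positionsOf hosts (in-host p v f)
            ... | h , h∈ , p∈ with positionsOf-∈ h p p∈
            ...   | i , i< , refl = proj₂ (proj₂ part-sep) h b h∈ (todo⊆ b∈) i i′ i< i′<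
            done : ∀ p → Valid p → (∃ λ v → φ₀ p ≡ just v) ⊎ (∃ λ b → b ∈ todo × p ∈ positionsOf b) ⊎ p ∈ spare
            done p val with tiles-cover p val
            ... | inj₂ p∈ = inj₂ (inj₂ (∈-++⁺ˡ p∈))
            ... | inj₁ (b , i , b∈ , i< , refl) with ∈-++⁻ hosts (∈-resp-↭ tσ b∈)
            ...   | inj₁ b∈h = inj₁ (filled′ _ (∈-concatMap positionsOf b∈h (∈-positionsOf b i i<)))
            ...   | inj₂ b∈r with ∈-++⁻ (take c₀ rest) (subst (b ∈_) (sym (take++drop≡id c₀ rest)) b∈r)
            ...     | inj₁ b∈t = inj₂ (inj₂ (∈-++⁺ʳ slots (∈-concatMap positionsOf b∈t (∈-positionsOf b i i<))))
            ...     | inj₂ b∈d = inj₂ (inj₁ (b , b∈d , ∈-positionsOf b i i<))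

          dropped-size : ∑ (take c₀ rest) size ≤ c₀ * Λ
          dropped-size = begin
            ∑ (take c₀ rest) size ≤⟨ ∑-mono (take c₀ rest) (λ b b∈ → Tile.size≤Λ (rest-tile b (∈-take c₀ b∈))) ⟩
            ∑ (take c₀ rest) (const Λ) ≡⟨ ∑-const (take c₀ rest) Λ ⟩
            length (take c₀ rest) * Λ ≤⟨ *-monoˡ-≤ Λ (≤-trans (≤-reflexive (length-take c₀ rest)) (m⊓n≤m c₀ _)) ⟩
            c₀ * Λ ∎
            where open ≤-Reasoning

          spare-size : length spare ≤ length slots + c₀ * Λ
          spare-size = ≤-trans (≤-reflexive (length-++ slots)) (+-monoʳ-≤ (length slots)
            (≤-trans (≤-reflexive (trans (length-concatMap positionsOf (take c₀ rest)) (∑-cong (take c₀ rest) length-positionsOf))) dropped-size))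

          spare-valid : ∀ p → p ∈ spare → Valid p
          spare-valid p p∈ with ∈-++⁻ slots p∈
          ... | inj₁ p∈s = slots-valid p p∈s
          ... | inj₂ p∈t with concatMap-∈ positionsOf (take c₀ rest) p∈t
          ...   | b , b∈ , p∈b = positionsOf-valid b (rest-tile b (∈-take c₀ b∈)) p p∈b

          module Numbers (q>0 : 1 ≤ q) (c₀≤ : c₀ ≤ length rest) (few : P < suc c₀ * (X * X))
            (slack : X + 2 * q * c₀ + q * (length slots + c₀ * Λ) + 2 * q * Λ ≤ N₁)
            (dense-enough : ∀ σ v → q * (∑ rest size + length rest) + ∑ rest size + 2 * q * ∑ hosts size ≤ 2 * q * deg σ v all)
            (budget : n * (length constraints * ((5 * q * Λ) * (5 * q * Λ))) ≤ P)
            (hits : ∀ d → N₁ + (length slots + c₀ * Λ) ≤ ∑ gs (λ g → ⟦ good d g ⟧)) where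

            open ≤-Reasoning

            vs : List V
            vs = Remaining.vs rem

            todo-len : ∑ todo len ≡ ∑ todo size
            todo-len = ∑-len todo (λ b b∈ → rest-tile b (todo⊆ b∈))

            c₀≤dropped : c₀ ≤ ∑ (take c₀ rest) size
            c₀≤dropped = begin
              c₀ ≡⟨ trans (length-take c₀ rest) (m≤n⇒m⊓n≡m c₀≤) ⟨
              length (take c₀ rest) ≡⟨ ∑-length (take c₀ rest) ⟨
              ∑ (take c₀ rest) (const 1) ≤⟨ ∑-mono (take c₀ rest) (λ b b∈ → ≤-trans (s≤s z≤n) (Tile.3≤size (rest-tile b (∈-take c₀ b∈)))) ⟩
              ∑ (take c₀ rest) size ∎

            lower : ∑ todo len + c₀ ≤ length vs
            lower = begin
              ∑ todo len + c₀ ≤⟨ +-mono-≤ (≤-reflexive todo-len) c₀≤dropped ⟩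
              ∑ todo size + ∑ (take c₀ rest) size ≡⟨ trans (+-comm (∑ todo size) _) (sym (rest-split size)) ⟩
              ∑ rest size ≤⟨ m≤m+n _ (length slots) ⟩
              M ≡⟨ Remaining.size rem ⟨
              length vs ∎

            upper : length vs ≤ ∑ todo len + (length slots + c₀ * Λ)
            upper = begin
              length vs ≡⟨ trans (Remaining.size rem) (cong (_+ length slots) (rest-split size)) ⟩
              ∑ (take c₀ rest) size + ∑ todo size + length slots ≤⟨ +-monoˡ-≤ (length slots) (+-mono-≤ dropped-size (≤-reflexive (sym todo-len))) ⟩
              c₀ * Λ + ∑ todo len + length slots ≡⟨ eq (c₀ * Λ) (∑ todo len) (length slots) ⟩
              ∑ todo len + (length slots + c₀ * Λ) ∎
              where
              eq : ∀ a b c → a + b + c ≡ b + (c + a)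
              eq = solve-∀

            deg-vs : ∀ σ v → deg σ v all ≤ ∑ hosts size + deg σ v vs
            deg-vs σ v = +-cancelˡ-≤ M _ _ (≤-trans (Remaining.loss rem (E σ v))
              (≤-reflexive (trans (cong (_+ deg σ v vs) (sym host-split)) (eq (∑ hosts size) M _))))
              where
              eq : ∀ a b c → a + b + c ≡ b + (a + c)
              eq = solve-∀

            -- Restricting to `vs` costs a neighbourhood at most as many vertices as the hosts have
            -- positions, which `dense-enough` allows for. The potential therefore starts at 0, and
            -- the whole of `P` is available for its growth.
            no-deficit : ∀ c → deficit todo vs c ≡ 0
            no-deficit (σ , v) = m≤n⇒m∸n≡0 (+-cancelʳ-≤ (2 * q * ∑ hosts size) _ _ (begin
              ∑ todo ρ + 2 * q * ∑ hosts size
                ≡⟨ cong (_+ 2 * q * ∑ hosts size) (trans (len-ρ todo) (cong (λ k → q * (k + length todo) + k) todo-len)) ⟩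
              q * (∑ todo size + length todo) + ∑ todo size + 2 * q * ∑ hosts size
                ≤⟨ +-monoˡ-≤ _ (+-mono-≤ (*-monoʳ-≤ q (+-mono-≤ todo≤ todo-length≤)) todo≤) ⟩
              q * (∑ rest size + length rest) + ∑ rest size + 2 * q * ∑ hosts size ≤⟨ dense-enough σ v ⟩
              2 * q * deg σ v all ≤⟨ *-monoʳ-≤ (2 * q) (deg-vs σ v) ⟩
              2 * q * (∑ hosts size + deg σ v vs) ≡⟨ eq (2 * q) (∑ hosts size) _ ⟩
              2 * q * deg σ v vs + 2 * q * ∑ hosts size ∎))
              where
              todo≤ : ∑ todo size ≤ ∑ rest size
              todo≤ = ≤-trans (m≤n+m _ _) (≤-reflexive (sym (rest-split size)))
              todo-length≤ : length todo ≤ length rest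
              todo-length≤ = ≤-trans (≤-reflexive (length-drop c₀ rest)) (m∸n≤m _ c₀)
              eq : ∀ a b c → a * (b + c) ≡ a * c + a * b
              eq = solve-∀

            no-potential : potential todo vs ≡ 0
            no-potential = trans (∑-cong constraints (λ c → cong₂ _*_ (no-deficit c) (no-deficit c))) (∑-zero constraints)

            todo-short : length todo ≤ n
            todo-short = begin
              length todo ≡⟨ ∑-length todo ⟨
              ∑ todo (const 1) ≤⟨ ∑-mono todo (λ b b∈ → ≤-trans (s≤s z≤n) (Tile.3≤size (rest-tile b (todo⊆ b∈)))) ⟩
              ∑ todo size ≤⟨ m≤n+m _ (∑ (take c₀ rest) size) ⟩
              ∑ (take c₀ rest) size + ∑ todo size ≡⟨ rest-split size ⟨
              ∑ rest size ≤⟨ m≤m+n _ (length slots) ⟩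
              M ≤⟨ m≤n+m M (∑ hosts size) ⟩
              ∑ hosts size + M ≡⟨ host-split ⟩
              n ∎

            leftover : ∃₂ λ bs vs → State φ₀ spare bs vs × ∑ bs len ≤ N₁
            leftover = greedy (State φ₀ spare) c₀ (length slots + c₀ * Λ) X P N₁ q>0 few slack
              (λ {bs} {b} {bs′} {vs} {vs′} st bσ p closed vσ → Place.place {φ₀} {spare} {bs} {b} {bs′} {vs} {vs′} st bσ p closed vσ)
              (length todo) todo vs refl initial
              (λ b b∈ → ≤-trans (≤-reflexive (len-size (rest-tile b (todo⊆ b∈)))) (Tile.size≤Λ (rest-tile b (todo⊆ b∈))))
              (Remaining.nodup rem) lower upper
              (≤-trans (≤-reflexive (cong (_+ length todo * (length constraints * ((5 * q * Λ) * (5 * q * Λ)))) no-potential))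
                (≤-trans (*-monoˡ-≤ (length constraints * ((5 * q * Λ) * (5 * q * Λ))) todo-short) budget))

            module Absorb (bs : List Block) (vs : List V) (st : State φ₀ spare bs vs) (small : ∑ bs len ≤ N₁) where
              open State st

              us : List Pos
              us = concatMap positionsOf bs ++ spare

              us-valid : ∀ u → u ∈ us → Valid u
              us-valid u u∈ with ∈-++⁻ (concatMap positionsOf bs) u∈
              ... | inj₂ u∈s = spare-valid u u∈s
              ... | inj₁ u∈b with concatMap-∈ positionsOf bs u∈b
              ...   | b , b∈ , u∈′ = positionsOf-valid b (tiled b b∈) u u∈′

              us-size : length us ≤ N₁ + (length slots + c₀ * Λ)
              us-size = ≤-trans (≤-reflexive (length-++ (concatMap positionsOf bs))) (+-mono-≤
                (≤-trans (≤-reflexive (trans (length-concatMap positionsOf bs) (trans (∑-cong bs length-positionsOf) (sym (∑-len bs tiled))))) small)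
                spare-size)

              still-placed : ∀ g → g ∈ gs → Placed φ g
              still-placed g g∈ = let pl = placedₛ g g∈ in record
                { inside = inside pl ; at-x = stays (at-x pl) ; at-r = stays (at-r pl) ; at-z = stays (at-z pl) }
                where
                stays : ∀ {p v} → φₛ p ≡ just v → φ p ≡ just v
                stays f = keeps _ _ (old′ _ _ f)

              absorbed : Absorbed φ us
              absorbed = absorb us φ gs emb us-valid still-placed apart (λ d → ≤-trans us-size (hits d))

              spanning : Spanning
              spanning = Absorbed.map′ absorbed , Absorbed.embedding absorbed , total
                where
                total : ∀ p → Valid p → ∃ λ v → Absorbed.map′ absorbed p ≡ just v
                total p val with done p val
                ... | inj₁ (v , f) = Absorbed.kept absorbed p v f
                ... | inj₂ (inj₁ (b , b∈ , p∈)) = Absorbed.filled absorbed p (∈-++⁺ˡ (∈-concatMap positionsOf b∈ p∈))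
                ... | inj₂ (inj₂ p∈) = Absorbed.filled absorbed p (∈-++⁺ʳ (concatMap positionsOf bs) p∈)

            packed : Spanning
            packed = let bs , vs , st , small = leftover in Absorb.spanning bs vs st small

    -- Triangles against larger tiles, and the balance of all losses.

    is-big : Block → Bool
    is-big b = 4 ≤ᵇ size b

    bigs smalls : List Block
    bigs = filterᵇ is-big tiles
    smalls = filterᵇ (not ∘ is-big) tiles

    big-size : ∀ b → b ∈ bigs → 4 ≤ size b
    big-size b b∈ = ≤ᵇ⇒≤ 4 (size b) (subst T (sym (proj₂ (∈-filterᵇ is-big tiles b∈))) _)

    small-size : ∀ b → b ∈ smalls → size b ≡ 3
    small-size b b∈ with ∈-filterᵇ (not ∘ is-big) tiles b∈
    ... | b∈t , e = ≤-antisym (≮⇒≥ (λ lt → case trans (sym (T⇒true (≤⇒≤ᵇ lt))) (not-true e) of λ ())) (Tile.3≤size (tile b b∈t))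
      where
      T⇒true : ∀ {b} → T b → b ≡ true
      T⇒true {true} _ = refl

    -- Blocks of cut cycles have length `L ≥ 4`, so a tile of size 3 is an uncut triangle.
    smalls-few : length smalls ≤ t
    smalls-few = begin
      length smalls ≡⟨ length-filterᵇ (not ∘ is-big) tiles ⟩
      ∑ tiles (λ b → ⟦ not (is-big b) ⟧) ≡⟨ ∑-concatMap tilesOf (allFin t) _ ⟩
      ∑ (allFin t) (λ k → ∑ (tilesOf k) (λ b → ⟦ not (is-big b) ⟧)) ≤⟨ ∑-mono′ (allFin t) one ⟩
      ∑ (allFin t) (const 1) ≡⟨ trans (∑-length (allFin t)) (length-tabulate {n = t} id) ⟩
      t ∎
      where
      open ≤-Reasoning
      one : ∀ k → ∑ (tilesOf k) (λ b → ⟦ not (is-big b) ⟧) ≤ 1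
      one k with ℓ k ≤? Λ
      ... | yes _ = ≤-trans (≤-reflexive (+-identityʳ _)) (⟦⟧≤1 (not (4 ≤ᵇ ℓ k)))
      ... | no _ = ≤-trans (≤-reflexive (trans (∑-map _ (C.blocks (pieces k) 0) (λ b → ⟦ not (is-big b) ⟧)) (trans (∑-cong (C.blocks (pieces k) 0) (λ _ → none 4≤L)) (∑-zero (C.blocks (pieces k) 0))))) z≤n
        where
        none : ∀ {m} → 4 ≤ m → ⟦ not (4 ≤ᵇ m) ⟧ ≡ 0
        none (s≤s (s≤s (s≤s (s≤s _)))) = refl

    smalls-total : ∑ smalls size ≤ 3 * t
    smalls-total = ≤-trans (≤-reflexive (trans (∑-cong-∈ smalls small-size) (trans (∑-const smalls 3) (*-comm (length smalls) 3)))) (*-monoʳ-≤ 3 smalls-few)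

    part-total : ∑ bigs size + ∑ smalls size + length slots ≡ n
    part-total = trans (cong (_+ length slots) (sym (∑-filter is-big tiles size))) tiles-count

    module Dense (q>0 : 1 ≤ q) (degrees : ∀ σ v → q * (n + t) + 2 * n ≤ 2 * q * deg σ v all) (B : ℕ) (smallB : 2 * q * B ≤ n) where
      open ≤-Reasoning

      -- Two neighbourhoods share at least `t + 2 * n / q` vertices, of which `us` removes at most
      -- `n / (2 * q)`.
      dense₂ : ∀ h a σ τ us → length us ≤ B → n ≤ q * ∑ all (λ z → ⟦ ((E σ h z ∧ E τ a z) ∧ true) ∧ not (z ∈ᵇ us) ⟧)
      dense₂ h a σ τ us le = *-cancelˡ-≤ 2 (linear (n + 2 * (q * t))
        (+-mono-≤ (+-mono-≤ (degrees σ h) (degrees τ a)) (+-mono-≤ (*-monoʳ-≤ (2 * q) shared) smallB))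
        (eq n q t (deg σ h all) (deg τ a all) O B))
        where
        O : ℕ
        O = ∑ all (λ z → ⟦ ((E σ h z ∧ E τ a z) ∧ true) ∧ not (z ∈ᵇ us) ⟧)
        shared : deg σ h all + deg τ a all ≤ O + B + n
        shared = ≤-trans (common all h a σ τ us occ-allFin)
          (+-mono-≤ (+-mono-≤ (≤-reflexive (∑-cong all (λ z → cong (λ c → ⟦ c ∧ not (z ∈ᵇ us) ⟧) (and-true (E σ h z ∧ E τ a z))))) le) (≤-reflexive length-all))
          where
          and-true : ∀ b → b ≡ b ∧ true
          and-true true = refl
          and-true false = refl
        eq : ∀ n q t d d′ o b → 2 * n + (2 * q * d + 2 * q * d′ + (2 * q * (o + b + n) + n)) + (n + 2 * (q * t)) ≡
          2 * (q * o) + ((q * (n + t) + 2 * n) + (q * (n + t) + 2 * n) + (2 * q * (d + d′) + 2 * q * b))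
        eq = solve-∀

      module _ (t-large : q * n ≤ 3 * (q * t) + 3 * n) where
        -- Three neighbourhoods share at least `(3 * t - n) / 2 + 3 * n / q` vertices. With
        -- `t ≥ n / 3 - n / q` this is at least `3 * n / (2 * q)`, and removing `us` leaves `n / q`.
        dense₃ : ∀ h a x σ τ υ us → length us ≤ B → n ≤ q * ∑ all (λ z → ⟦ ((E σ h z ∧ E τ a z) ∧ E υ z x) ∧ not (z ∈ᵇ us) ⟧)
        dense₃ h a x σ τ υ us le = *-cancelˡ-≤ 2 (linear 0
          (+-mono-≤ (+-mono-≤ (+-mono-≤ (degrees σ h) (degrees τ a)) (degrees (not υ) x)) (+-mono-≤ (+-mono-≤ (*-monoʳ-≤ (2 * q) shared) smallB) t-large))
          (eq n q t (deg σ h all) (deg τ a all) (deg (not υ) x all) O B))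
          where
          O : ℕ
          O = ∑ all (λ z → ⟦ ((E σ h z ∧ E τ a z) ∧ E υ z x) ∧ not (z ∈ᵇ us) ⟧)
          shared : deg σ h all + deg τ a all + deg (not υ) x all ≤ O + B + 2 * n
          shared = begin
            deg σ h all + deg τ a all + deg (not υ) x all
              ≡⟨ trans (∑-+ all (λ z → ⟦ E σ h z ⟧ + ⟦ E τ a z ⟧) (λ z → ⟦ E (not υ) x z ⟧)) (cong (_+ deg (not υ) x all) (∑-+ all (λ z → ⟦ E σ h z ⟧) (λ z → ⟦ E τ a z ⟧))) ⟨
            ∑ all (λ z → ⟦ E σ h z ⟧ + ⟦ E τ a z ⟧ + ⟦ E (not υ) x z ⟧)
              ≤⟨ ∑-mono′ all (λ z → ≤-trans (≤-reflexive (cong (λ c → ⟦ E σ h z ⟧ + ⟦ E τ a z ⟧ + ⟦ c ⟧) (sym (E-flip υ z x)))) (triple-overlap (E σ h z) (E τ a z) (E υ z x) (z ∈ᵇ us))) ⟩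
            ∑ all (λ z → ⟦ ((E σ h z ∧ E τ a z) ∧ E υ z x) ∧ not (z ∈ᵇ us) ⟧ + ⟦ z ∈ᵇ us ⟧ + 2)
              ≡⟨ trans (∑-+ all (λ z → ⟦ ((E σ h z ∧ E τ a z) ∧ E υ z x) ∧ not (z ∈ᵇ us) ⟧ + ⟦ z ∈ᵇ us ⟧) (const 2)) (cong₂ _+_ (∑-+ all (λ z → ⟦ ((E σ h z ∧ E τ a z) ∧ E υ z x) ∧ not (z ∈ᵇ us) ⟧) (λ z → ⟦ z ∈ᵇ us ⟧)) (trans (∑-const all 2) (trans (cong (_* 2) length-all) (*-comm n 2)))) ⟩
            O + ∑ all (λ z → ⟦ z ∈ᵇ us ⟧) + 2 * n ≤⟨ +-monoˡ-≤ (2 * n) (+-monoʳ-≤ O (≤-trans (∑-∈ᵇ all occ-allFin us) le)) ⟩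
            O + B + 2 * n ∎
          eq : ∀ n q t d d′ d″ o b → 2 * n + (2 * q * d + 2 * q * d′ + 2 * q * d″ + ((2 * q * (o + b + 2 * n) + n) + (3 * (q * t) + 3 * n))) + 0 ≡
            2 * (q * o) + ((q * (n + t) + 2 * n) + (q * (n + t) + 2 * n) + (q * (n + t) + 2 * n) + ((2 * q * (d + d′ + d″) + 2 * q * b) + q * n))
          eq = solve-∀

    module _ (q>0 : 1 ≤ q) (degrees : ∀ σ v → q * (n + t) + 2 * n ≤ 2 * q * deg σ v all) (u W c₀ : ℕ)
      (target : 4 * q * (84 * (Q * u) + Λ) ≤ n) (L≡ : L ≡ 2 * W * q) (n≤Wu : n ≤ W * u) (8u≤n : 8 * u ≤ n)
      (constants : 2 * q * c₀ + q * (c₀ * Λ) + 2 * q * Λ ≤ u) (logarithm : 4 * (n * (n * n)) ≤ 2 ^ u)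
      (few : n * (2 * n * ((5 * q * Λ) * (5 * q * Λ))) < suc c₀ * (u * u)) where

      open ≤-Reasoning
      open Dense q>0 degrees

      -- The total size of the hosts: `84 = 7 * 2 * 6`, as 7 positions per window yield
      -- `2 * Q * (6 * u)` windows, which `many-hits` turns into `6 * u` hits, less `u` for the
      -- number of demands.
      m : ℕ
      m = 84 * (Q * u)

      Q>0 : 1 ≤ Q
      Q>0 = *-mono-≤ q>0 (*-mono-≤ q>0 q>0)

      Λ>0 : 1 ≤ Λ
      Λ>0 = ≤-trans (≤-trans (s≤s z≤n) 4≤L) L≤Λ

      1* : ∀ {a} b → 1 ≤ a → b ≤ a * b
      1* b h = ≤-trans (≤-reflexive (sym (*-identityˡ b))) (*-monoˡ-≤ b h)

      W>0 : 0 < 2 * W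
      W>0 = n≢0⇒n>0 (λ e → <⇒≱ (≤-trans (s≤s z≤n) 4≤L) (≤-reflexive (trans L≡ (cong (_* q) e))))

      slots-bound : q * length slots ≤ u
      slots-bound = *-cancelˡ-≤ (2 * W) {{>-nonZero W>0}} (begin
        2 * W * (q * length slots) ≡⟨ *-assoc (2 * W) q _ ⟨
        2 * W * q * length slots ≡⟨ cong (_* length slots) L≡ ⟨
        L * length slots ≤⟨ slots-few ⟩
        2 * n ≤⟨ *-monoʳ-≤ 2 n≤Wu ⟩
        2 * (W * u) ≡⟨ *-assoc 2 W u ⟨
        2 * W * u ∎)

      slots≤u : length slots ≤ u
      slots≤u = ≤-trans (1* _ q>0) slots-bound

      4qm≤n : 4 * q * m ≤ n
      4qm≤n = ≤-trans (*-monoʳ-≤ (4 * q) (m≤m+n m Λ)) target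

      c₀Λ≤u : q * (c₀ * Λ) ≤ u
      c₀Λ≤u = ≤-trans (≤-trans (m≤n+m _ (2 * q * c₀)) (m≤m+n _ _)) constants

      -- Since `2 * q ≤ suc L`, cutting creates at most `n / (2 * q)` additional tiles.
      tile-count : q * length tiles + q * length tiles ≤ q * t + q * t + n
      tile-count = ≤-trans (≤-reflexive (double q (length tiles))) (≤-trans (*-monoʳ-≤ (2 * q) (m≤n+m∸n (length tiles) t))
        (≤-trans (≤-reflexive (expand q t (length tiles ∸ t))) (+-monoʳ-≤ (q * t + q * t) (≤-trans (*-monoˡ-≤ (length tiles ∸ t) 2q≤L) excess))))
        where
        double : ∀ q k → q * k + q * k ≡ 2 * q * k
        double = solve-∀
        expand : ∀ q t d → 2 * q * (t + d) ≡ q * t + q * t + 2 * q * d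
        expand = solve-∀
        2q≤L : 2 * q ≤ suc L
        2q≤L = ≤-trans (≤-trans (≤-trans (1* (2 * q) (half W>0)) (≤-reflexive (swap-W W q))) (≤-reflexive (sym L≡))) (n≤1+n L)
          where
          half : 0 < 2 * W → 1 ≤ W
          half h = n≢0⇒n>0 (λ { refl → <⇒≱ h z≤n })
          swap-W : ∀ W q → W * (2 * q) ≡ 2 * W * q
          swap-W = solve-∀
        excess : suc L * (length tiles ∸ t) ≤ n
        excess = ≤-trans (≤-reflexive (*-distribˡ-∸ (suc L) (length tiles) t)) (≤-trans (∸-monoˡ-≤ (suc L * t) tiles-few) (≤-reflexive (m+n∸m≡n (suc L * t) n)))

      module Go (mode : Bool) (pool other : List Block) (pσ : tiles ↭ pool ++ other)
        (pool-mode : mode ≡ true ⊎ (∀ b → b ∈ pool → 4 ≤ size b)) (t-large : mode ≡ true → q * n ≤ 3 * (q * t) + 3 * n)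
        (hosts rs : List Block) (pool≡ : pool ≡ hosts ++ rs) (lo : m ≤ ∑ hosts size) (hi : ∑ hosts size ≤ m + Λ) where

        rest : List Block
        rest = rs ++ other

        tσ : tiles ↭ hosts ++ rest
        tσ = ↭-trans pσ (↭-trans (++⁺ʳ other (↭-reflexive pool≡)) (↭-reflexive (++-assoc hosts rs other)))

        host-mode : mode ≡ true ⊎ (∀ b → b ∈ hosts → 4 ≤ size b)
        host-mode = [ inj₁ , (λ h → inj₂ (λ b b∈ → h b (subst (b ∈_) (sym pool≡) (∈-++⁺ˡ b∈)))) ]′ pool-mode

        -- One `hp` bounds the vertices of the gadgets, the other the positions of the hosts to be
        -- filled.
        hp B : ℕ
        hp = ∑ hosts size
        B = 2 * hp

        4qhp≤n : 4 * q * hp ≤ n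
        4qhp≤n = ≤-trans (*-monoʳ-≤ (4 * q) hi) target

        smallB : 2 * q * B ≤ n
        smallB = ≤-trans (≤-reflexive (eq q hp)) 4qhp≤n
          where
          eq : ∀ q h → 2 * q * (2 * h) ≡ 4 * q * h
          eq = solve-∀

        dense : ∀ h a σ τ p x us → length us ≤ B → n ≤ q * ∑ all (λ z → ⟦ ((E σ h z ∧ E τ a z) ∧ closing mode p z x) ∧ not (z ∈ᵇ us) ⟧)
        dense h a σ τ p x us le = by-mode mode t-large
          where
          by-mode : ∀ mode → (mode ≡ true → q * n ≤ 3 * (q * t) + 3 * n) →
            n ≤ q * ∑ all (λ z → ⟦ ((E σ h z ∧ E τ a z) ∧ closing mode p z x) ∧ not (z ∈ᵇ us) ⟧)
          by-mode true tl = dense₃ B smallB (tl refl) h a x σ τ (s (spotᵇ p 2)) us le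
          by-mode false _ = dense₂ B smallB h a σ τ us le

        module PP = Pipeline mode hosts rest tσ host-mode B dense ≤-refl
        module H = Hosts mode hosts PP.host-tile (proj₁ PP.part-sep) host-mode

        n-split : hp + ∑ rest size + length slots ≡ n
        n-split = trans (cong (_+ length slots) (trans (sym (∑-++ hosts rest size)) (sym (∑-↭ size tσ)))) tiles-count

        u≤rest : u ≤ ∑ rest size
        u≤rest = *-cancelˡ-≤ 4 (linear (2 * n)
          (+-mono-≤ (+-mono-≤ (*-monoʳ-≤ 4 (≤-reflexive (sym n-split))) 4hp≤n) (+-mono-≤ (*-monoʳ-≤ 4 slots≤u) 8u≤n))
          (eq u hp (∑ rest size) (length slots) n))
          where
          4hp≤n : 4 * hp ≤ n
          4hp≤n = ≤-trans (≤-trans (1* (4 * hp) q>0) (≤-reflexive (e q hp))) 4qhp≤n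
            where
            e : ∀ q h → q * (4 * h) ≡ 4 * q * h
            e = solve-∀
          eq : ∀ u h r S n → 4 * u + (4 * (h + r + S) + n + (4 * u + n)) + 2 * n ≡ 4 * r + (4 * n + 4 * h + (4 * S + 8 * u))
          eq = solve-∀

        c₀≤rest : c₀ ≤ length rest
        c₀≤rest = *-cancelʳ-≤ _ _ Λ {{>-nonZero Λ>0}} (begin
          c₀ * Λ ≤⟨ 1* (c₀ * Λ) q>0 ⟩
          q * (c₀ * Λ) ≤⟨ c₀Λ≤u ⟩
          u ≤⟨ u≤rest ⟩
          ∑ rest size ≤⟨ ∑-mono rest (λ b b∈ → Tile.size≤Λ (PP.part-tile b (∈-++⁺ʳ hosts b∈))) ⟩
          ∑ rest (const Λ) ≡⟨ ∑-const rest Λ ⟩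
          length rest * Λ ∎)

        rest≤tiles : length rest ≤ length tiles
        rest≤tiles = ≤-trans (m≤n+m _ (length hosts)) (≤-reflexive (trans (sym (length-++ hosts)) (sym (↭-length tσ))))

        rest≤n : ∑ rest size ≤ n
        rest≤n = ≤-trans (m≤n+m _ hp) (≤-trans (m≤m+n _ (length slots)) (≤-reflexive n-split))

        slack : u + 2 * q * c₀ + q * (length slots + c₀ * Λ) + 2 * q * Λ ≤ 3 * u
        slack = linear 0 (+-mono-≤ constants slots-bound) (eq u q c₀ (length slots) (c₀ * Λ) Λ)
          where
          eq : ∀ u q c S l Λ → u + 2 * q * c + q * (S + l) + 2 * q * Λ + (u + u) + 0 ≡ 3 * u + (2 * q * c + q * l + 2 * q * Λ + q * S)
          eq = solve-∀

        -- The surplus `2 * n` in `degrees` is divided up: `n` for the reserve in `ρ`, `n / 2` for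
        -- the tiles beyond `t`, and `n / 2` for the vertices of the hosts.
        dense-enough : ∀ σ v → q * (∑ rest size + length rest) + ∑ rest size + 2 * q * hp ≤ 2 * q * deg σ v all
        dense-enough σ v = *-cancelˡ-≤ 2 (linear 0
          (+-mono-≤ (+-mono-≤ (*-monoʳ-≤ 2 (degrees σ v)) (≤-trans (+-mono-≤ (*-monoʳ-≤ q rest≤tiles) (*-monoʳ-≤ q rest≤tiles)) tile-count))
            (+-mono-≤ (+-mono-≤ (*-monoʳ-≤ (2 * q) rest≤n) (*-monoʳ-≤ 2 rest≤n)) 4qhp≤n))
          (eq q (∑ rest size) (length rest) hp (deg σ v all) n t))
          where
          eq : ∀ q r k h d n t → 2 * (q * (r + k) + r + 2 * q * h) + (2 * (2 * q * d) + (q * t + q * t + n) + (2 * q * n + 2 * n + n)) + 0 ≡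
            2 * (2 * q * d) + (2 * (q * (n + t) + 2 * n) + (q * k + q * k) + (2 * q * r + 2 * r + 4 * q * h))
          eq = solve-∀

        sites-bound : (2 * Q ∸ 1) * (6 * u) ≤ length H.sites
        sites-bound = ≤-trans (*-monoˡ-≤ (6 * u) (m∸n≤m (2 * Q) 1)) (*-cancelˡ-≤ 7 (begin
          7 * (2 * Q * (6 * u)) ≡⟨ eq Q u ⟩
          m ≤⟨ lo ⟩
          hp ≤⟨ H.sites-many ⟩
          7 * length H.sites ∎))
          where
          eq : ∀ Q u → 7 * (2 * Q * (6 * u)) ≡ 84 * (Q * u)
          eq = solve-∀

        length-constraints : length constraints ≡ 2 * n
        length-constraints = trans (sym (∑-length constraints)) (trans (∑-constraints (const 1))
          (trans (∑-const all 2) (trans (cong (_* 2) length-all) (*-comm n 2))))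

        module Final (S : Selected H.sites) where
          module F = PP.Finish S (3 * u) c₀ u (n * (2 * n * ((5 * q * Λ) * (5 * q * Λ))))

          many : ∀ d → 6 * u ≤ u + ∑ (Selected.gs S) (λ g → ⟦ good d g ⟧)
          many = Select.many-hits (closing mode) B dense S (6 * u) u Q>0 sites-bound (≤-trans (≤-reflexive length-demands) logarithm)

          -- The `5 * u` hits cover `3 * u` positions of unpacked tiles, at most `u` slots, and at
          -- most `u` positions of the tiles given up.
          hits : ∀ d → 3 * u + (length slots + c₀ * Λ) ≤ ∑ (Selected.gs S) (λ g → ⟦ good d g ⟧)
          hits d = linear 0 (+-mono-≤ (many d) (+-mono-≤ slots≤u (≤-trans (1* (c₀ * Λ) q>0) c₀Λ≤u))) (eq u (length slots) (c₀ * Λ) _)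
            where
            eq : ∀ u S l h → 3 * u + (S + l) + (u + h + (u + u)) + 0 ≡ h + (6 * u + (S + l))
            eq = solve-∀

          spanning : Spanning
          spanning = F.Pack.Numbers.packed F.filled q>0 c₀≤rest few slack dense-enough
            (≤-reflexive (cong (λ k → n * (k * ((5 * q * Λ) * (5 * q * Λ)))) length-constraints)) hits

        spanning : Spanning
        spanning = Final.spanning PP.selected

      embed : Spanning
      embed with n ≤? 2 * q * ∑ bigs size
      ... | yes big = go (prefix bigs size m Λ (λ b b∈ → Tile.size≤Λ (tile b (proj₁ (∈-filterᵇ is-big tiles b∈)))) m≤)
        where
        m≤ : m ≤ ∑ bigs size
        m≤ = *-cancelˡ-≤ (2 * q) {{>-nonZero (≤-trans (s≤s z≤n) (*-monoʳ-≤ 2 q>0))}}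
          (≤-trans (≤-trans (m≤m+n _ (2 * q * m)) (≤-reflexive (eq q m))) (≤-trans 4qm≤n big))
          where
          eq : ∀ q m → 2 * q * m + 2 * q * m ≡ 4 * q * m
          eq = solve-∀
        go : (∃₂ λ hs rs → bigs ≡ hs ++ rs × m ≤ ∑ hs size × ∑ hs size ≤ m + Λ) → Spanning
        go (hs , rs , e , lo , hi) = Go.spanning false bigs smalls (filter-↭ is-big tiles) (inj₂ big-size) (λ ()) hs rs e lo hi
      -- Larger tiles now cover less than `n / (2 * q)` positions and the slots at most `u / q`, so
      -- triangles cover the rest, whence `t ≥ n / 3 - n / q`. Gadgets are placed on triangles.
      ... | no ¬big = go (prefix smalls size m Λ (λ b b∈ → Tile.size≤Λ (tile b (proj₁ (∈-filterᵇ (not ∘ is-big) tiles b∈)))) m≤)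
        where
        few-bigs : 2 * q * ∑ bigs size ≤ n
        few-bigs = <⇒≤ (≰⇒> ¬big)
        2u≤n : 2 * u ≤ n
        2u≤n = ≤-trans (*-monoˡ-≤ u {2} {8} (s≤s (s≤s z≤n))) 8u≤n
        smalls-large : 2 * q * n ≤ n + 2 * u + 2 * q * ∑ smalls size
        smalls-large = linear 0 (+-mono-≤ (+-mono-≤ few-bigs (*-monoʳ-≤ 2 slots-bound)) (*-monoʳ-≤ (2 * q) (≤-reflexive (sym part-total))))
          (eq q n u (∑ bigs size) (∑ smalls size) (length slots))
          where
          eq : ∀ q n u b c S → 2 * q * n + (n + 2 * u + 2 * q * (b + c + S)) + 0 ≡ n + 2 * u + 2 * q * c + (2 * q * b + 2 * (q * S) + 2 * q * n)
          eq = solve-∀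
        t-large : q * n ≤ 3 * (q * t) + 3 * n
        t-large = *-cancelˡ-≤ 2 (linear (4 * n) (+-mono-≤ (+-mono-≤ smalls-large 2u≤n) (*-monoʳ-≤ (2 * q) smalls-total)) (eq q n u (∑ smalls size) t))
          where
          eq : ∀ q n u c t → 2 * (q * n) + (n + 2 * u + 2 * q * c + n + 2 * q * (3 * t)) + 4 * n ≡ 2 * (3 * (q * t) + 3 * n) + (2 * q * n + 2 * u + 2 * q * c)
          eq = solve-∀
        m≤ : m ≤ ∑ smalls size
        m≤ = *-cancelˡ-≤ (4 * q) {{>-nonZero (≤-trans (s≤s z≤n) (*-monoʳ-≤ 4 q>0))}}
          (linear (4 * u) (+-mono-≤ (+-mono-≤ 4qm≤n (*-monoʳ-≤ 2 smalls-large)) (+-mono-≤ 8u≤n (*-monoʳ-≤ 4 (1* n q>0))))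
            (eq q m n u (∑ smalls size)))
          where
          eq : ∀ q m n u c → 4 * q * m + (n + 2 * (n + 2 * u + 2 * q * c) + (n + 4 * (q * n))) + 4 * u ≡ 4 * q * c + (4 * q * m + 2 * (2 * q * n) + (8 * u + 4 * n))
          eq = solve-∀
        go : (∃₂ λ hs rs → smalls ≡ hs ++ rs × m ≤ ∑ hs size × ∑ hs size ≤ m + Λ) → Spanning
        go (hs , rs , e , lo , hi) = Go.spanning true smalls bigs (↭-trans (filter-↭ is-big tiles) (++-comm bigs smalls)) (inj₁ refl) (λ _ → t-large) hs rs e lo hi

  -- Clearing denominators and choosing the constants.

  -- A positive η has numerator at least 1, so `η ≥ 1 / q` for its denominator `q`; the inequality
  -- is multiplied by `2 * q`, and everything else takes place in ℕ.
  semidegree-bound : ∀ η → ℚ.0ℚ ℚ.< η → ∃ λ q → 1 ≤ q × (∀ a n d →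
    ℕ→ℚ a ℚ.* ℚ.½ ℚ.+ η ℚ.* ℕ→ℚ n ℚ.≤ ℕ→ℚ d → q * a + 2 * n ≤ 2 * q * d)
  semidegree-bound (mkℚ (ℤ.+ zero) _ _) (ℚ.*<* (ℤ.+<+ ()))
  semidegree-bound (mkℚ ℤ.-[1+ _ ] _ _) (ℚ.*<* ())
  semidegree-bound η@(mkℚ (ℤ.+ suc p) e _) _ = suc e , s≤s z≤n , λ a n d h → clear a n d (unnormalise a n d h)
    where
    nat : ℕ → ℚᵘ.ℚᵘ
    nat m = ℚᵘ.mkℚᵘ (ℤ.+ m) 0
    nat-≃ : ∀ m → ℚ.toℚᵘ (ℕ→ℚ m) ℚᵘ.≃ nat m
    nat-≃ m = ℚ.toℚᵘ-fromℚᵘ (nat m)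
    unnormalise : ∀ a n d → ℕ→ℚ a ℚ.* ℚ.½ ℚ.+ η ℚ.* ℕ→ℚ n ℚ.≤ ℕ→ℚ d →
      nat a ℚᵘ.* ℚᵘ.½ ℚᵘ.+ ℚᵘ.mkℚᵘ (ℤ.+ suc p) e ℚᵘ.* nat n ℚᵘ.≤ nat d
    unnormalise a n d h = ℚᵘ.≤-respʳ-≃ (nat-≃ d) (ℚᵘ.≤-respˡ-≃
      (ℚᵘ.≃-trans (ℚ.toℚᵘ-homo-+ (ℕ→ℚ a ℚ.* ℚ.½) (η ℚ.* ℕ→ℚ n))
        (ℚᵘ.+-cong (ℚᵘ.≃-trans (ℚ.toℚᵘ-homo-* (ℕ→ℚ a) ℚ.½) (ℚᵘ.*-congʳ (nat-≃ a)))
          (ℚᵘ.≃-trans (ℚ.toℚᵘ-homo-* η (ℕ→ℚ n)) (ℚᵘ.*-congˡ {ℚ.toℚᵘ η} (nat-≃ n)))))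
      (ℚ.toℚᵘ-mono-≤ h))
    clear : ∀ a n d → nat a ℚᵘ.* ℚᵘ.½ ℚᵘ.+ ℚᵘ.mkℚᵘ (ℤ.+ suc p) e ℚᵘ.* nat n ℚᵘ.≤ nat d →
      suc e * a + 2 * n ≤ 2 * suc e * d
    clear a n d (ℚᵘ.*≤* h) = linear (2 * (p * n)) (naturals h) (eq (suc e) a n p d)
      where
      eq : ∀ q a n p d → q * a + 2 * n + d * (2 * (q * 1)) + 2 * (p * n) ≡
        2 * q * d + (a * 1 * (q * 1) + (1 + p) * n * 2) * 1
      eq = solve-∀
      naturals : (ℤ.+ a ℤ.* ℤ.+ 1 ℤ.* ℤ.+ (suc e * 1) ℤ.+ ℤ.+ suc p ℤ.* ℤ.+ n ℤ.* ℤ.+ 2) ℤ.* ℤ.+ 1 ℤ.≤ ℤ.+ d ℤ.* ℤ.+ (2 * (suc e * 1)) →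
        (a * 1 * (suc e * 1) + suc p * n * 2) * 1 ≤ d * (2 * (suc e * 1))
      naturals h
        rewrite sym (ℤ.pos-* a 1) | sym (ℤ.pos-* (a * 1) (suc e * 1)) | sym (ℤ.pos-* (suc p) n) | sym (ℤ.pos-* (suc p * n) 2)
              | sym (ℤ.pos-* (a * 1 * (suc e * 1) + suc p * n * 2) 1) | sym (ℤ.pos-* d (2 * (suc e * 1)))
        = ℤ.drop‿+≤+ h

  -- With `w = u / 4 + 1` one has `u ≤ 4 * w` and `64 * c ≤ w`, so the left side is at most the
  -- fourth power of `w ≤ 2 ^ (u / 4)`. The 256 is `4 * 64`.
  exponential : ∀ c u → 256 * c ≤ u → c * (u * (u * u)) ≤ 2 ^ u
  exponential c u h = begin
    c * (u * (u * u)) ≤⟨ *-monoʳ-≤ c (*-mono-≤ u≤ (*-mono-≤ u≤ u≤)) ⟩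
    c * (4 * w * (4 * w * (4 * w))) ≡⟨ eq₁ c w ⟩
    64 * c * (w * (w * w)) ≤⟨ *-monoˡ-≤ (w * (w * w)) 64c≤w ⟩
    w * (w * (w * w)) ≤⟨ *-mono-≤ w≤ (*-mono-≤ w≤ (*-mono-≤ w≤ w≤)) ⟩
    2 ^ v * (2 ^ v * (2 ^ v * 2 ^ v))
      ≡⟨ trans (cong (λ k → 2 ^ v * (2 ^ v * k)) (sym (^-distribˡ-+-* 2 v v))) (trans (cong (2 ^ v *_) (sym (^-distribˡ-+-* 2 v (v + v)))) (sym (^-distribˡ-+-* 2 v (v + (v + v))))) ⟩
    2 ^ (v + (v + (v + v))) ≤⟨ ^-monoʳ-≤ 2 (≤-trans (≤-reflexive (eq₂ v)) (≤-trans (m≤n+m (v * 4) (u % 4)) (≤-reflexive (sym split)))) ⟩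
    2 ^ u ∎
    where
    open ≤-Reasoning
    v w : ℕ
    v = u / 4
    w = suc v
    split : u ≡ u % 4 + v * 4
    split = m≡m%n+[m/n]*n u 4
    u< : suc u ≤ 4 * w
    u< = ≤-trans (s≤s (≤-reflexive split)) (≤-trans (+-monoˡ-≤ (v * 4) (m%n<n u 4)) (≤-reflexive (eq₃ v)))
      where
      eq₃ : ∀ v → 4 + v * 4 ≡ 4 * suc v
      eq₃ = solve-∀
    u≤ : u ≤ 4 * w
    u≤ = <⇒≤ u<
    64c≤w : 64 * c ≤ w
    64c≤w = *-cancelˡ-≤ 4 (≤-trans (≤-reflexive (eq₄ c)) (≤-trans h u≤))
      where
      eq₄ : ∀ c → 4 * (64 * c) ≡ 256 * c
      eq₄ = solve-∀
    w≤ : w ≤ 2 ^ v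
    w≤ = n<2^n v
      where
      n<2^n : ∀ v → suc v ≤ 2 ^ v
      n<2^n zero = ≤-refl
      n<2^n (suc v) = ≤-trans (+-mono-≤ (m^n>0 2 v) (n<2^n v)) (≤-reflexive (cong (2 ^ v +_) (sym (+-identityʳ (2 ^ v)))))
    eq₁ : ∀ c w → c * (4 * w * (4 * w * (4 * w))) ≡ 64 * c * (w * (w * w))
    eq₁ = solve-∀
    eq₂ : ∀ v → v + (v + (v + v)) ≡ v * 4
    eq₂ = solve-∀

  -- n is measured in units u ≈ n/W: prices treat a deficit of u as large, packing stops at 3u, and each demand has 5u gadgets.
  record Constants (q L Λ n : ℕ) : Set where
    field
      u W c₀    : ℕ
      positive  : 0 < n
      target    : 4 * q * (84 * (q * (q * q) * u) + Λ) ≤ n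
      block     : L ≡ 2 * W * q
      upper     : n ≤ W * u
      lower     : 8 * u ≤ n
      constants : 2 * q * c₀ + q * (c₀ * Λ) + 2 * q * Λ ≤ u
      logarithm : 4 * (n * (n * n)) ≤ 2 ^ u
      few       : n * (2 * n * ((5 * q * Λ) * (5 * q * Λ))) < suc c₀ * (u * u)

  constants-exist : ∀ q → 1 ≤ q → ∃ λ n₀ → ∃₂ λ L Λ → 4 ≤ L × L * L ≤ Λ × (∀ n → n₀ ≤ n → Constants q L Λ n)
  constants-exist q q>0 = D * u₀ , L , Λ , 4≤L , ≤-refl , λ n n₀≤n → choose n n₀≤n
    where
    open ≤-Reasoning
    D W L Λ c₀ c u₀ : ℕ
    -- `336 = 4 * 84` comes from `target`, and 8 from `lower`. As `u = n / D` is rounded down,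
    -- `n ≤ 2 * D * u`, hence `W`. `L` makes `q` times the number of slots at most `u`; `c₀` and `c`
    -- are the coefficients left in `few` and `logarithm` after `n ≤ W * u`. Only `u` depends on
    -- `n`, and `u₀` collects its lower bounds.
    D = 8 + 336 * (q * (q * (q * q)))
    W = 2 * D
    L = 2 * W * q
    Λ = L * L
    c₀ = 2 * (W * W) * ((5 * q * Λ) * (5 * q * Λ))
    c = 4 * (W * (W * W))
    u₀ = suc (2 * q * c₀ + q * (c₀ * Λ) + 2 * q * Λ + 256 * c)
    4≤L : 4 ≤ L
    4≤L = ≤-trans {j = 2 * W} (≤-trans (≤-trans (s≤s (s≤s (s≤s (s≤s z≤n)))) (m≤m+n 8 (336 * (q * (q * (q * q)))))) (≤-trans (m≤m+n D (D + 0)) (m≤m+n W (W + 0))))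
      (≤-trans (≤-reflexive (sym (*-identityʳ (2 * W)))) (*-monoʳ-≤ (2 * W) q>0))
    choose : ∀ n → D * u₀ ≤ n → Constants q L Λ n
    choose n n₀≤n = record
      { u = u ; W = W ; c₀ = c₀
      ; positive = ≤-trans (*-mono-≤ {1} {D} (s≤s z≤n) (s≤s z≤n)) n₀≤n
      ; target = target
      ; block = refl
      ; upper = upper
      ; lower = ≤-trans (*-monoˡ-≤ u (m≤m+n 8 (336 * (q * (q * (q * q)))))) Du≤n
      ; constants = ≤-trans (≤-trans (m≤m+n _ (256 * c)) (n≤1+n _)) u₀≤u
      ; logarithm = logarithm
      ; few = few
      }
      where
      u : ℕ
      u = n / D
      n≡ : n ≡ n % D + u * D
      n≡ = m≡m%n+[m/n]*n n D
      Du≤n : D * u ≤ n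
      Du≤n = ≤-trans (≤-reflexive (*-comm D u)) (≤-trans (m≤n+m (u * D) (n % D)) (≤-reflexive (sym n≡)))
      n< : n < suc u * D
      n< = ≤-trans (s≤s (≤-reflexive n≡)) (+-monoˡ-≤ (u * D) (m%n<n n D))
      u₀≤u : u₀ ≤ u
      u₀≤u = ≤-pred (*-cancelʳ-< D u₀ (suc u) (≤-<-trans (≤-trans (≤-reflexive (*-comm u₀ D)) n₀≤n) n<))
      u>0 : 1 ≤ u
      u>0 = ≤-trans (s≤s z≤n) u₀≤u
      upper : n ≤ W * u
      upper = ≤-trans (<⇒≤ n<) (≤-trans (*-monoˡ-≤ D (+-monoˡ-≤ u u>0)) (≤-reflexive (eq u D)))
        where
        eq : ∀ u D → (u + u) * D ≡ 2 * D * u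
        eq = solve-∀
      2qΛ≤u : 2 * q * Λ ≤ u
      2qΛ≤u = ≤-trans (≤-trans (m≤n+m _ (2 * q * c₀ + q * (c₀ * Λ))) (≤-trans (m≤m+n _ (256 * c)) (n≤1+n _))) u₀≤u
      target : 4 * q * (84 * (q * (q * q) * u) + Λ) ≤ n
      target = begin
        4 * q * (84 * (q * (q * q) * u) + Λ) ≡⟨ eq q u Λ ⟩
        336 * (q * (q * (q * q))) * u + 2 * (2 * q * Λ) ≤⟨ +-monoʳ-≤ (336 * (q * (q * (q * q))) * u) (≤-trans (*-monoʳ-≤ 2 2qΛ≤u) (*-monoˡ-≤ u {2} {8} (s≤s (s≤s z≤n)))) ⟩
        336 * (q * (q * (q * q))) * u + 8 * u ≡⟨ trans (+-comm _ (8 * u)) (sym (*-distribʳ-+ u 8 (336 * (q * (q * (q * q)))))) ⟩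
        D * u ≤⟨ Du≤n ⟩
        n ∎
        where
        eq : ∀ q u Λ → 4 * q * (84 * (q * (q * q) * u) + Λ) ≡ 336 * (q * (q * (q * q))) * u + 2 * (2 * q * Λ)
        eq = solve-∀
      logarithm : 4 * (n * (n * n)) ≤ 2 ^ u
      logarithm = begin
        4 * (n * (n * n)) ≤⟨ *-monoʳ-≤ 4 (*-mono-≤ upper (*-mono-≤ upper upper)) ⟩
        4 * (W * u * (W * u * (W * u))) ≡⟨ eq W u ⟩
        c * (u * (u * u)) ≤⟨ exponential c u (≤-trans (≤-trans (m≤n+m _ (2 * q * c₀ + q * (c₀ * Λ) + 2 * q * Λ)) (n≤1+n _)) u₀≤u) ⟩
        2 ^ u ∎
        where
        eq : ∀ W u → 4 * (W * u * (W * u * (W * u))) ≡ 4 * (W * (W * W)) * (u * (u * u))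
        eq = solve-∀
      few : n * (2 * n * ((5 * q * Λ) * (5 * q * Λ))) < suc c₀ * (u * u)
      few = begin-strict
        n * (2 * n * K) ≤⟨ *-mono-≤ upper (*-monoˡ-≤ K (*-monoʳ-≤ 2 upper)) ⟩
        W * u * (2 * (W * u) * K) ≡⟨ eq W u K ⟩
        c₀ * (u * u) <⟨ m<n+m (c₀ * (u * u)) {u * u} (*-mono-≤ u>0 u>0) ⟩
        u * u + c₀ * (u * u) ∎
        where
        K : ℕ
        K = (5 * q * Λ) * (5 * q * Λ)
        eq : ∀ W u K → W * u * (2 * (W * u) * K) ≡ 2 * (W * W) * K * (u * u)
        eq = solve-∀

  -- Orientations of cycles as sign patterns.

  module Patterns {t : ℕ} (ℓ : Fin t → ℕ) (D : (k : Fin t) → Digraph (ℓ k)) (orient : ∀ k → IsCycleOrientation (D k)) where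

    place : ∀ k → Fin (ℓ k) → Fin (ℓ k)
    place k = proj₁ (orient k)

    place-injective : ∀ k {i j} → place k i ≡ place k j → i ≡ j
    place-injective k = proj₁ (proj₂ (orient k))

    -- Describing the direction at a position existentially avoids inverting the placement.
    Forward : Fin t × ℕ → Set
    Forward (k , a) = ∃ λ i → ∃ λ j → toℕ (place k i) ≡ a × CycStep (place k i) (place k j) × Edge (D k) i j

    cycStep? : ∀ {m} (a b : Fin m) → Dec (CycStep a b)
    cycStep? {m} a b = (suc (toℕ a) Data.Nat.≟ toℕ b) ⊎-dec ((suc (toℕ a) Data.Nat.≟ m) ×-dec (toℕ b Data.Nat.≟ 0))

    forward? : ∀ p → Dec (Forward p)
    forward? (k , a) = any? (λ i → any? (λ j → (toℕ (place k i) Data.Nat.≟ a) ×-dec (cycStep? (place k i) (place k j) ×-dec (adj (D k) i j ≟ᵇ true))))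

    sign : Fin t × ℕ → Bool
    sign p = does (forward? p)

    step-unique : ∀ {m} {a b c : Fin m} → CycStep a b → CycStep a c → b ≡ c
    step-unique (inj₁ e) (inj₁ f) = toℕ-injective (trans (sym e) f)
    step-unique {b = b} (inj₁ e) (inj₂ (f , _)) = ⊥-elim (<⇒≢ (toℕ<n b) (trans (sym e) f))
    step-unique {c = c} (inj₂ (f , _)) (inj₁ e) = ⊥-elim (<⇒≢ (toℕ<n c) (trans (sym e) f))
    step-unique (inj₂ (_ , e)) (inj₂ (_ , f)) = toℕ-injective (trans e (sym f))

    sign-forward : ∀ k i j → CycStep (place k i) (place k j) → Edge (D k) i j → sign (k , toℕ (place k i)) ≡ true
    sign-forward k i j st e = dec-true (forward? (k , toℕ (place k i))) (i , j , refl , st , e)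

    -- A forward witness at this position would involve the same two vertices, because a position
    -- has only one successor; it would then form a double edge with the given one.
    sign-backward : ∀ k i j → CycStep (place k j) (place k i) → Edge (D k) i j → sign (k , toℕ (place k j)) ≡ false
    sign-backward k i j st e = dec-false (forward? (k , toℕ (place k j))) absurd
      where
      absurd : ¬ Forward (k , toℕ (place k j))
      absurd (i′ , j′ , e′ , st′ , f) with place-injective k (toℕ-injective e′)
      ... | refl with place-injective k (step-unique st st′)
      ...   | refl = case trans (sym f) (proj₂ (proj₂ (proj₂ (proj₂ (orient k)))) i j e) of λ ()

    module _ (3≤ℓ : ∀ k → 3 ≤ ℓ k) {n : ℕ} (G : Digraph n) where
      open Walks G
      open Positions G ℓ 3≤ℓ sign

      next-step : ∀ k (a b : Fin (ℓ k)) → CycStep a b → next (k , toℕ a) ≡ (k , toℕ b)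
      next-step k a b (inj₁ e) = trans (next-suc k (toℕ a) (≤-trans (s≤s (≤-reflexive e)) (toℕ<n b))) (cong (k ,_) e)
      next-step k a b (inj₂ (e , f)) = trans (next-wrap k (toℕ a) e) (cong (k ,_) (sym f))

      copies : ∀ φ → Embedding φ → (∀ p → Valid p → ∃ λ v → φ p ≡ just v) → ContainsDisjointCopies ℓ D G
      copies φ emb total = f , (λ k → injective k , edges k) , (λ k k′ i i′ ne e → ne (,-injectiveˡ (same k k′ i i′ e)))
        where
        pos : ∀ k → Fin (ℓ k) → Pos
        pos k i = k , toℕ (place k i)
        f : ∀ k → Fin (ℓ k) → Fin n
        f k i = proj₁ (total (pos k i) (toℕ<n (place k i)))
        f-at : ∀ k i → φ (pos k i) ≡ just (f k i)
        f-at k i = proj₂ (total (pos k i) (toℕ<n (place k i)))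
        same : ∀ k k′ i i′ → f k i ≡ f k′ i′ → pos k i ≡ pos k′ i′
        same k k′ i i′ e = inj emb (pos k i) (pos k′ i′) (f k i) (f-at k i) (trans (f-at k′ i′) (cong just (sym e)))
        injective : ∀ k {i i′} → f k i ≡ f k i′ → i ≡ i′
        injective k {i} {i′} e = place-injective k (toℕ-injective (,-injectiveʳ (same k k i i′ e)))
        along : ∀ k i j → CycStep (place k i) (place k j) → E (sign (pos k i)) (f k i) (f k j) ≡ true
        along k i j st = edge emb (pos k i) (f k i) (f k j) (f-at k i) (trans (cong φ (next-step k _ _ st)) (f-at k j))
        edges : ∀ k i j → Edge (D k) i j → Edge G (f k i) (f k j)
        edges k i j e with proj₁ (proj₂ (proj₂ (orient k))) i j (inj₁ e)
        ... | inj₁ st = subst (λ σ → E σ (f k i) (f k j) ≡ true) (sign-forward k i j st e) (along k i j st)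
        ... | inj₂ st = subst (λ σ → E σ (f k j) (f k i) ≡ true) (sign-backward k i j st e) (along k j i st)

  -- Assembly.

  pack : ∀ η q L Λ → 1 ≤ q →
    (∀ a n d → ℕ→ℚ a ℚ.* ℚ.½ ℚ.+ η ℚ.* ℕ→ℚ n ℚ.≤ ℕ→ℚ d → q * a + 2 * n ≤ 2 * q * d) →
    4 ≤ L → L * L ≤ Λ → ∀ {t} (ℓ : Fin t → ℕ) → (∀ k → 3 ≤ ℓ k) → Constants q L Λ (sumFin ℓ) →
    (D : (k : Fin t) → Digraph (ℓ k)) → (∀ k → IsCycleOrientation (D k)) → (G : Digraph (sumFin ℓ)) →
    MinSemiDegreeAtLeast G (ℕ→ℚ (sumFin ℓ + t) ℚ.* ℚ.½ ℚ.+ η ℚ.* ℕ→ℚ (sumFin ℓ)) → ContainsDisjointCopies ℓ D G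
  pack η q L Λ q>0 bound 4≤L L*L≤Λ {t} ℓ 3≤ℓ cs D orient G δ = found spanning
    where
    open Patterns ℓ D orient
    open Constants cs
    open Walks G using (deg)
    degrees : ∀ σ v → q * (sumFin ℓ + t) + 2 * sumFin ℓ ≤ 2 * q * deg σ v (allFin (sumFin ℓ))
    degrees true v = bound (sumFin ℓ + t) (sumFin ℓ) (outdeg G v) (proj₁ (δ v))
    degrees false v = bound (sumFin ℓ + t) (sumFin ℓ) (indeg G v) (proj₂ (δ v))
    spanning : Packing.Spanning G ℓ 3≤ℓ sign refl positive q L Λ 4≤L L*L≤Λ
    spanning = Packing.embed G ℓ 3≤ℓ sign refl positive q L Λ 4≤L L*L≤Λ q>0 degrees u W c₀ target block upper lower constants logarithm few
    found : Packing.Spanning G ℓ 3≤ℓ sign refl positive q L Λ 4≤L L*L≤Λ → ContainsDisjointCopies ℓ D G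
    found (φ , emb , total) = copies 3≤ℓ G φ emb total

  threshold : ∀ η →
    (∃ λ q → 1 ≤ q × (∀ a n d → ℕ→ℚ a ℚ.* ℚ.½ ℚ.+ η ℚ.* ℕ→ℚ n ℚ.≤ ℕ→ℚ d → q * a + 2 * n ≤ 2 * q * d)) →
    Σ ℕ λ n₀ → ∀ t (ℓ : Fin t → ℕ) → (∀ k → 3 ≤ ℓ k) → n₀ ≤ sumFin ℓ →
      (D : (k : Fin t) → Digraph (ℓ k)) → (∀ k → IsCycleOrientation (D k)) → (G : Digraph (sumFin ℓ)) →
      MinSemiDegreeAtLeast G (ℕ→ℚ (sumFin ℓ + t) ℚ.* ℚ.½ ℚ.+ η ℚ.* ℕ→ℚ (sumFin ℓ)) → ContainsDisjointCopies ℓ D G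
  threshold η (q , q>0 , bound) =
    let n₀ , L , Λ , 4≤L , L*L≤Λ , enough = constants-exist q q>0
    in n₀ , λ t ℓ 3≤ℓ n₀≤n → pack η q L Λ q>0 bound 4≤L L*L≤Λ ℓ 3≤ℓ (enough (sumFin ℓ) n₀≤n)

open import Defs
open import Data.Nat using (ℕ; _≤_; _+_)
open import Data.Fin using (Fin)
open import Data.Product using (Σ; _×_)
open import Data.Rational using (ℚ; _<_; _*_; ½; 0ℚ)
import Data.Rational

theorem1p7 : (η : ℚ) → 0ℚ < η →
    Σ ℕ λ n₀ →
    (t : ℕ) (ℓ : Fin t → ℕ) → (∀ k → 3 ≤ ℓ k) → n₀ ≤ sumFin ℓ →
    (D : (k : Fin t) → Digraph (ℓ k)) → (∀ k → IsCycleOrientation (D k)) →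
    (G : Digraph (sumFin ℓ)) →
    MinSemiDegreeAtLeast G (ℕ→ℚ (sumFin ℓ + t) * ½ Data.Rational.+ η * ℕ→ℚ (sumFin ℓ)) →
    ContainsDisjointCopies ℓ D G
theorem1p7 η η>0 = Proof.threshold η (Proof.semidegree-bound η η>0)
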